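{- There exist absolute constants $c>0$ and $t_0$ such that for all integers $t\ge t_0$ and all integers $1\le s\le t$, \[ r_{K_s}(C_5,K_t)\ \ge\ \binom{\left\lfloor c\,\frac{t^{10/7}}{(\log t)^{13/7}}\right\rfloor}{s} \qquad\text{and}\qquad r_{K_s}(C_7,K_t)\ \ge\ \binom{\left\lfloor c\,\frac{t^{5/4}}{(\log t)^{3/2}}\right\rfloor}{s}. \]
   Context: For graphs $H_1,H_2$, a graph $G$ is $(H_1,H_2)$-Ramsey if every red/blue coloring of the edges of $G$ contains a red copy of $H_1$ or a blue copy of $H_2$. $r_{K_s}(H_1,H_2)$ denotes the minimum, over all $(H_1,H_2)$-Ramsey graphs $G$, of the number of copies of $K_s$ in $G$. $C_\ell$ denotes the cycle of length $\ell$. -}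

module Defs where

open import Data.Nat using (ℕ; zero; suc; _+_; _*_; _^_; _≤_; _<_; _%_)
open import Data.Nat.Base using (_≡ᵇ_)
open import Data.Bool using (Bool; true; false; _∧_; _∨_; not)
open import Data.Bool.Properties using (∨-comm)
open import Data.Fin using (Fin; toℕ; _≟_)
open import Data.Fin.Subset using (Subset; ∣_∣)
open import Data.Vec using (Vec; []; _∷_; lookup)
open import Data.List using (List; []; _∷_; map; _++_; length; filterᵇ; allFin)
open import Data.Bool.ListAction using (and)
open import Data.Product using (Σ; ∃; _×_; _,_)
open import Data.Sum using (_⊎_)
open import Function.Definitions using (Injective)
open import Relation.Nullary.Decidable using (⌊_⌋; yes; no)
open import Relation.Binary.PropositionalEquality using (_≡_; refl)

record Graph (n : ℕ) : Set where
  field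
    adj    : Fin n → Fin n → Bool
    sym    : ∀ u v → adj u v ≡ adj v u
    irrefl : ∀ u → adj u u ≡ false
open Graph public

K : (t : ℕ) → Graph t
K t = record { adj = λ i j → not ⌊ i ≟ j ⌋ ; sym = s ; irrefl = ir }
  where
  s : ∀ u v → not ⌊ u ≟ v ⌋ ≡ not ⌊ v ≟ u ⌋
  s u v with u ≟ v | v ≟ u
  ... | yes _ | yes _ = refl
  ... | no _  | no _  = refl
  ... | yes refl | no ¬p with ¬p refl
  ... | ()
  s u v | no ¬p | yes refl with ¬p refl
  ... | ()
  ir : ∀ u → not ⌊ u ≟ u ⌋ ≡ false
  ir u with u ≟ u
  ... | yes _ = refl
  ... | no ¬p with ¬p refl
  ... | ()

cycAdj : (m : ℕ) → Fin (suc m) → Fin (suc m) → Bool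
cycAdj m i j = ((suc (toℕ i) % suc m) ≡ᵇ toℕ j) ∨ ((suc (toℕ j) % suc m) ≡ᵇ toℕ i)

C₅ : Graph 5
C₅ = record { adj = cycAdj 4 ; sym = λ u v → ∨-comm ((suc (toℕ u) % 5) ≡ᵇ toℕ v) ((suc (toℕ v) % 5) ≡ᵇ toℕ u) ; irrefl = ir }
  where
  ir : ∀ u → cycAdj 4 u u ≡ false
  ir Fin.zero = refl
  ir (Fin.suc Fin.zero) = refl
  ir (Fin.suc (Fin.suc Fin.zero)) = refl
  ir (Fin.suc (Fin.suc (Fin.suc Fin.zero))) = refl
  ir (Fin.suc (Fin.suc (Fin.suc (Fin.suc Fin.zero)))) = refl

C₇ : Graph 7
C₇ = record { adj = cycAdj 6 ; sym = λ u v → ∨-comm ((suc (toℕ u) % 7) ≡ᵇ toℕ v) ((suc (toℕ v) % 7) ≡ᵇ toℕ u) ; irrefl = ir }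
  where
  ir : ∀ u → cycAdj 6 u u ≡ false
  ir Fin.zero = refl
  ir (Fin.suc Fin.zero) = refl
  ir (Fin.suc (Fin.suc Fin.zero)) = refl
  ir (Fin.suc (Fin.suc (Fin.suc Fin.zero))) = refl
  ir (Fin.suc (Fin.suc (Fin.suc (Fin.suc Fin.zero)))) = refl
  ir (Fin.suc (Fin.suc (Fin.suc (Fin.suc (Fin.suc Fin.zero))))) = refl
  ir (Fin.suc (Fin.suc (Fin.suc (Fin.suc (Fin.suc (Fin.suc Fin.zero)))))) = refl

-- A red/blue edge colouring of G is a symmetric map Fin n → Fin n → Bool
-- (true = red, false = blue); only its values on edges of G matter.
Colouring : ℕ → Set
Colouring n = Fin n → Fin n → Bool

IsSymmetricColouring : ∀ {n} → Colouring n → Set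
IsSymmetricColouring {n} col = ∀ (u v : Fin n) → col u v ≡ col v u

MonoCopy : ∀ {k n} → (H : Graph k) → (G : Graph n) → Colouring n → Bool → Set
MonoCopy {k} {n} H G col c =
  Σ (Fin k → Fin n) λ f →
    Injective _≡_ _≡_ f ×
    (∀ i j → adj H i j ≡ true → (adj G (f i) (f j) ≡ true × col (f i) (f j) ≡ c))

IsRamsey : ∀ {k₁ k₂ n} → Graph k₁ → Graph k₂ → Graph n → Set
IsRamsey H₁ H₂ G =
  ∀ col → IsSymmetricColouring col → MonoCopy H₁ G col true ⊎ MonoCopy H₂ G col false

allSubsets : (n : ℕ) → List (Subset n)
allSubsets zero = [] ∷ []
allSubsets (suc n) = map (true ∷_) (allSubsets n) ++ map (false ∷_) (allSubsets n)

allᵇ : ∀ {A : Set} → (A → Bool) → List A → Bool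
allᵇ f xs = and (map f xs)

isCliqueᵇ : ∀ {n} → Graph n → Subset n → Bool
isCliqueᵇ {n} G p =
  allᵇ (λ i → allᵇ (λ j → not (lookup p i ∧ lookup p j ∧ not ⌊ i ≟ j ⌋) ∨ adj G i j) (allFin n)) (allFin n)

numKs : ∀ {n} → ℕ → Graph n → ℕ
numKs {n} s G = length (filterᵇ (λ p → (∣ p ∣ ≡ᵇ s) ∧ isCliqueᵇ G p) (allSubsets n))

module Submission where

-- In characteristic 2, the affine parts of the Ree–Tits octagon (order q = 2^(2j+1)) and of the twisted triality
-- hexagon over F_(q³) are partial linear spaces in which a point and a slope determine a line and in which every
-- closed walk along at most 7, respectively 5, lines is degenerate. In each line the edges between two random sides are
-- kept. Along a degenerate walk the sides cancel, so this graph has no closed walk of length 7, respectively 5, while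
-- every not too small set of points contains a point with many neighbours inside the set; counting sequences
-- accordingly, only few t-tuples of points are independent. If G had too few copies of K_s, then it would have few
-- copies of K_t, and a random map from G to the points would send no K_t to an independent tuple: colouring the edges
-- of G by adjacency of the images avoids a red odd cycle and a blue K_t. The order q is the largest admissible odd power of 2.

open import Defs hiding (sym)
open import Data.Nat using (ℕ; zero; suc; _+_; _*_; _^_; _∸_; _≤_; _<_; z≤n; s≤s; _≤?_; _<?_; NonZero; >-nonZero; _/_; _%_)
open import Data.Nat.Base using (_≤ᵇ_; _<ᵇ_; _≡ᵇ_; _!)
open import Data.Nat.Combinatorics using (_C_; nCk+nC[k+1]≡[n+1]C[k+1])
open import Data.Nat.Combinatorics.Specification using (k>n⇒nCk≡0)
open import Data.Nat.DivMod using (_mod_; m/n*n≤m; m≡m%n+[m/n]*n; m%n<n; %-distribˡ-+; m<n⇒m%n≡m; m%n%n≡m%n; [m+kn]%n≡m%n)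
open import Data.Nat.Logarithm using (⌊log₂_⌋; ⌊log₂⌋-mono-≤; ⌊log₂[2^n]⌋≡n)
open import Data.Nat.Properties hiding (_≟_)
open import Data.Nat.Tactic.RingSolver using (solve-∀)
open import Axiom.UniquenessOfIdentityProofs.WithK using (uip)
open import Data.Bool as Bool using (Bool; true; false; _∧_; _∨_; not; if_then_else_; _xor_)
open import Data.Bool.ListAction using (and)
open import Data.Bool.Properties as Boolₚ using (∧-identityʳ; ∨-zeroʳ; xor-assoc; xor-comm; xor-same; ∧-distribʳ-xor; ∧-assoc; ∧-comm; ∧-zeroʳ)
open import Data.Empty using (⊥; ⊥-elim)
open import Data.Fin as Fin using (Fin; zero; suc; toℕ; inject≤; _≟_; combine; remQuot; _↑ˡ_; _↑ʳ_)
open import Data.Fin.Properties using (remQuot-combine; combine-remQuot; injective⇒≤; toℕ-fromℕ<; toℕ-injective; toℕ<n; toℕ-inject≤; inject≤-injective)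
open import Data.Fin.Subset using (Subset; ∣_∣)
open import Data.List as List using (List; []; _∷_; _++_; map; allFin; concatMap; filterᵇ)
open import Data.List.Membership.Propositional using (_∈_)
open import Data.List.Membership.Propositional.Properties using (∈-map⁺; ∈-allFin)
import Data.List.Relation.Unary.Any as Any
open import Data.Product using (∃; Σ; Σ-syntax; _×_; _,_; proj₁; proj₂)
open import Data.Sum using (_⊎_; inj₁; inj₂)
open import Data.Unit using (⊤; tt)
open import Data.Vec as Vec using (Vec; []; _∷_; lookup; tabulate; _[_]≔_)
open import Data.Vec.Properties using (lookup∘tabulate; tabulate∘lookup; tabulate-cong; lookup∘updateAt; lookup∘updateAt′)
open import Function using (_∘_)
open import Function.Definitions using (Injective)
open import Relation.Binary.PropositionalEquality
open import Relation.Nullary using (yes; no; ¬_; Dec)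
open import Relation.Nullary.Decidable using (⌊_⌋)

-- Finite sums

-- The random map from G to the points need not be injective, so a red odd cycle of G becomes only a
-- closed walk, and a blue clique only a tuple with possible repetitions. Hence all closed walks of
-- the given odd length must be excluded, and independent sequences are counted with repetition. The
-- polygons are not treated through incidence axioms. Lines are elements of a unipotent group,
-- points are cosets of one-parameter subgroups, and each change of line in a walk is multiplication
-- by one letter. A polynomial on the group expressing opposition vanishes on the shorter way round
-- a closed walk but not on the other, so the girth becomes a polynomial identity checked by
-- computation. There are q^11 points and q parallel classes of q^(d+1) lines. A set of 64 q^(d+1)
-- points contains a point adjacent to a fraction of order q^-d of the set. Counting independent
-- t-tuples works once t is of order q^d (log t)^2 and allows N of order q^f t with f = 10 - d; the
-- largest such q gives the exponent 1 + f/d. Here f/d is 3/7 for the hexagon and 2/8 for the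
-- octagon. Passing from K_s to K_t costs a factor exponential in t, which only changes the
-- constant.

private variable
  Ix Jx : Set
  n : ℕ

∑ : List Ix → (Ix → ℕ) → ℕ
∑ [] f = 0
∑ (x ∷ xs) f = f x + ∑ xs f

[_]ᵇ : Bool → ℕ
[ true ]ᵇ = 1
[ false ]ᵇ = 0

+-swap4 : ∀ a b c d → (a + b) + (c + d) ≡ (a + c) + (b + d)
+-swap4 a b c d = trans (+-assoc a b _) (trans (cong (a +_) (trans (sym (+-assoc b c d))
  (trans (cong (_+ d) (+-comm b c)) (+-assoc c b d)))) (sym (+-assoc a c _)))

∑-cong : ∀ (xs : List Ix) {f g} → (∀ x → f x ≡ g x) → ∑ xs f ≡ ∑ xs g
∑-cong [] e = refl
∑-cong (x ∷ xs) e = cong₂ _+_ (e x) (∑-cong xs e)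

∑-mono : ∀ (xs : List Ix) {f g} → (∀ x → f x ≤ g x) → ∑ xs f ≤ ∑ xs g
∑-mono [] h = z≤n
∑-mono (x ∷ xs) h = +-mono-≤ (h x) (∑-mono xs h)

∑-0 : ∀ (xs : List Ix) → ∑ xs (λ _ → 0) ≡ 0
∑-0 [] = refl
∑-0 (x ∷ xs) = ∑-0 xs

∑-+ : ∀ (xs : List Ix) f g → ∑ xs (λ x → f x + g x) ≡ ∑ xs f + ∑ xs g
∑-+ [] f g = refl
∑-+ (x ∷ xs) f g = trans (cong (f x + g x +_) (∑-+ xs f g)) (+-swap4 (f x) (g x) (∑ xs f) (∑ xs g))

∑-*ˡ : ∀ (xs : List Ix) c f → ∑ xs (λ x → c * f x) ≡ c * ∑ xs f
∑-*ˡ [] c f = sym (*-zeroʳ c)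
∑-*ˡ (x ∷ xs) c f = trans (cong (c * f x +_) (∑-*ˡ xs c f)) (sym (*-distribˡ-+ c (f x) _))

∑-*ʳ : ∀ (xs : List Ix) c f → ∑ xs (λ x → f x * c) ≡ ∑ xs f * c
∑-*ʳ xs c f = trans (∑-cong xs λ x → *-comm (f x) c) (trans (∑-*ˡ xs c f) (*-comm c _))

∑-swap : ∀ (xs : List Ix) (ys : List Jx) (f : Ix → Jx → ℕ) → ∑ xs (λ x → ∑ ys (f x)) ≡ ∑ ys (λ y → ∑ xs (λ x → f x y))
∑-swap [] ys f = sym (∑-0 ys)
∑-swap (x ∷ xs) ys f = trans (cong (∑ ys (f x) +_) (∑-swap xs ys f)) (sym (∑-+ ys (f x) _))

∑-++ : ∀ (xs ys : List Ix) f → ∑ (xs ++ ys) f ≡ ∑ xs f + ∑ ys f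
∑-++ [] ys f = refl
∑-++ (x ∷ xs) ys f = trans (cong (f x +_) (∑-++ xs ys f)) (sym (+-assoc (f x) _ _))

∑-map : ∀ (g : Ix → Jx) xs f → ∑ (map g xs) f ≡ ∑ xs (f ∘ g)
∑-map g [] f = refl
∑-map g (x ∷ xs) f = cong (f (g x) +_) (∑-map g xs f)

∑-concatMap : ∀ (g : Ix → List Jx) xs f → ∑ (concatMap g xs) f ≡ ∑ xs (λ x → ∑ (g x) f)
∑-concatMap g [] f = refl
∑-concatMap g (x ∷ xs) f = trans (∑-++ (g x) _ f) (cong (∑ (g x) f +_) (∑-concatMap g xs f))

length-filterᵇ : ∀ (p : Ix → Bool) xs → List.length (filterᵇ p xs) ≡ ∑ xs (λ x → [ p x ]ᵇ)
length-filterᵇ p [] = refl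
length-filterᵇ p (x ∷ xs) with p x
... | true = cong suc (length-filterᵇ p xs)
... | false = length-filterᵇ p xs

-- The averaging principle behind every random choice and every choice of a good vertex below: an
-- expectation is a sum over a finite list.
∑-witness : ∀ (xs : List Ix) f g → ∑ xs f < ∑ xs g → ∃ λ x → f x < g x
∑-witness [] f g ()
∑-witness (x ∷ xs) f g h with f x <? g x
... | yes p = x , p
... | no ¬p = ∑-witness xs f g (+-cancelˡ-< (g x) _ _ (≤-<-trans (+-monoˡ-≤ _ (≮⇒≥ ¬p)) h))

∑ᶠ : ∀ n → (Fin n → ℕ) → ℕ
∑ᶠ n = ∑ (allFin n)

∑-tabulate : ∀ n (g : Fin n → Ix) f → ∑ (List.tabulate g) f ≡ ∑ᶠ n (f ∘ g)
∑-tabulate zero g f = refl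
∑-tabulate (suc n) g f = cong (f (g zero) +_) (trans (∑-tabulate n (g ∘ suc) f) (sym (∑-tabulate n suc (f ∘ g))))

∑ᶠ-suc : ∀ n f → ∑ᶠ (suc n) f ≡ f zero + ∑ᶠ n (f ∘ suc)
∑ᶠ-suc n f = cong (f zero +_) (∑-tabulate n suc f)

∑ᶠ-const : ∀ n c → ∑ᶠ n (λ _ → c) ≡ n * c
∑ᶠ-const zero c = refl
∑ᶠ-const (suc n) c = trans (∑ᶠ-suc n _) (cong (c +_) (∑ᶠ-const n c))

∑ᶠ-≤ : ∀ n {f} c → (∀ i → f i ≤ c) → ∑ᶠ n f ≤ n * c
∑ᶠ-≤ n c h = ≤-trans (∑-mono (allFin n) h) (≤-reflexive (∑ᶠ-const n c))

term≤∑ᶠ : ∀ n f (i : Fin n) → f i ≤ ∑ᶠ n f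
term≤∑ᶠ (suc n) f zero = ≤-trans (m≤m+n _ _) (≤-reflexive (sym (∑ᶠ-suc n f)))
term≤∑ᶠ (suc n) f (suc i) = ≤-trans (term≤∑ᶠ n (f ∘ suc) i) (≤-trans (m≤n+m _ (f zero)) (≤-reflexive (sym (∑ᶠ-suc n f))))

size : (Fin n → Bool) → ℕ
size {n} a = ∑ᶠ n (λ i → [ a i ]ᵇ)

∑-allSubsets : ∀ N f → ∑ (allSubsets (suc N)) f ≡ ∑ (allSubsets N) (f ∘ (true ∷_)) + ∑ (allSubsets N) (f ∘ (false ∷_))
∑-allSubsets N f = trans (∑-++ (map (true ∷_) (allSubsets N)) _ f) (cong₂ _+_ (∑-map _ (allSubsets N) f) (∑-map _ (allSubsets N) f))

-- All maps from `Fin N` to `Fin n`, as vectors. Summing over this list replaces the expectation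
-- over a uniformly random map.
words : ∀ n N → List (Vec (Fin n) N)
words n zero = [] ∷ []
words n (suc N) = concatMap (λ i → map (i ∷_) (words n N)) (allFin n)

∑-words : ∀ n N f → ∑ (words n (suc N)) f ≡ ∑ᶠ n (λ i → ∑ (words n N) (λ v → f (i ∷ v)))
∑-words n N f = trans (∑-concatMap _ (allFin n) f) (∑-cong (allFin n) λ i → ∑-map (i ∷_) (words n N) f)

[]ᵇ≤1 : ∀ b → [ b ]ᵇ ≤ 1
[]ᵇ≤1 true = ≤-refl
[]ᵇ≤1 false = z≤n

[]ᵇ-∧ : ∀ a b → [ a ∧ b ]ᵇ ≡ [ a ]ᵇ * [ b ]ᵇ
[]ᵇ-∧ true b = sym (+-identityʳ _)
[]ᵇ-∧ false b = refl

*-swap4 : ∀ a b c d → (a * b) * (c * d) ≡ (a * c) * (b * d)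
*-swap4 a b c d = trans (*-assoc a b _) (trans (cong (a *_) (trans (sym (*-assoc b c d))
  (trans (cong (_* d) (*-comm b c)) (*-assoc c b d)))) (sym (*-assoc a c _)))

^-distribʳ-* : ∀ e a b → (a * b) ^ e ≡ a ^ e * b ^ e
^-distribʳ-* zero a b = refl
^-distribʳ-* (suc e) a b = trans (cong (a * b *_) (^-distribʳ-* e a b)) (*-swap4 a b _ _)

-- Independent sequences

module Independent {n : ℕ} (E : Fin n → Fin n → Bool) (E-sym : ∀ u v → E u v ≡ E v u) (E-irr : ∀ u → E u u ≡ false) where

  Set′ : Set
  Set′ = Fin n → Bool

  _∖N_ : Set′ → Fin n → Set′
  (A ∖N u) v = A v ∧ not (E u v)

  _∖_ : Set′ → Fin n → Set′
  (A ∖ u) v = A v ∧ not ⌊ u ≟ v ⌋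

  _⊑_ : Set′ → Set′ → Set
  A ⊑ B = ∀ v → A v ≡ true → B v ≡ true

  -- Entries may repeat: by irreflexivity u stays available after its neighbours have been removed.
  -- A random map that is not injective produces such tuples.
  count : ℕ → Set′ → ℕ
  count zero A = 1
  count (suc t) A = ∑ᶠ n λ u → [ A u ]ᵇ * count t (A ∖N u)

  ∧-true : ∀ {a b} → a ∧ b ≡ true → a ≡ true × b ≡ true
  ∧-true {true} {true} _ = refl , refl

  ∖N-mono : ∀ {A B} u → A ⊑ B → (A ∖N u) ⊑ (B ∖N u)
  ∖N-mono {A} u h v e with ∧-true {A v} e
  ... | a , b rewrite h v a = b

  count-mono : ∀ t {A B} → A ⊑ B → count t A ≤ count t B
  count-mono zero h = ≤-refl
  count-mono (suc t) {A} {B} h = ∑-mono (allFin n) λ u → go u (A u) refl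
    where
    go : ∀ u a → A u ≡ a → [ a ]ᵇ * count t (A ∖N u) ≤ [ B u ]ᵇ * count t (B ∖N u)
    go u false _ = z≤n
    go u true e rewrite h u e = +-monoˡ-≤ 0 (count-mono t (∖N-mono u h))

  ∖-comm : ∀ A u v → ((A ∖N u) ∖ v) ⊑ ((A ∖ v) ∖N u)
  ∖-comm A u v w e with A w | E u w | ⌊ v ≟ w ⌋
  ... | true | false | false = refl

  ∖N-comm : ∀ A u v → ((A ∖N u) ∖N v) ⊑ ((A ∖N v) ∖N u)
  ∖N-comm A u v w e with A w | E u w | E v w
  ... | true | false | false = refl

  -- Split according to whether v occurs in the sequence; removing one occurrence leaves a sequence avoiding N(v).
  count-split : ∀ t A v → count (suc t) A ≤ count (suc t) (A ∖ v) + [ A v ]ᵇ * (suc t * count t (A ∖N v))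
  count-split t A v = ≤-trans (∑-mono (allFin n) (bound t))
      (≤-trans (≤-reflexive (∑-+ (allFin n) (λ u → [ (A ∖ v) u ]ᵇ * count t ((A ∖ v) ∖N u)) (rest t)))
        (+-monoʳ-≤ (count (suc t) (A ∖ v)) (rest-sum t)))
    where
    -- Bounds the sequences with first entry u that contain v: either u is v itself, or v stands in
    -- one of the later positions and is deleted from there, so that u and the other entries avoid
    -- N(v).
    rest : ℕ → Fin n → ℕ
    rest zero u = if ⌊ v ≟ u ⌋ then [ A v ]ᵇ else 0
    rest (suc t) u = (if ⌊ v ≟ u ⌋ then [ A v ]ᵇ * count (suc t) (A ∖N v) else 0)
      + [ A v ]ᵇ * (suc t * ([ (A ∖N v) u ]ᵇ * count t ((A ∖N v) ∖N u)))

    avoid : ∀ t u → E v u ≡ true → (A ∖N u) ⊑ ((A ∖ v) ∖N u)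
    avoid t u e w h with v ≟ w
    ... | no _ with A w
    ...   | true = h
    avoid t u e w h | yes refl with A w | trans (E-sym u w) e
    ... | true | e′ rewrite e′ with () ← h

    bound-E : ∀ t u b → E v u ≡ b → count (suc t) (A ∖N u) ≤ count (suc t) ((A ∖ v) ∖N u)
                + [ A v ]ᵇ * (suc t * ([ not b ]ᵇ * count t ((A ∖N v) ∖N u)))
    bound-E t u true e = ≤-trans (count-mono (suc t) (avoid t u e)) (m≤m+n _ _)
    bound-E t u false e = ≤-trans (count-split t (A ∖N u) v) (+-mono-≤ (count-mono (suc t) (∖-comm A u v))
        (*-mono-≤ le (*-monoʳ-≤ (suc t) (≤-trans (count-mono t (∖N-comm A u v)) (≤-reflexive (sym (+-identityʳ _)))))))
      where
      le : [ (A ∖N u) v ]ᵇ ≤ [ A v ]ᵇ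
      le with A v
      ... | true = []ᵇ≤1 _
      ... | false = z≤n

    bound-yes : ∀ t a → A v ≡ a → [ a ]ᵇ * count t (A ∖N v) ≤ rest t v
    bound-yes t a e with v ≟ v in eq
    bound-yes zero a e | yes _ rewrite eq | e = ≤-reflexive (*-identityʳ _)
    bound-yes (suc t) a e | yes _ rewrite eq | e = m≤m+n _ _
    bound-yes t a e | no ¬p with () ← ¬p refl

    bound-no : ∀ t u → ¬ v ≡ u → ∀ a → A u ≡ a → [ a ]ᵇ * count t (A ∖N u) ≤ [ a ∧ true ]ᵇ * count t ((A ∖ v) ∖N u) + rest t u
    bound-no t u _ false _ = z≤n
    bound-no zero u _ true _ = s≤s z≤n
    bound-no (suc t) u v≢u true e with v ≟ u
    ... | yes p with () ← v≢u p
    ... | no _ rewrite e = ≤-trans (≤-reflexive (+-identityʳ _)) (≤-trans (bound-E t u (E v u) refl) (+-monoˡ-≤ ([ A v ]ᵇ * (suc t * ([ not (E v u) ]ᵇ * count t ((A ∖N v) ∖N u)))) (≤-reflexive (sym (+-identityʳ (count (suc t) ((A ∖ v) ∖N u)))))))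

    bound : ∀ t u → [ A u ]ᵇ * count t (A ∖N u) ≤ [ (A ∖ v) u ]ᵇ * count t ((A ∖ v) ∖N u) + rest t u
    bound t u with v ≟ u
    ... | yes refl = ≤-trans (bound-yes t (A u) refl) (m≤n+m _ _)
    ... | no ne = bound-no t u ne (A u) refl

    single : ∀ c → ∑ᶠ n (λ u → if ⌊ v ≟ u ⌋ then c else 0) ≤ c
    single c = go n v c
      where
      zeros : ∀ n → ∑ᶠ n (λ _ → 0) ≡ 0
      zeros n = ∑-0 (allFin n)
      go : ∀ n (v : Fin n) c → ∑ᶠ n (λ u → if ⌊ v ≟ u ⌋ then c else 0) ≤ c
      go (suc n) zero c = ≤-reflexive (trans (∑ᶠ-suc n (λ u → if ⌊ zero ≟ u ⌋ then c else 0)) (trans (cong (c +_) (zeros n)) (+-identityʳ c)))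
      go (suc n) (suc v) c = ≤-trans (≤-reflexive (trans (∑ᶠ-suc n (λ u → if ⌊ suc v ≟ u ⌋ then c else 0)) (∑-cong (allFin n) same))) (go n v c)
        where
        same : ∀ u → (if ⌊ suc v ≟ suc u ⌋ then c else 0) ≡ (if ⌊ v ≟ u ⌋ then c else 0)
        same u with v ≟ u
        ... | yes refl = refl
        ... | no _ = refl

    rest-sum : ∀ t → ∑ᶠ n (rest t) ≤ [ A v ]ᵇ * (suc t * count t (A ∖N v))
    rest-sum zero = ≤-trans (single _) (≤-reflexive (sym (*-identityʳ _)))
    rest-sum (suc t) = ≤-trans (≤-reflexive (∑-+ (allFin n) _ _)) (≤-trans (+-mono-≤ (single _)
        (≤-reflexive (trans (∑-*ˡ (allFin n) [ A v ]ᵇ _) (cong ([ A v ]ᵇ *_) (∑-*ˡ (allFin n) (suc t) _)))))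
      (≤-reflexive (sym (*-distribˡ-+ [ A v ]ᵇ (count (suc t) (A ∖N v)) _))))

  degree : Set′ → Fin n → ℕ
  degree A v = size λ u → A u ∧ E v u

  size-∖N : ∀ A v → size (A ∖N v) + degree A v ≡ size A
  size-∖N A v = trans (sym (∑-+ (allFin n) _ _)) (∑-cong (allFin n) λ u → go (A u) (E v u))
    where
    go : ∀ a e → [ a ∧ not e ]ᵇ + [ a ∧ e ]ᵇ ≡ [ a ]ᵇ
    go true true = refl
    go true false = refl
    go false _ = refl

  size-∖ : ∀ A v → A v ≡ true → suc (size (A ∖ v)) ≤ size A
  size-∖ A v e = subst₂ _≤_ (+-comm _ 1) (trans (sym (∑-+ (allFin n) _ _)) (∑-cong (allFin n) λ u → go (A u) ⌊ v ≟ u ⌋))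
    (+-monoʳ-≤ (size (A ∖ v)) (≤-trans here (term≤∑ᶠ n (λ u → [ A u ∧ ⌊ v ≟ u ⌋ ]ᵇ) v)))
    where
    go : ∀ a e → [ a ∧ not e ]ᵇ + [ a ∧ e ]ᵇ ≡ [ a ]ᵇ
    go true true = refl
    go true false = refl
    go false _ = refl
    here : 1 ≤ [ A v ∧ ⌊ v ≟ v ⌋ ]ᵇ
    here rewrite e with v ≟ v
    ... | yes _ = ≤-refl
    ... | no ne with () ← ne refl

  size≤n : ∀ A → size A ≤ n
  size≤n A = ≤-trans (∑ᶠ-≤ n 1 λ u → []ᵇ≤1 (A u)) (≤-reflexive (*-identityʳ n))

  count-trivial : ∀ t A X → size A ≤ X → count t A ≤ X ^ t
  count-trivial zero A X h = ≤-refl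
  count-trivial (suc t) A X h = ≤-trans (∑-mono (allFin n) λ u → *-monoʳ-≤ [ A u ]ᵇ
      (count-trivial t (A ∖N u) X (≤-trans (≤-trans (m≤m+n _ _) (≤-reflexive (size-∖N A u))) h)))
    (≤-trans (≤-reflexive (∑-*ʳ (allFin n) (X ^ t) _)) (*-monoˡ-≤ (X ^ t) h))

  module Bound (X M T : ℕ) (1≤X : 1 ≤ X)
    (dense : ∀ A → X ≤ size A → ∃ λ v → A v ≡ true × size A ≤ M * degree A v) where

    Y : ℕ
    Y = 1 + n * T

    1≤Y^ : ∀ j → 1 ≤ Y ^ j
    1≤Y^ j = m^n>0 Y j

    -- From d ≥ a/M and b = a - d one gets b (M + 1) ≤ a M, so removing a large neighbourhood gains
    -- one factor 1 + 1/M.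
    threshold : ∀ j a b d → b + d ≡ a → a ≤ M * d → a * M ^ suc j ≤ X * suc M ^ suc j → b * M ^ j ≤ X * suc M ^ j
    threshold j a b d refl a≤Md h = *-cancelʳ-≤ _ _ (suc M) (≤-trans (≤-reflexive eq₁) (≤-trans (*-monoˡ-≤ (M ^ j) le) (≤-trans (≤-reflexive eq₂)
        (≤-trans h (≤-reflexive eq₃)))))
      where
      le : b * suc M ≤ (b + d) * M
      le = ≤-trans (≤-reflexive (*-suc b M)) (≤-trans (+-monoˡ-≤ (b * M) (≤-trans (m≤m+n b d) a≤Md))
        (≤-reflexive (trans (+-comm (M * d) (b * M)) (trans (cong (b * M +_) (*-comm M d)) (sym (*-distribʳ-+ M b d))))))
      eq₁ : b * M ^ j * suc M ≡ b * suc M * M ^ j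
      eq₁ = trans (*-assoc b _ _) (trans (cong (b *_) (*-comm (M ^ j) _)) (sym (*-assoc b _ _)))
      eq₂ : (b + d) * M * M ^ j ≡ (b + d) * M ^ suc j
      eq₂ = *-assoc (b + d) M _
      eq₃ : X * suc M ^ suc j ≡ X * suc M ^ j * suc M
      eq₃ = trans (cong (X *_) (*-comm (suc M) _)) (sym (*-assoc X _ _))

    mutual
      -- The invariant is |A| ≤ X (1 + 1/M)^j, cleared of denominators. Passing to the
      -- non-neighbours of a dense vertex lowers j by one, so at most j entries are recorded by
      -- peeling, each at a cost of at most `Y`, which dominates the factor 1 + |A| t of one round.
      -- All other entries come from a set of at most X points.
      count-bound : ∀ j t A → t ≤ T → size A * M ^ j ≤ X * suc M ^ j → count t A ≤ X ^ t * Y ^ j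
      count-bound j zero A _ _ = ≤-trans (1≤Y^ j) (≤-reflexive (sym (+-identityʳ _)))
      count-bound zero (suc t) A _ h = ≤-trans (count-trivial (suc t) A X (subst₂ _≤_ (*-identityʳ _) (*-identityʳ _) h))
        (≤-reflexive (sym (*-identityʳ _)))
      count-bound (suc j) (suc t) A t<T h = ≤-trans (peel j t t<T (size A) A ≤-refl h)
        (≤-trans (*-monoʳ-≤ (X ^ suc t * Y ^ j) (+-monoʳ-≤ 1 (*-mono-≤ (size≤n A) t<T)))
          (≤-reflexive (trans (*-assoc (X ^ suc t) _ _) (cong (X ^ suc t *_) (*-comm (Y ^ j) Y)))))

      -- Each vertex taken out of A either is absent from the sequence or costs a factor t and shrinks A.
      peel : ∀ j t → suc t ≤ T → ∀ s A → size A ≤ s → size A * M ^ suc j ≤ X * suc M ^ suc j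
        → count (suc t) A ≤ X ^ suc t * Y ^ j * (1 + s * suc t)
      peel j t t<T s A A≤s h with X ≤? size A
      ... | no X≰ = ≤-trans (count-trivial (suc t) A X (<⇒≤ (≰⇒> X≰)))
        (≤-trans (≤-reflexive (sym (*-identityʳ _))) (≤-trans (*-monoʳ-≤ (X ^ suc t) (1≤Y^ j)) (≤-trans (≤-reflexive (sym (*-identityʳ _)))
          (*-monoʳ-≤ (X ^ suc t * Y ^ j) (s≤s z≤n)))))
      ... | yes X≤ with dense A X≤
      peel j t t<T zero A A≤s h | yes X≤ | v , Av , d with () ← ≤-trans (size-∖ A v Av) A≤s
      peel j t t<T (suc s) A A≤s h | yes X≤ | v , Av , d = ≤-trans (count-split t A v) (≤-trans (+-mono-≤ one two) (≤-reflexive eq))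
        where
        W = X ^ suc t * Y ^ j
        smaller : suc (size (A ∖ v)) ≤ size A
        smaller = size-∖ A v Av
        one : count (suc t) (A ∖ v) ≤ W * (1 + s * suc t)
        one = peel j t t<T s (A ∖ v) (≤-pred (≤-trans smaller A≤s)) (≤-trans (*-monoˡ-≤ (M ^ suc j) (<⇒≤ smaller)) h)
        two : [ A v ]ᵇ * (suc t * count t (A ∖N v)) ≤ suc t * W
        two rewrite Av = ≤-trans (≤-reflexive (+-identityʳ _)) (*-monoʳ-≤ (suc t) (≤-trans
          (count-bound j t (A ∖N v) (<⇒≤ t<T) (threshold j _ _ _ (size-∖N A v) d h))
          (*-monoˡ-≤ (Y ^ j) (≤-trans (≤-reflexive (sym (+-identityʳ _))) (*-monoˡ-≤ (X ^ t) 1≤X)))))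
        eq : W * (1 + s * suc t) + suc t * W ≡ W * (1 + suc s * suc t)
        eq = trans (cong (W * (1 + s * suc t) +_) (*-comm (suc t) W)) (trans (sym (*-distribˡ-+ W _ _)) (cong (W *_) (cong suc (+-comm (s * suc t) (suc t)))))

    bernoulli : ∀ k → M ^ k * (M + k) ≤ M * suc M ^ k
    bernoulli zero = ≤-reflexive (trans (+-identityʳ _) (trans (+-identityʳ M) (sym (*-identityʳ M))))
    bernoulli (suc k) = ≤-trans (≤-reflexive eq) (≤-trans (+-mono-≤ (*-monoʳ-≤ M (bernoulli k))
        (≤-trans (*-monoʳ-≤ (M ^ k) (m≤m+n M k)) (bernoulli k))) (≤-reflexive eq₂))
      where
      eq : M ^ suc k * (M + suc k) ≡ M * (M ^ k * (M + k)) + M ^ k * M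
      eq = trans (cong (M * M ^ k *_) (+-suc M k)) (trans (*-suc (M * M ^ k) (M + k))
        (trans (+-comm (M * M ^ k) _) (cong₂ _+_ (*-assoc M _ _) (*-comm M _))))
      eq₂ : M * (M * suc M ^ k) + M * suc M ^ k ≡ M * suc M ^ suc k
      eq₂ = trans (+-comm _ (M * suc M ^ k)) (trans (cong (M * suc M ^ k +_) (trans (sym (*-assoc M M _)) (trans (*-assoc M M _) refl)))
        (sym (trans (cong (M *_) refl) (*-distribˡ-+ M (suc M ^ k) (M * suc M ^ k)))))

    halving : 1 ≤ M → 2 * M ^ M ≤ suc M ^ M
    halving 1≤M = *-cancelˡ-≤ M ⦃ >-nonZero 1≤M ⦄ (≤-trans (≤-reflexive eq) (bernoulli M))
      where
      eq : M * (2 * M ^ M) ≡ M ^ M * (M + M)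
      eq = trans (*-comm M _) (trans (cong (_* M) (*-comm 2 (M ^ M))) (trans (*-assoc (M ^ M) 2 M) (cong (M ^ M *_) (cong (M +_) (+-identityʳ M)))))

    -- By Bernoulli (1 + 1/M)^M ≥ 2, so M rounds halve the set and M e rounds bring n ≤ 2^e X points
    -- down to X.
    count-all : ∀ e t → 1 ≤ M → t ≤ T → n ≤ 2 ^ e * X → count t (λ _ → true) ≤ X ^ t * Y ^ (M * e)
    count-all e t 1≤M t≤T n≤ = count-bound (M * e) t (λ _ → true) t≤T (≤-trans (*-monoˡ-≤ (M ^ (M * e)) (≤-trans (size≤n _) n≤)) le)
      where
      le : 2 ^ e * X * M ^ (M * e) ≤ X * suc M ^ (M * e)
      le = ≤-trans (≤-reflexive (trans (cong (_* M ^ (M * e)) (*-comm (2 ^ e) X)) (trans (*-assoc X _ _) (cong (X *_)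
          (trans (cong (2 ^ e *_) (sym (^-*-assoc M M e))) (sym (^-distribʳ-* e 2 (M ^ M))))))))
        (*-monoʳ-≤ X (≤-trans (^-monoˡ-≤ e (halving 1≤M)) (≤-reflexive (^-*-assoc (suc M) M e))))

-- Cliques

binom : ℕ → ℕ → ℕ
binom n zero = 1
binom zero (suc k) = 0
binom (suc n) (suc k) = binom n k + binom n (suc k)

C≡binom : ∀ n k → n C k ≡ binom n k
C≡binom n zero = refl
C≡binom zero (suc k) = k>n⇒nCk≡0 {0} {suc k} (s≤s z≤n)
C≡binom (suc n) (suc k) = trans (sym (nCk+nC[k+1]≡[n+1]C[k+1] n k)) (cong₂ _+_ (C≡binom n k) (C≡binom n (suc k)))

absorb : ∀ n k → suc k * binom (suc n) (suc k) ≡ suc n * binom n k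
absorb zero zero = refl
absorb zero (suc k) = *-zeroʳ k
absorb (suc n) zero = begin
  binom (suc (suc n)) 1 + 0 ≡⟨ +-identityʳ _ ⟩
  1 + binom (suc n) 1 ≡⟨ cong suc (trans (sym (+-identityʳ _)) (absorb n zero)) ⟩
  suc (suc n * 1) ∎
  where open ≡-Reasoning
absorb (suc n) (suc k) = begin
  suc (suc k) * (x + y) ≡⟨ *-distribˡ-+ (suc (suc k)) x y ⟩
  (x + suc k * x) + suc (suc k) * y ≡⟨ cong₂ (λ a b → (x + a) + b) (absorb n k) (absorb n (suc k)) ⟩
  (x + suc n * binom n k) + suc n * binom n (suc k) ≡⟨ +-assoc x _ _ ⟩
  x + (suc n * binom n k + suc n * binom n (suc k)) ≡⟨ cong (x +_) (sym (*-distribˡ-+ (suc n) (binom n k) _)) ⟩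
  suc (suc n) * x ∎
  where
  open ≡-Reasoning
  x = binom (suc n) (suc k)
  y = binom (suc n) (suc (suc k))

binom-! : ∀ n k → k ! * binom n k ≤ n ^ k
binom-! n zero = ≤-refl
binom-! zero (suc k) = ≤-reflexive (*-zeroʳ (suc k !))
binom-! (suc n) (suc k) = begin
  suc k * k ! * binom (suc n) (suc k) ≡⟨ trans (cong (_* binom (suc n) (suc k)) (*-comm (suc k) (k !))) (*-assoc (k !) (suc k) _) ⟩
  k ! * (suc k * binom (suc n) (suc k)) ≡⟨ cong (k ! *_) (absorb n k) ⟩
  k ! * (suc n * binom n k) ≡⟨ trans (sym (*-assoc (k !) _ _)) (trans (cong (_* binom n k) (*-comm (k !) (suc n))) (*-assoc (suc n) (k !) (binom n k))) ⟩
  suc n * (k ! * binom n k) ≤⟨ *-monoʳ-≤ (suc n) (≤-trans (binom-! n k) (^-monoˡ-≤ k (n≤1+n n))) ⟩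
  suc n * suc n ^ k ∎
  where open ≤-Reasoning

∧-true : ∀ {a b} → a ∧ b ≡ true → a ≡ true × b ≡ true
∧-true {true} {true} _ = refl , refl

true-not : ∀ {b} → b ≡ true → not b ≡ true → ⊥
true-not refl ()

not-true : ∀ {b} → not b ≡ true → b ≡ false
not-true {false} _ = refl

≡ᵇ-refl : ∀ k → (k ≡ᵇ k) ≡ true
≡ᵇ-refl zero = refl
≡ᵇ-refl (suc k) = ≡ᵇ-refl k

bool-ext : ∀ {a b} → (a ≡ true → b ≡ true) → (b ≡ true → a ≡ true) → a ≡ b
bool-ext {true} f g = sym (f refl)
bool-ext {false} {true} f g = g refl
bool-ext {false} {false} f g = refl

allᵇ-elim : ∀ {A : Set} n (f : A → Bool) (g : Fin n → A) → allᵇ f (List.tabulate g) ≡ true → ∀ i → f (g i) ≡ true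
allᵇ-elim (suc n) f g e zero = proj₁ (∧-true e)
allᵇ-elim (suc n) f g e (suc i) = allᵇ-elim n f (g ∘ suc) (proj₂ (∧-true {f (g zero)} e)) i

allᵇ-intro : ∀ {A : Set} n (f : A → Bool) (g : Fin n → A) → (∀ i → f (g i) ≡ true) → allᵇ f (List.tabulate g) ≡ true
allᵇ-intro zero f g h = refl
allᵇ-intro (suc n) f g h rewrite h zero = allᵇ-intro n f (g ∘ suc) (h ∘ suc)

∣∣-insert : ∀ {n} (p : Subset n) v → lookup p v ≡ false → ∣ p [ v ]≔ true ∣ ≡ suc ∣ p ∣
∣∣-insert (false ∷ p) zero refl = refl
∣∣-insert (true ∷ p) (suc v) e = cong suc (∣∣-insert p v e)
∣∣-insert (false ∷ p) (suc v) e = ∣∣-insert p v e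

∣∣-size : ∀ {n} (p : Subset n) → ∣ p ∣ ≡ size (lookup p)
∣∣-size [] = refl
∣∣-size {suc n} (true ∷ p) = trans (cong suc (∣∣-size p)) (sym (∑ᶠ-suc n (λ i → [ lookup (true ∷ p) i ]ᵇ)))
∣∣-size {suc n} (false ∷ p) = trans (∣∣-size p) (sym (∑ᶠ-suc n (λ i → [ lookup (false ∷ p) i ]ᵇ)))

-- Inserting v is a bijection from the sets that avoid v to the sets that contain it.
∑-containing : ∀ n (v : Fin n) (f : Subset n → ℕ) → ∑ (allSubsets n) (λ p → [ lookup p v ]ᵇ * f p)
  ≡ ∑ (allSubsets n) (λ p → [ not (lookup p v) ]ᵇ * f (p [ v ]≔ true))
∑-containing (suc n) zero f = trans (∑-allSubsets n (λ p → [ lookup p zero ]ᵇ * f p))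
  (trans (cong (∑ (allSubsets n) (λ p → f (true ∷ p) + 0) +_) (∑-0 (allSubsets n)))
    (trans (+-comm _ 0) (sym (trans (∑-allSubsets n (λ p → [ not (lookup p zero) ]ᵇ * f (p [ zero ]≔ true)))
      (cong (_+ ∑ (allSubsets n) (λ p → f (true ∷ p) + 0)) (∑-0 (allSubsets n)))))))
∑-containing (suc n) (suc v) f = trans (∑-allSubsets n (λ p → [ lookup p (suc v) ]ᵇ * f p))
  (trans (cong₂ _+_ (∑-containing n v (λ p → f (true ∷ p))) (∑-containing n v (λ p → f (false ∷ p))))
    (sym (∑-allSubsets n (λ p → [ not (lookup p (suc v)) ]ᵇ * f (p [ suc v ]≔ true)))))

module Clique {n : ℕ} (G : Graph n) where

  Set′ : Set
  Set′ = Fin n → Bool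

  _∖_ : Set′ → Fin n → Set′
  (W ∖ v) u = W u ∧ not ⌊ v ≟ u ⌋

  _∩N_ : Set′ → Fin n → Set′
  (W ∩N v) u = W u ∧ adj G v u

  inside : Set′ → Subset n → Bool
  inside W p = allᵇ (λ i → not (lookup p i) ∨ W i) (allFin n)

  isK : ℕ → Set′ → Subset n → Bool
  isK s W p = (∣ p ∣ ≡ᵇ s) ∧ (isCliqueᵇ G p ∧ inside W p)

  cliques : ℕ → Set′ → ℕ
  cliques s W = ∑ (allSubsets n) λ p → [ isK s W p ]ᵇ

  record IsK (s : ℕ) (W : Set′) (p : Subset n) : Set where
    constructor isk
    field
      card : ∣ p ∣ ≡ s
      complete : ∀ i j → lookup p i ≡ true → lookup p j ≡ true → ¬ i ≡ j → adj G i j ≡ true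
      within : ∀ i → lookup p i ≡ true → W i ≡ true
  open IsK

  isK-sound : ∀ s W p → isK s W p ≡ true → IsK s W p
  isK-sound s W p e with ∧-true {∣ p ∣ ≡ᵇ s} e
  ... | e₁ , e₂ with ∧-true {isCliqueᵇ G p} e₂
  ... | e₃ , e₄ = isk (≡ᵇ⇒≡ _ _ (subst Bool.T (sym e₁) _)) comp with′
    where
    comp : ∀ i j → lookup p i ≡ true → lookup p j ≡ true → ¬ i ≡ j → adj G i j ≡ true
    comp i j pi pj i≢j with allᵇ-elim n _ (λ k → k) (allᵇ-elim n _ (λ k → k) e₃ i) j
    ... | h rewrite pi | pj with i ≟ j
    ...   | yes i≡j = ⊥-elim (i≢j i≡j)
    ...   | no _ = h
    with′ : ∀ i → lookup p i ≡ true → W i ≡ true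
    with′ i pi with allᵇ-elim n _ (λ k → k) e₄ i
    ... | h rewrite pi = h

  isK-complete : ∀ s W p → IsK s W p → isK s W p ≡ true
  isK-complete s W p (isk refl c w) = cong₂ _∧_ (≡ᵇ-refl ∣ p ∣) (cong₂ _∧_ cl ins)
    where
    pair : ∀ i j a b → lookup p i ≡ a → lookup p j ≡ b → not (a ∧ b ∧ not ⌊ i ≟ j ⌋) ∨ adj G i j ≡ true
    pair i j false b _ _ = refl
    pair i j true false _ _ = refl
    pair i j true true pi pj with i ≟ j
    ... | yes _ = refl
    ... | no ne = c i j pi pj ne
    cl : isCliqueᵇ G p ≡ true
    cl = allᵇ-intro n _ (λ k → k) λ i → allᵇ-intro n _ (λ k → k) λ j → pair i j _ _ refl refl
    one : ∀ i a → lookup p i ≡ a → not a ∨ W i ≡ true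
    one i false _ = refl
    one i true pi = w i pi
    ins : inside W p ≡ true
    ins = allᵇ-intro n _ (λ k → k) λ i → one i _ refl

  avoiding : ∀ s W v p → [ not (lookup p v) ]ᵇ * [ isK s W p ]ᵇ ≡ [ isK s (W ∖ v) p ]ᵇ
  avoiding s W v p = trans (sym ([]ᵇ-∧ (not (lookup p v)) _)) (cong [_]ᵇ (bool-ext to from))
    where
    to : not (lookup p v) ∧ isK s W p ≡ true → isK s (W ∖ v) p ≡ true
    to e with ∧-true {not (lookup p v)} e
    ... | a , b with isK-sound s W p b
    ... | isk c d w = isK-complete s _ p (isk c d w′)
      where
      w′ : ∀ i → lookup p i ≡ true → (W ∖ v) i ≡ true
      w′ i pi with v ≟ i
      ... | yes refl = ⊥-elim (true-not pi a)
      ... | no _ rewrite w i pi = refl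
    from : isK s (W ∖ v) p ≡ true → not (lookup p v) ∧ isK s W p ≡ true
    from e with isK-sound s _ p e
    ... | isk c d w = cong₂ _∧_ (go _ refl) (isK-complete s W p (isk c d λ i pi → proj₁ (∧-true {W i} (w i pi))))
      where
      go : ∀ b → lookup p v ≡ b → not b ≡ true
      go false _ = refl
      go true pv with proj₂ (∧-true {W v} (w v pv))
      ... | h with v ≟ v
      ...   | no ne = ⊥-elim (ne refl)
      ...   | yes _ with () ← h

  containing : ∀ s W v p → [ not (lookup p v) ]ᵇ * [ isK (suc s) W (p [ v ]≔ true) ]ᵇ ≡ [ W v ]ᵇ * [ isK s (W ∩N v) p ]ᵇ
  containing s W v p = trans (sym ([]ᵇ-∧ (not (lookup p v)) _)) (trans (cong [_]ᵇ (bool-ext to from)) ([]ᵇ-∧ (W v) _))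
    where
    q = p [ v ]≔ true
    qv : lookup q v ≡ true
    qv = lookup∘updateAt v p
    qi : ∀ i → ¬ i ≡ v → lookup q i ≡ lookup p i
    qi i ne = lookup∘updateAt′ i v ne p
    p⊆q : ∀ i → lookup p i ≡ true → lookup q i ≡ true
    p⊆q i pi with i ≟ v
    ... | yes refl = qv
    ... | no ne = trans (qi i ne) pi
    to : not (lookup p v) ∧ isK (suc s) W q ≡ true → W v ∧ isK s (W ∩N v) p ≡ true
    to e with ∧-true {not (lookup p v)} e
    ... | a , b with isK-sound (suc s) W q b
    ... | isk c d w = cong₂ _∧_ (w v qv) (isK-complete s _ p (isk card′
            (λ i j pi pj ne → d i j (p⊆q i pi) (p⊆q j pj) ne)
            λ i pi → cong₂ _∧_ (w i (p⊆q i pi)) (d v i qv (p⊆q i pi) λ { refl → ⊥-elim (true-not pi a) })))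
      where
      pv : lookup p v ≡ false
      pv = not-true a
      card′ : ∣ p ∣ ≡ s
      card′ = suc-injective (trans (sym (∣∣-insert p v pv)) c)
    from : W v ∧ isK s (W ∩N v) p ≡ true → not (lookup p v) ∧ isK (suc s) W q ≡ true
    from e with ∧-true {W v} e
    ... | a , b with isK-sound s _ p b
    ... | isk c d w = cong₂ _∧_ (cong not pv) (isK-complete (suc s) W q (isk (trans (∣∣-insert p v pv) (cong suc c)) d′ w′))
      where
      pv : lookup p v ≡ false
      pv = go _ refl
        where
        go : ∀ b → lookup p v ≡ b → b ≡ false
        go false _ = refl
        go true h with trans (sym (irrefl G v)) (proj₂ (∧-true {W v} (w v h)))
        ... | ()
      nbr : ∀ i → lookup p i ≡ true → adj G v i ≡ true
      nbr i pi = proj₂ (∧-true {W i} (w i pi))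
      d′ : ∀ i j → lookup q i ≡ true → lookup q j ≡ true → ¬ i ≡ j → adj G i j ≡ true
      d′ i j hi hj ne with i ≟ v | j ≟ v
      ... | yes refl | yes refl = ⊥-elim (ne refl)
      ... | yes refl | no nj = nbr j (trans (sym (qi j nj)) hj)
      ... | no ni | yes refl = trans (Graph.sym G i v) (nbr i (trans (sym (qi i ni)) hi))
      ... | no ni | no nj = d i j (trans (sym (qi i ni)) hi) (trans (sym (qi j nj)) hj) ne
      w′ : ∀ i → lookup q i ≡ true → W i ≡ true
      w′ i hi with i ≟ v
      ... | yes refl = a
      ... | no ni = proj₁ (∧-true {W i} (w i (trans (sym (qi i ni)) hi)))

  cliques-at : ∀ s W v → ∑ (allSubsets n) (λ p → [ lookup p v ]ᵇ * [ isK (suc s) W p ]ᵇ) ≡ [ W v ]ᵇ * cliques s (W ∩N v)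
  cliques-at s W v = trans (∑-containing n v (λ p → [ isK (suc s) W p ]ᵇ)) (trans (∑-cong (allSubsets n) (containing s W v))
    (∑-*ˡ (allSubsets n) [ W v ]ᵇ _))

  cliques-split : ∀ s W v → cliques (suc s) W ≡ cliques (suc s) (W ∖ v) + [ W v ]ᵇ * cliques s (W ∩N v)
  cliques-split s W v = trans (∑-cong (allSubsets n) λ p → sym (both (lookup p v) _)) (trans (∑-+ (allSubsets n) _ _)
      (cong₂ _+_ (∑-cong (allSubsets n) (avoiding (suc s) W v)) (cliques-at s W v)))
    where
    both : ∀ b k → [ not b ]ᵇ * k + [ b ]ᵇ * k ≡ k
    both true k = +-identityʳ k
    both false k = trans (+-identityʳ _) (+-identityʳ k)

  -- Double counting of pairs of a clique and one of its vertices.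
  cliques-count : ∀ s W → suc s * cliques (suc s) W ≡ ∑ᶠ n λ v → [ W v ]ᵇ * cliques s (W ∩N v)
  cliques-count s W = trans (sym (∑-*ˡ (allSubsets n) (suc s) _)) (trans (∑-cong (allSubsets n) weigh)
      (trans (sym (∑-swap (allFin n) (allSubsets n) _)) (∑-cong (allFin n) (cliques-at s W))))
    where
    weigh : ∀ p → suc s * [ isK (suc s) W p ]ᵇ ≡ ∑ᶠ n (λ v → [ lookup p v ]ᵇ * [ isK (suc s) W p ]ᵇ)
    weigh p = trans (go _ refl) (sym (∑-*ʳ (allFin n) [ isK (suc s) W p ]ᵇ (λ v → [ lookup p v ]ᵇ)))
      where
      go : ∀ b → isK (suc s) W p ≡ b → suc s * [ b ]ᵇ ≡ size (lookup p) * [ b ]ᵇ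
      go false _ = trans (*-zeroʳ (suc s)) (sym (*-zeroʳ (size (lookup p))))
      go true e = cong (_* 1) (trans (sym (card (isK-sound (suc s) W p e))) (∣∣-size p))

  size-∖ : ∀ W v → W v ≡ true → suc (size (W ∖ v)) ≤ size W
  size-∖ W v e = subst₂ _≤_ (+-comm _ 1) (trans (sym (∑-+ (allFin n) _ _)) (∑-cong (allFin n) λ u → go (W u) ⌊ v ≟ u ⌋))
    (+-monoʳ-≤ (size (W ∖ v)) (≤-trans here (term≤∑ᶠ n (λ u → [ W u ∧ ⌊ v ≟ u ⌋ ]ᵇ) v)))
    where
    go : ∀ a e → [ a ∧ not e ]ᵇ + [ a ∧ e ]ᵇ ≡ [ a ]ᵇ
    go true true = refl
    go true false = refl
    go false _ = refl
    here : 1 ≤ [ W v ∧ ⌊ v ≟ v ⌋ ]ᵇ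
    here rewrite e with v ≟ v
    ... | yes _ = ≤-refl
    ... | no ne with () ← ne refl

  size-∩N : ∀ W v → size (W ∩N v) ≤ size (W ∖ v)
  size-∩N W v = ∑-mono (allFin n) go
    where
    go : ∀ u → [ W u ∧ adj G v u ]ᵇ ≤ [ W u ∧ not ⌊ v ≟ u ⌋ ]ᵇ
    go u with v ≟ u
    ... | yes refl rewrite irrefl G v = ≤-refl
    ... | no _ with W u
    ...   | true = []ᵇ≤1 _
    ...   | false = z≤n

  empty-or-member : ∀ W → size W ≡ 0 ⊎ ∃ λ v → W v ≡ true
  empty-or-member W with size W in eq
  ... | zero = inj₁ refl
  ... | suc w with ∑-witness (allFin n) (λ _ → 0) (λ u → [ W u ]ᵇ)
                     (subst₂ _<_ (sym (∑-0 (allFin n))) (sym eq) (s≤s z≤n))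
  ...   | v , h with W v in e
  ...     | true = inj₂ (v , e)

  cliques-empty : ∀ s W → size W ≡ 0 → cliques (suc s) W ≡ 0
  cliques-empty s W e = cancel s (trans (cliques-count s W) (n≤0⇒n≡0 (≤-trans (∑-mono (allFin n) none) (≤-reflexive (∑-0 (allFin n))))))
    where
    none : ∀ v → [ W v ]ᵇ * cliques s (W ∩N v) ≤ 0
    none v with W v in wv
    ... | false = z≤n
    ... | true with () ← ≤-trans (≤-trans (≤-reflexive (cong [_]ᵇ (sym wv))) (term≤∑ᶠ n (λ u → [ W u ]ᵇ) v)) (≤-reflexive e)
    cancel : ∀ m {n} → suc m * n ≡ 0 → n ≡ 0
    cancel m {zero} _ = refl

  cliques-zero : ∀ W → cliques 0 W ≡ 1
  cliques-zero W = trans (∑-cong (allSubsets n) λ p → cong [_]ᵇ (bool-ext (λ e → sub p e) (λ e → sup p e))) (one n)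
    where
    one : ∀ n → ∑ (allSubsets n) (λ p → [ ∣ p ∣ ≡ᵇ 0 ]ᵇ) ≡ 1
    one zero = refl
    one (suc n) = trans (∑-allSubsets n _) (cong₂ _+_ (∑-0 (allSubsets n)) (one n))
    sub : ∀ p → isK 0 W p ≡ true → (∣ p ∣ ≡ᵇ 0) ≡ true
    sub p e = proj₁ (∧-true {∣ p ∣ ≡ᵇ 0} e)
    none : ∀ {n} (p : Subset n) → ∣ p ∣ ≡ 0 → ∀ i → lookup p i ≡ true → ⊥
    none (false ∷ p) e (suc i) pi = none p e i pi
    sup : ∀ p → (∣ p ∣ ≡ᵇ 0) ≡ true → isK 0 W p ≡ true
    sup p e = isK-complete 0 W p (isk c (λ i _ pi → ⊥-elim (none p c i pi)) (λ i pi → ⊥-elim (none p c i pi)))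
      where
      c : ∣ p ∣ ≡ 0
      c = ≡ᵇ⇒≡ _ _ (subst Bool.T (sym e) _)

  -- In both lemmas a vertex v of W is removed: the cliques through v are the cliques of W ∩ N(v).
  cliques-bound : ∀ w d W → size W ≤ w → cliques d W ≤ binom w d
  cliques-bound w zero W _ = ≤-reflexive (cliques-zero W)
  cliques-bound w (suc d) W h with empty-or-member W
  ... | inj₁ e = ≤-trans (≤-reflexive (cliques-empty d W e)) z≤n
  cliques-bound zero (suc d) W h | inj₂ (v , Wv) with () ← ≤-trans (size-∖ W v Wv) h
  cliques-bound (suc w) (suc d) W h | inj₂ (v , Wv) = ≤-trans (≤-reflexive (trans (cliques-split d W v) (+-comm _ ([ W v ]ᵇ * _))))
      (+-mono-≤ (≤-trans (*-monoˡ-≤ _ ([]ᵇ≤1 (W v))) (≤-trans (≤-reflexive (+-identityʳ _)) (cliques-bound w d (W ∩N v) (≤-trans (size-∩N W v) smaller))))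
        (cliques-bound w (suc d) (W ∖ v) smaller))
    where
    smaller : size (W ∖ v) ≤ w
    smaller = ≤-pred (≤-trans (size-∖ W v Wv) h)

  remove : ∀ s d W v r → W v ≡ true → cliques (suc s + d) (W ∖ v) ≤ cliques (suc s) (W ∖ v) * r → cliques (s + d) (W ∩N v) ≤ cliques s (W ∩N v) * r
    → cliques (suc s + d) W ≤ cliques (suc s) W * r
  remove s d W v r Wv h₁ h₂ = ≤-trans (≤-reflexive (trans (cliques-split (s + d) W v) (cong (λ b → cliques (suc s + d) (W ∖ v) + [ b ]ᵇ * cliques (s + d) (W ∩N v)) Wv)))
    (≤-trans (+-mono-≤ h₁ (≤-trans (≤-reflexive (+-identityʳ _)) h₂)) (≤-reflexive (trans (sym (*-distribʳ-+ r (cliques (suc s) (W ∖ v)) (cliques s (W ∩N v))))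
      (cong (_* r) (sym (trans (cliques-split s W v) (trans (cong (λ b → cliques (suc s) (W ∖ v) + [ b ]ᵇ * cliques s (W ∩N v)) Wv) (cong (cliques (suc s) (W ∖ v) +_) (+-identityʳ _)))))))))

  -- The difference N - s is the same for the cliques through v, where both N and s drop by one;
  -- this is what keeps the binomial factor constant along the induction. At s = 0 it is the bound
  -- for all d-subsets of N points.
  extend-small : ∀ s d w N W → size W ≤ w → w ≤ N → cliques (s + d) W ≤ cliques s W * binom (N ∸ s) d
  extend-small zero d w N W h w≤N = ≤-trans (cliques-bound N d W (≤-trans h w≤N)) (≤-reflexive (trans (sym (+-identityʳ _)) (cong (_* binom N d) (sym (cliques-zero W)))))
  extend-small (suc s) d w N W h w≤N with empty-or-member W
  ... | inj₁ e = ≤-trans (≤-reflexive (cliques-empty (s + d) W e)) z≤n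
  extend-small (suc s) d zero N W h w≤N | inj₂ (v , Wv) with () ← ≤-trans (size-∖ W v Wv) h
  extend-small (suc s) d (suc w) (suc N) W h (s≤s w≤N) | inj₂ (v , Wv) = remove s d W v _ Wv
      (extend-small (suc s) d w (suc N) (W ∖ v) smaller (≤-trans w≤N (n≤1+n N)))
      (extend-small s d w N (W ∩N v) (≤-trans (size-∩N W v) smaller) w≤N)
    where
    smaller : size (W ∖ v) ≤ w
    smaller = ≤-pred (≤-trans (size-∖ W v Wv) h)

  -- If every vertex of W had at least `binom N s` cliques in its neighbourhood, double counting
  -- would give at least (N + 1) `binom N s` incidences, which is (s + 1) `binom (suc N) (suc s)` by
  -- absorption.
  sparse-vertex : ∀ s N W → suc N ≤ size W → cliques (suc s) W < binom (suc N) (suc s) → ∃ λ v → W v ≡ true × cliques s (W ∩N v) < binom N s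
  sparse-vertex s N W big few with ∑-witness (allFin n) (λ v → [ W v ]ᵇ * cliques s (W ∩N v)) (λ v → [ W v ]ᵇ * binom N s)
      (<-≤-trans (subst (_< suc s * binom (suc N) (suc s)) (cliques-count s W) (*-monoʳ-< (suc s) few))
        (≤-trans (≤-reflexive (absorb N s)) (≤-trans (*-monoˡ-≤ (binom N s) big) (≤-reflexive (sym (∑-*ʳ (allFin n) (binom N s) _))))))
  ... | v , h with W v in Wv
  ...   | true = v , Wv , subst₂ _<_ (+-identityʳ _) (+-identityʳ _) h

  -- A weak form of the Kruskal-Katona theorem. The sharp form would divide by the binomial
  -- coefficient of s + d + 1 over s + 1; this factor is at most exponential in the clique size and
  -- is absorbed into the constant later. While W has more than N vertices, a sparse vertex is
  -- removed: both W without it and its neighbourhood again have few cliques.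
  extend : ∀ s d w N W → size W ≤ w → cliques (suc s) W < binom N (suc s) → cliques (suc s + d) W ≤ cliques (suc s) W * binom (N ∸ suc s) d
  extend s d w zero W h ()
  extend s d w (suc N) W h few with size W ≤? suc N
  ... | yes small = extend-small (suc s) d (size W) (suc N) W ≤-refl small
  ... | no large with sparse-vertex s N W (<⇒≤ (≰⇒> large)) few
  extend s d zero (suc N) W h few | no large | v , Wv , fv with () ← ≤-trans (size-∖ W v Wv) h
  extend zero d (suc w) (suc N) W h few | no large | v , Wv , fv = ⊥-elim (<-irrefl (cliques-zero (W ∩N v)) fv)
  extend (suc s) d (suc w) (suc N) W h few | no large | v , Wv , fv = remove (suc s) d W v _ Wv
      (extend (suc s) d w (suc N) (W ∖ v) smaller (≤-<-trans (≤-trans (m≤m+n _ _) (≤-reflexive (sym (cliques-split (suc s) W v)))) few))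
      (extend s d w N (W ∩N v) (≤-trans (size-∩N W v) smaller) fv)
    where
    smaller : size (W ∖ v) ≤ w
    smaller = ≤-pred (≤-trans (size-∖ W v Wv) h)

  numKs≡cliques : ∀ s → numKs s G ≡ cliques s (λ _ → true)
  numKs≡cliques s = trans (length-filterᵇ _ (allSubsets n)) (∑-cong (allSubsets n) λ p → cong [_]ᵇ (cong ((∣ p ∣ ≡ᵇ s) ∧_) (sym (drop p))))
    where
    drop : ∀ p → isCliqueᵇ G p ∧ inside (λ _ → true) p ≡ isCliqueᵇ G p
    drop p rewrite allᵇ-intro n (λ i → not (lookup p i) ∨ true) (λ k → k) (λ i → ∨-zeroʳ (not (lookup p i))) = ∧-identityʳ _

  few-cliques : ∀ s d N → numKs (suc s) G < N C suc s → numKs (suc s + d) G ≤ binom N (suc s) * binom (N ∸ suc s) d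
  few-cliques s d N few rewrite numKs≡cliques (suc s) | numKs≡cliques (suc s + d) | C≡binom N (suc s) =
    ≤-trans (extend s d _ N (λ _ → true) ≤-refl few) (*-monoˡ-≤ _ (<⇒≤ few))

-- Powers against factorials

rising : ℕ → ℕ → ℕ
rising x zero = 1
rising x (suc s) = suc x * rising (suc x) s

rising-last : ∀ x s → rising x (suc s) ≡ rising x s * (x + suc s)
rising-last x zero = trans (*-identityʳ (suc x)) (trans (sym (+-comm x 1)) (sym (+-identityʳ _)))
rising-last x (suc s) = trans (cong (suc x *_) (rising-last (suc x) s)) (trans (sym (*-assoc (suc x) (rising (suc x) s) _))
  (cong (suc x * rising (suc x) s *_) (sym (+-suc x (suc s)))))

^≤rising : ∀ x s → x ^ s ≤ rising x s
^≤rising x zero = ≤-refl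
^≤rising x (suc s) = *-mono-≤ (n≤1+n x) (≤-trans (^-monoˡ-≤ s (n≤1+n x)) (^≤rising (suc x) s))

rising-0 : ∀ s → rising 0 s ≡ s !
rising-0 zero = refl
rising-0 (suc s) = trans (rising-last 0 s) (trans (*-comm (rising 0 s) (suc s)) (cong (suc s *_) (rising-0 s)))

-- This is s! times the bound of the binomial coefficient of x + s over s by 2^(x + s); the
-- induction is Pascal's rule multiplied by s!.
rising≤ : ∀ x s → rising x s ≤ s ! * 2 ^ (x + s)
rising≤ x zero = ≤-trans (m^n>0 2 (x + 0)) (≤-reflexive (sym (+-identityʳ _)))
rising≤ zero (suc s) = ≤-trans (≤-reflexive (trans (rising-0 (suc s)) (sym (*-identityʳ _)))) (*-monoʳ-≤ (suc s !) (m^n>0 2 (suc s)))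
rising≤ (suc x) (suc s) = begin
  rising (suc x) (suc s) ≡⟨ trans (rising-last (suc x) s) (trans (*-comm (rising (suc x) s) _) (*-distribʳ-+ (rising (suc x) s) (suc x) (suc s))) ⟩
  rising x (suc s) + suc s * rising (suc x) s ≤⟨ +-mono-≤ (rising≤ x (suc s)) (*-monoʳ-≤ (suc s) (rising≤ (suc x) s)) ⟩
  suc s ! * 2 ^ (x + suc s) + suc s * (s ! * 2 ^ (suc x + s)) ≡⟨ cong₂ (λ a b → suc s ! * a + b) refl (trans (sym (*-assoc (suc s) (s !) _)) (cong (λ k → suc s ! * 2 ^ k) (sym (+-suc x s)))) ⟩
  suc s ! * 2 ^ (x + suc s) + suc s ! * 2 ^ (x + suc s) ≡⟨ trans (sym (*-distribˡ-+ (suc s !) (2 ^ (x + suc s)) _)) (cong (λ z → suc s ! * (2 ^ (x + suc s) + z)) (sym (+-identityʳ _))) ⟩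
  suc s ! * 2 ^ (suc x + suc s) ∎
  where open ≤-Reasoning

^≤! : ∀ x s → x ^ s ≤ s ! * 2 ^ (x + s)
^≤! x s = ≤-trans (^≤rising x s) (rising≤ x s)

-- With t = s + d, the powers t^s and t^d cost 2^(t+s) and 2^(t+d); the exponents add up to 3t,
-- whence the 8.
binom-product : ∀ s d N → binom N s * binom (N ∸ s) d * (s + d) ^ (s + d) ≤ (8 * N) ^ (s + d)
binom-product s d N = begin
  a * b * t ^ t ≡⟨ cong (a * b *_) (^-distribˡ-+-* t s d) ⟩
  a * b * (t ^ s * t ^ d) ≤⟨ *-monoʳ-≤ (a * b) (*-mono-≤ (^≤! t s) (^≤! t d)) ⟩
  a * b * ((s ! * 2 ^ (t + s)) * (d ! * 2 ^ (t + d))) ≡⟨ cong (a * b *_) (*-swap4 (s !) _ (d !) _) ⟩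
  a * b * ((s ! * d !) * (2 ^ (t + s) * 2 ^ (t + d))) ≡⟨ sym (*-assoc (a * b) _ _) ⟩
  a * b * (s ! * d !) * (2 ^ (t + s) * 2 ^ (t + d)) ≡⟨ cong₂ _*_ (trans (*-swap4 a b (s !) (d !)) (cong₂ _*_ (*-comm a (s !)) (*-comm b (d !)))) two ⟩
  (s ! * a) * (d ! * b) * 8 ^ t ≤⟨ *-monoˡ-≤ (8 ^ t) (*-mono-≤ (binom-! N s) (≤-trans (binom-! (N ∸ s) d) (^-monoˡ-≤ d (m∸n≤m N s)))) ⟩
  N ^ s * N ^ d * 8 ^ t ≡⟨ trans (cong (_* 8 ^ t) (sym (^-distribˡ-+-* N s d))) (trans (*-comm (N ^ t) _) (sym (^-distribʳ-* t 8 N))) ⟩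
  (8 * N) ^ t ∎
  where
  open ≤-Reasoning
  t = s + d
  a = binom N s
  b = binom (N ∸ s) d
  two : 2 ^ (t + s) * 2 ^ (t + d) ≡ 8 ^ t
  two = trans (sym (^-distribˡ-+-* 2 (t + s) (t + d))) (trans (cong (2 ^_) (trans (+-swap4 t s t d) (trans (+-assoc t t t)
    (cong (λ z → t + (t + z)) (sym (+-identityʳ t)))))) (sym (^-*-assoc 2 3 t)))

-- Random sides of lines

_==_ : Bool → Bool → Bool
true == b = b
false == b = not b

agreement : ∀ {L} → (mask c : Fin L → Bool) → Subset L → ℕ
agreement mask c s = size λ i → mask i ∧ (lookup s i == c i)

-- The exponential moment factors over coordinates: 1 + 8 on the mask and 2 off it. The power of 2
-- on the left clears the denominator in 2^(L - |mask|).
∑-8^agreement : ∀ L (mask c : Fin L → Bool) →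
  ∑ (allSubsets L) (λ s → 8 ^ agreement mask c s) * 2 ^ size mask ≡ 9 ^ size mask * 2 ^ L
∑-8^agreement zero mask c = refl
∑-8^agreement (suc L) mask c = begin
  ∑ (allSubsets (suc L)) (λ s → 8 ^ agreement mask c s) * 2 ^ size mask
    ≡⟨ cong₂ _*_ (∑-allSubsets L (λ s → 8 ^ agreement mask c s)) (cong (2 ^_) (∑ᶠ-suc L (λ i → [ mask i ]ᵇ))) ⟩
  (∑ (allSubsets L) (λ s → 8 ^ agreement mask c (true ∷ s)) + ∑ (allSubsets L) (λ s → 8 ^ agreement mask c (false ∷ s))) * 2 ^ ([ mask zero ]ᵇ + size (mask ∘ suc))
    ≡⟨ cong (λ z → z * 2 ^ ([ mask zero ]ᵇ + size (mask ∘ suc))) (cong₂ _+_ (head true) (head false)) ⟩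
  (8 ^ [ mask zero ∧ (true == c zero) ]ᵇ * Z + 8 ^ [ mask zero ∧ (false == c zero) ]ᵇ * Z) * 2 ^ ([ mask zero ]ᵇ + size (mask ∘ suc))
    ≡⟨ final (mask zero) (c zero) ⟩
  9 ^ ([ mask zero ]ᵇ + size (mask ∘ suc)) * 2 ^ suc L
    ≡⟨ cong (λ z → 9 ^ z * 2 ^ suc L) (sym (∑ᶠ-suc L (λ i → [ mask i ]ᵇ))) ⟩
  9 ^ size mask * 2 ^ suc L ∎
  where
  open ≡-Reasoning
  Z = ∑ (allSubsets L) (λ s → 8 ^ agreement (mask ∘ suc) (c ∘ suc) s)
  head : ∀ b → ∑ (allSubsets L) (λ s → 8 ^ agreement mask c (b ∷ s)) ≡ 8 ^ [ mask zero ∧ (b == c zero) ]ᵇ * Z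
  head b = trans (∑-cong (allSubsets L) λ s → trans (cong (8 ^_) (∑ᶠ-suc L (λ i → [ mask i ∧ (lookup (b ∷ s) i == c i) ]ᵇ)))
      (^-distribˡ-+-* 8 [ mask zero ∧ (b == c zero) ]ᵇ _)) (∑-*ˡ (allSubsets L) (8 ^ [ mask zero ∧ (b == c zero) ]ᵇ) _)
  IH : Z * 2 ^ size (mask ∘ suc) ≡ 9 ^ size (mask ∘ suc) * 2 ^ L
  IH = ∑-8^agreement L (mask ∘ suc) (c ∘ suc)
  k = size (mask ∘ suc)
  nine : ∀ x y → x + y ≡ 9 * Z → (x + y) * (2 * 2 ^ k) ≡ 9 * 9 ^ k * (2 * 2 ^ L)
  nine x y e = trans (cong (_* (2 * 2 ^ k)) e) (trans (*-swap4 9 Z 2 (2 ^ k)) (trans (cong (9 * 2 *_) IH) (sym (*-swap4 9 (9 ^ k) 2 (2 ^ L)))))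
  final : ∀ a b → (8 ^ [ a ∧ (true == b) ]ᵇ * Z + 8 ^ [ a ∧ (false == b) ]ᵇ * Z) * 2 ^ ([ a ]ᵇ + k) ≡ 9 ^ ([ a ]ᵇ + k) * 2 ^ suc L
  final true true = nine (8 * Z) (1 * Z) (sym (*-distribʳ-+ Z 8 1))
  final true false = nine (1 * Z) (8 * Z) (sym (*-distribʳ-+ Z 1 8))
  final false b = trans (cong (_* 2 ^ k) (trans (cong₂ _+_ (+-identityʳ Z) refl) refl)) (trans (*-assoc 2 Z (2 ^ k)) (trans (cong (2 *_) IH)
     (trans (sym (*-assoc 2 (9 ^ k) (2 ^ L))) (trans (cong (_* 2 ^ L) (*-comm 2 (9 ^ k))) (*-assoc (9 ^ k) 2 _)))))

9^16≤2^51 : 9 ^ 16 ≤ 2 ^ 51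
9^16≤2^51 = ≤ᵇ⇒≤ (9 ^ 16) (2 ^ 51) _

-- Markov with weight 8 per agreement: a position contributes 1 + 8, and 9 ^ 16 ≤ 2 ^ 51.
agreement-tail : ∀ L (mask c : Fin L → Bool) w → size mask ≡ 16 * w →
  ∑ (allSubsets L) (λ s → [ 15 * w ≤ᵇ agreement mask c s ]ᵇ) * 2 ^ (10 * w) ≤ 2 ^ L
agreement-tail L mask c w e = *-cancelʳ-≤ _ _ (2 ^ (51 * w)) ⦃ m^n≢0 2 (51 * w) ⦄ (begin
  bad * 2 ^ (10 * w) * 2 ^ (51 * w) ≡⟨ trans (*-assoc bad _ _) (cong (bad *_) (trans (sym (^-distribˡ-+-* 2 (10 * w) (51 * w)))
      (trans (cong (2 ^_) (trans (sym (*-distribʳ-+ w 10 51)) (*-distribʳ-+ w 45 16))) (^-distribˡ-+-* 2 (45 * w) (16 * w))))) ⟩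
  bad * (2 ^ (45 * w) * 2 ^ (16 * w)) ≡⟨ trans (cong (λ z → bad * (z * 2 ^ (16 * w))) eight) (sym (*-assoc bad _ _)) ⟩
  bad * 8 ^ (15 * w) * 2 ^ (16 * w) ≤⟨ *-monoˡ-≤ (2 ^ (16 * w)) markov ⟩
  ∑ (allSubsets L) (λ s → 8 ^ agreement mask c s) * 2 ^ (16 * w) ≡⟨ cong (λ z → ∑ (allSubsets L) (λ s → 8 ^ agreement mask c s) * 2 ^ z) (sym e) ⟩
  ∑ (allSubsets L) (λ s → 8 ^ agreement mask c s) * 2 ^ size mask ≡⟨ ∑-8^agreement L mask c ⟩
  9 ^ size mask * 2 ^ L ≡⟨ cong (λ z → 9 ^ z * 2 ^ L) e ⟩
  9 ^ (16 * w) * 2 ^ L ≡⟨ cong (_* 2 ^ L) (sym (^-*-assoc 9 16 w)) ⟩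
  (9 ^ 16) ^ w * 2 ^ L ≤⟨ *-monoˡ-≤ (2 ^ L) (^-monoˡ-≤ w 9^16≤2^51) ⟩
  (2 ^ 51) ^ w * 2 ^ L ≡⟨ trans (cong (_* 2 ^ L) (^-*-assoc 2 51 w)) (*-comm _ (2 ^ L)) ⟩
  2 ^ L * 2 ^ (51 * w) ∎)
  where
  open ≤-Reasoning
  bad = ∑ (allSubsets L) (λ s → [ 15 * w ≤ᵇ agreement mask c s ]ᵇ)
  eight : 2 ^ (45 * w) ≡ 8 ^ (15 * w)
  eight = trans (cong (2 ^_) (*-assoc 3 15 w)) (sym (^-*-assoc 2 3 (15 * w)))
  markov : bad * 8 ^ (15 * w) ≤ ∑ (allSubsets L) (λ s → 8 ^ agreement mask c s)
  markov = ≤-trans (≤-reflexive (sym (∑-*ʳ (allSubsets L) (8 ^ (15 * w)) _))) (∑-mono (allSubsets L) λ s → go (agreement mask c s) _ refl)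
    where
    go : ∀ g b → (15 * w ≤ᵇ g) ≡ b → [ b ]ᵇ * 8 ^ (15 * w) ≤ 8 ^ g
    go g false _ = z≤n
    go g true h = ≤-trans (≤-reflexive (+-identityʳ _)) (^-monoʳ-≤ 8 (≤ᵇ⇒≤ (15 * w) g (subst Bool.T (sym h) _)))

-- The binomial theorem. The weight Y^(n - |A|) stands for Y^(-|A|) in a union bound over all sets
-- A, kept integral by a factor Y^n.
∑-Y^ : ∀ n Y → ∑ (allSubsets n) (λ A → Y ^ size (not ∘ lookup A)) ≡ suc Y ^ n
∑-Y^ zero Y = refl
∑-Y^ (suc n) Y = trans (∑-allSubsets n (λ A → Y ^ size (not ∘ lookup A))) (trans (cong₂ _+_
    (trans (∑-cong (allSubsets n) λ A → cong (Y ^_) (∑ᶠ-suc n (λ i → [ not (lookup (true ∷ A) i) ]ᵇ))) (∑-Y^ n Y))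
    (trans (∑-cong (allSubsets n) λ A → cong (Y ^_) (∑ᶠ-suc n (λ i → [ not (lookup (false ∷ A) i) ]ᵇ))) (trans (∑-*ˡ (allSubsets n) Y _) (cong (Y *_) (∑-Y^ n Y)))))
  refl)

almost-Y^ : ∀ n Y → 2 * n < Y → suc Y ^ n < 2 * Y ^ n
almost-Y^ n Y h = *-cancelʳ-< Y (suc Y ^ n) (2 * Y ^ n) (begin-strict
  suc Y ^ n * Y <⟨ *-monoʳ-< (suc Y ^ n) ⦃ m^n≢0 (suc Y) n ⦄ Y<2Z ⟩
  suc Y ^ n * (2 * Z) ≡⟨ trans (sym (*-assoc (suc Y ^ n) 2 Z)) (trans (cong (_* Z) (*-comm (suc Y ^ n) 2)) (*-assoc 2 (suc Y ^ n) Z)) ⟩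
  2 * (suc Y ^ n * Z) ≤⟨ *-monoʳ-≤ 2 (claim n Z n+Z≡Y) ⟩
  2 * Y ^ suc n ≡⟨ trans (cong (2 *_) (*-comm Y (Y ^ n))) (sym (*-assoc 2 (Y ^ n) Y)) ⟩
  2 * Y ^ n * Y ∎)
  where
  open ≤-Reasoning
  Z = Y ∸ n
  n≤Y : n ≤ Y
  n≤Y = ≤-trans (m≤m+n n _) (<⇒≤ h)
  n+Z≡Y : n + Z ≡ Y
  n+Z≡Y = m+[n∸m]≡n n≤Y
  n<Z : n < Z
  n<Z = +-cancelˡ-< n n Z (subst₂ _<_ (cong (n +_) (+-identityʳ n)) (sym n+Z≡Y) h)
  Y<2Z : Y < 2 * Z
  Y<2Z = subst₂ _<_ n+Z≡Y (cong (Z +_) (sym (+-identityʳ Z))) (+-monoˡ-< Z n<Z)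
  -- This is (1 + 1/Y)^k (1 - k/Y) ≤ 1; each step uses (Y + 1) Z ≤ Y (Z + 1), valid since Z ≤ Y.
  claim : ∀ k Z → k + Z ≡ Y → suc Y ^ k * Z ≤ Y ^ suc k
  claim zero Z refl = ≤-reflexive (*-comm 1 Z)
  claim (suc k) Z e = begin
    suc Y * suc Y ^ k * Z ≡⟨ trans (*-assoc (suc Y) (suc Y ^ k) Z) (trans (cong (suc Y *_) (*-comm (suc Y ^ k) Z)) (trans (sym (*-assoc (suc Y) Z (suc Y ^ k))) (*-comm _ (suc Y ^ k)))) ⟩
    suc Y ^ k * (Z + Y * Z) ≤⟨ *-monoʳ-≤ (suc Y ^ k) (≤-trans (+-monoˡ-≤ (Y * Z) (≤-trans (m≤n+m Z (suc k)) (≤-reflexive e))) (≤-reflexive (sym (*-suc Y Z)))) ⟩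
    suc Y ^ k * (Y * suc Z) ≡⟨ trans (cong (suc Y ^ k *_) (*-comm Y (suc Z))) (trans (sym (*-assoc (suc Y ^ k) (suc Z) Y)) (*-comm _ Y)) ⟩
    Y * (suc Y ^ k * suc Z) ≤⟨ *-monoʳ-≤ Y (claim k (suc Z) (trans (+-suc k Z) e)) ⟩
    Y * Y ^ suc k ∎

∑ᶠ-+ : ∀ a b (f : Fin (a + b) → ℕ) → ∑ᶠ (a + b) f ≡ ∑ᶠ a (λ i → f (i ↑ˡ b)) + ∑ᶠ b (λ i → f (a ↑ʳ i))
∑ᶠ-+ zero b f = refl
∑ᶠ-+ (suc a) b f = trans (∑ᶠ-suc (a + b) f) (trans (cong (f zero +_) (∑ᶠ-+ a b (f ∘ suc)))
  (trans (sym (+-assoc (f zero) _ _)) (cong (_+ ∑ᶠ b (λ i → f (suc a ↑ʳ i))) (sym (∑ᶠ-suc a (λ i → f (i ↑ˡ b)))))))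

∑ᶠ-combine : ∀ a b (f : Fin (a * b) → ℕ) → ∑ᶠ (a * b) f ≡ ∑ᶠ a λ i → ∑ᶠ b λ j → f (combine i j)
∑ᶠ-combine zero b f = refl
∑ᶠ-combine (suc a) b f = trans (∑ᶠ-+ b (a * b) f) (trans (cong (∑ᶠ b (λ j → f (j ↑ˡ (a * b))) +_) (∑ᶠ-combine a b (f ∘ (b ↑ʳ_))))
  (sym (∑ᶠ-suc a (λ i → ∑ᶠ b λ j → f (combine i j)))))

δ : ∀ {n} → Fin n → Fin n → ℕ
δ i j = [ ⌊ i ≟ j ⌋ ]ᵇ

∑-δ : ∀ n (i : Fin n) (f : Fin n → ℕ) → ∑ᶠ n (λ j → δ i j * f j) ≡ f i
∑-δ (suc n) zero f = trans (∑ᶠ-suc n (λ j → δ zero j * f j)) (trans (cong (f zero + 0 +_) (∑-0 (allFin n))) (trans (+-identityʳ _) (+-identityʳ _)))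
∑-δ (suc n) (suc i) f = trans (∑ᶠ-suc n (λ j → δ (suc i) j * f j)) (trans (∑-cong (allFin n) same) (∑-δ n i (f ∘ suc)))
  where
  same : ∀ j → δ (suc i) (suc j) * f (suc j) ≡ δ i j * f (suc j)
  same j with i ≟ j
  ... | yes refl = refl
  ... | no _ = refl

xor-irrefl : ∀ a → a xor a ≡ true → ⊥
xor-irrefl true ()
xor-irrefl false ()

someᵇ : ∀ {r} → (Fin r → Bool) → Bool
someᵇ {zero} f = false
someᵇ {suc r} f = f zero ∨ someᵇ (f ∘ suc)

someᵇ-elim : ∀ {r} (f : Fin r → Bool) → someᵇ f ≡ true → ∃ λ i → f i ≡ true
someᵇ-elim {suc r} f e with f zero in h
... | true = zero , h
... | false with someᵇ-elim (f ∘ suc) e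
...   | i , g = suc i , g

someᵇ-cong : ∀ {r} {f g : Fin r → Bool} → (∀ i → f i ≡ g i) → someᵇ f ≡ someᵇ g
someᵇ-cong {zero} e = refl
someᵇ-cong {suc r} e = cong₂ _∨_ (e zero) (someᵇ-cong (e ∘ suc))

someᵇ-none : ∀ {r} (f : Fin r → Bool) → (∀ i → f i ≡ false) → someᵇ f ≡ false
someᵇ-none {zero} f h = refl
someᵇ-none {suc r} f h rewrite h zero = someᵇ-none (f ∘ suc) (h ∘ suc)

∑≤someᵇ : ∀ {r} (f : Fin r → Bool) → (∀ i j → f i ≡ true → f j ≡ true → i ≡ j) → size f ≤ [ someᵇ f ]ᵇ
∑≤someᵇ {zero} f _ = z≤n
∑≤someᵇ {suc r} f uniq = ≤-trans (≤-reflexive (∑ᶠ-suc r (λ i → [ f i ]ᵇ))) (go (f zero) refl)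
  where
  suc-inj : ∀ {i j : Fin r} → suc i ≡ suc j → i ≡ j
  suc-inj refl = refl
  none : f zero ≡ true → ∀ i → [ f (suc i) ]ᵇ ≡ 0
  none h i with f (suc i) in g
  ... | false = refl
  ... | true with () ← uniq zero (suc i) h g
  go : ∀ b → f zero ≡ b → [ b ]ᵇ + size (f ∘ suc) ≤ [ b ∨ someᵇ (f ∘ suc) ]ᵇ
  go false _ = ∑≤someᵇ (f ∘ suc) λ i j p q → suc-inj (uniq (suc i) (suc j) p q)
  go true h = ≤-reflexive (cong suc (trans (∑-cong (allFin r) (none h)) (∑-0 (allFin r))))

-- The graph obtained by replacing every line by a complete bipartite graph between its two sides.
module Lines {r n m : ℕ} (lab : Fin r → Fin n → Fin m) where

  across : (Fin r → Fin n → Bool) → Fin n → Fin n → Fin r → Bool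
  across side v u κ = ⌊ lab κ v ≟ lab κ u ⌋ ∧ (side κ v xor side κ u)

  edge : (Fin r → Fin n → Bool) → Fin n → Fin n → Bool
  edge side v u = someᵇ (across side v u)

  across-sym : ∀ side v u κ → across side v u κ ≡ across side u v κ
  across-sym side v u κ with lab κ v ≟ lab κ u | lab κ u ≟ lab κ v
  ... | yes _ | yes _ = xor-comm (side κ v) (side κ u)
  ... | yes p | no q = ⊥-elim (q (sym p))
  ... | no p | yes q = ⊥-elim (p (sym q))
  ... | no _ | no _ = refl

  edge-sym : ∀ side v u → edge side v u ≡ edge side u v
  edge-sym side v u = someᵇ-cong (across-sym side v u)

  edge-irrefl : ∀ side v → edge side v v ≡ false
  edge-irrefl side v = someᵇ-none _ λ κ → trans (cong (⌊ lab κ v ≟ lab κ v ⌋ ∧_) (xor-same (side κ v))) (∧-zeroʳ _)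

  module Degrees (two-points : ∀ κ κ′ v u → lab κ v ≡ lab κ u → lab κ′ v ≡ lab κ′ u → ¬ v ≡ u → κ ≡ κ′)
    (side : Fin r → Fin n → Bool) where

    module _ (A : Fin n → Bool) where
      on : Bool → Fin r → Fin m → ℕ
      on b κ ℓ = ∑ᶠ n λ v → δ (lab κ v) ℓ * [ A v ∧ (side κ v == b) ]ᵇ

      -- A line contributes all pairs of a point of A on its true side and one on its false side.
      -- Such a pair is joined by an edge, and by `two-points` only one slope counts it.
      degree-sum : ∑ᶠ r (λ κ → ∑ᶠ m λ ℓ → on true κ ℓ * on false κ ℓ) ≤ ∑ᶠ n λ v → [ A v ]ᵇ * size (λ u → A u ∧ edge side v u)
      degree-sum = begin
        ∑ᶠ r (λ κ → ∑ᶠ m λ ℓ → on true κ ℓ * on false κ ℓ)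
          ≡⟨ ∑-cong (allFin r) (λ κ → trans (∑-cong (allFin m) λ ℓ → sym (∑-*ʳ (allFin n) (on false κ ℓ) _)) (∑-swap (allFin m) (allFin n) (λ ℓ v → δ (lab κ v) ℓ * [ A v ∧ (side κ v == true) ]ᵇ * on false κ ℓ))) ⟩
        ∑ᶠ r (λ κ → ∑ᶠ n λ v → ∑ᶠ m λ ℓ → δ (lab κ v) ℓ * [ A v ∧ (side κ v == true) ]ᵇ * on false κ ℓ)
          ≡⟨ ∑-cong (allFin r) (λ κ → ∑-cong (allFin n) λ v → trans (∑-cong (allFin m) λ ℓ → *-assoc (δ (lab κ v) ℓ) _ _) (∑-δ m (lab κ v) (λ ℓ → [ A v ∧ (side κ v == true) ]ᵇ * on false κ ℓ))) ⟩
        ∑ᶠ r (λ κ → ∑ᶠ n λ v → [ A v ∧ (side κ v == true) ]ᵇ * on false κ (lab κ v))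
          ≡⟨ ∑-swap (allFin r) (allFin n) (λ κ v → [ A v ∧ (side κ v == true) ]ᵇ * on false κ (lab κ v)) ⟩
        ∑ᶠ n (λ v → ∑ᶠ r λ κ → [ A v ∧ (side κ v == true) ]ᵇ * on false κ (lab κ v))
          ≤⟨ ∑-mono (allFin n) per-vertex ⟩
        ∑ᶠ n (λ v → [ A v ]ᵇ * size (λ u → A u ∧ edge side v u)) ∎
        where
        open ≤-Reasoning
        pair : ∀ κ v u → [ A v ∧ (side κ v == true) ]ᵇ * (δ (lab κ u) (lab κ v) * [ A u ∧ (side κ u == false) ]ᵇ) ≤ [ A v ]ᵇ * ([ A u ]ᵇ * [ across side v u κ ]ᵇ)
        pair κ v u with lab κ u ≟ lab κ v | lab κ v ≟ lab κ u
        ... | yes p | no q = ⊥-elim (q (sym p))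
        ... | no _ | _ = ≤-trans (≤-reflexive (*-zeroʳ [ A v ∧ (side κ v == true) ]ᵇ)) z≤n
        ... | yes _ | yes _ with A v | A u | side κ v | side κ u
        ...   | false | _ | _ | _ = z≤n
        ...   | true | _ | false | _ = z≤n
        ...   | true | false | true | _ = z≤n
        ...   | true | true | true | true = z≤n
        ...   | true | true | true | false = ≤-refl
        unique : ∀ v u i j → across side v u i ≡ true → across side v u j ≡ true → i ≡ j
        unique v u i j p q with lab i v ≟ lab i u | lab j v ≟ lab j u
        ... | yes e | yes f = two-points i j v u e f ne
          where
          ne : ¬ v ≡ u
          ne refl = xor-irrefl (side i v) p
        per-vertex : ∀ v → ∑ᶠ r (λ κ → [ A v ∧ (side κ v == true) ]ᵇ * on false κ (lab κ v)) ≤ [ A v ]ᵇ * size (λ u → A u ∧ edge side v u)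
        per-vertex v = begin
          ∑ᶠ r (λ κ → [ A v ∧ (side κ v == true) ]ᵇ * on false κ (lab κ v))
            ≤⟨ ∑-mono (allFin r) (λ κ → ≤-trans (≤-reflexive (sym (∑-*ˡ (allFin n) [ A v ∧ (side κ v == true) ]ᵇ _))) (∑-mono (allFin n) (pair κ v))) ⟩
          ∑ᶠ r (λ κ → ∑ᶠ n λ u → [ A v ]ᵇ * ([ A u ]ᵇ * [ across side v u κ ]ᵇ))
            ≡⟨ trans (∑-swap (allFin r) (allFin n) (λ κ u → [ A v ]ᵇ * ([ A u ]ᵇ * [ across side v u κ ]ᵇ))) (∑-cong (allFin n) λ u → trans (∑-*ˡ (allFin r) [ A v ]ᵇ _) (cong ([ A v ]ᵇ *_) (∑-*ˡ (allFin r) [ A u ]ᵇ _))) ⟩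
          ∑ᶠ n (λ u → [ A v ]ᵇ * ([ A u ]ᵇ * size (across side v u)))
            ≤⟨ ∑-mono (allFin n) (λ u → *-monoʳ-≤ [ A v ]ᵇ (≤-trans (*-monoʳ-≤ [ A u ]ᵇ (∑≤someᵇ (across side v u) (unique v u))) (≤-reflexive (sym ([]ᵇ-∧ (A u) _))))) ⟩
          ∑ᶠ n (λ u → [ A v ]ᵇ * [ A u ∧ edge side v u ]ᵇ)
            ≡⟨ ∑-*ˡ (allFin n) [ A v ]ᵇ _ ⟩
          [ A v ]ᵇ * size (λ u → A u ∧ edge side v u) ∎

∑-allSubsets-1 : ∀ n → ∑ (allSubsets n) (λ _ → 1) ≡ 2 ^ n
∑-allSubsets-1 zero = refl
∑-allSubsets-1 (suc n) = trans (∑-allSubsets n (λ _ → 1)) (cong₂ _+_ (∑-allSubsets-1 n) (trans (∑-allSubsets-1 n) (sym (+-identityʳ _))))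

≤ᵇ-true : ∀ m n → m ≤ n → (m ≤ᵇ n) ≡ true
≤ᵇ-true m n h with m ≤ᵇ n | ≤⇒≤ᵇ h
... | true | _ = refl

true-≤ᵇ : ∀ m n → (m ≤ᵇ n) ≡ true → m ≤ n
true-≤ᵇ m n e = ≤ᵇ⇒≤ m n (subst Bool.T (sym e) _)

∑-Y^-empty : ∀ n Y → ∑ (allSubsets n) (λ A → [ size (lookup A) ≡ᵇ 0 ]ᵇ * Y ^ size (not ∘ lookup A)) ≡ Y ^ n
∑-Y^-empty zero Y = refl
∑-Y^-empty (suc n) Y = trans (∑-allSubsets n (λ A → [ size (lookup A) ≡ᵇ 0 ]ᵇ * Y ^ size (not ∘ lookup A)))
  (trans (cong₂ _+_ (trans (∑-cong (allSubsets n) λ A → cong (λ z → [ z ≡ᵇ 0 ]ᵇ * Y ^ size (not ∘ lookup (true ∷ A))) (∑ᶠ-suc n (λ i → [ lookup (true ∷ A) i ]ᵇ))) (∑-0 (allSubsets n)))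
    (trans (∑-cong (allSubsets n) λ A → trans (cong₂ (λ z w → [ z ≡ᵇ 0 ]ᵇ * Y ^ w) (∑ᶠ-suc n (λ i → [ lookup (false ∷ A) i ]ᵇ)) (∑ᶠ-suc n (λ i → [ not (lookup (false ∷ A) i) ]ᵇ)))
        (trans (sym (*-assoc [ size (lookup A) ≡ᵇ 0 ]ᵇ Y (Y ^ size (not ∘ lookup A)))) (trans (cong (_* Y ^ size (not ∘ lookup A)) (*-comm [ size (lookup A) ≡ᵇ 0 ]ᵇ Y)) (*-assoc Y [ size (lookup A) ≡ᵇ 0 ]ᵇ (Y ^ size (not ∘ lookup A))))))
      (∑-*ˡ (allSubsets n) Y _))) (cong (Y *_) (∑-Y^-empty n Y)))

size-not : ∀ {n} (A : Fin n → Bool) → size A + size (not ∘ A) ≡ n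
size-not {n} A = trans (sym (∑-+ (allFin n) _ _)) (trans (∑-cong (allFin n) λ i → go (A i)) (trans (∑ᶠ-const n 1) (*-identityʳ n)))
  where
  go : ∀ b → [ b ]ᵇ + [ not b ]ᵇ ≡ 1
  go true = refl
  go false = refl

term≤∑ : ∀ n (f : Subset n → ℕ) A → f A ≤ ∑ (allSubsets n) f
term≤∑ zero f [] = ≤-reflexive (sym (+-identityʳ _))
term≤∑ (suc n) f (true ∷ A) = ≤-trans (term≤∑ n (f ∘ (true ∷_)) A) (≤-trans (m≤m+n _ _) (≤-reflexive (sym (∑-allSubsets n f))))
term≤∑ (suc n) f (false ∷ A) = ≤-trans (term≤∑ n (f ∘ (false ∷_)) A) (≤-trans (m≤n+m _ _) (≤-reflexive (sym (∑-allSubsets n f))))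

-- Sides for which every large set has a vertex of large degree

module Sampling {r n m : ℕ} (lab : Fin r → Fin n → Fin m) (ρ X : ℕ) (r≡ : r ≡ 16 * ρ)
  (1≤X : 1 ≤ X) (few-lines : 4 * (r * m) ≤ ρ * X) (few-points : 2 * n < 2 ^ (5 * ρ)) where

  L Y : ℕ
  L = r * n
  Y = 2 ^ (5 * ρ)

  sides : Subset L → Fin r → Fin n → Bool
  sides s κ v = lookup s (combine κ v)

  mask : (Fin n → Bool) → Fin L → Bool
  mask A i = A (proj₂ (remQuot {r} n i))

  target : Subset (r * m) → Fin L → Bool
  target c i = lookup c (combine (proj₁ (remQuot {r} n i)) (lab (proj₁ (remQuot {r} n i)) (proj₂ (remQuot {r} n i))))

  size-mask : ∀ A → size (mask A) ≡ 16 * (ρ * size A)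
  size-mask A = trans (∑ᶠ-combine r n (λ i → [ mask A i ]ᵇ)) (trans (∑-cong (allFin r) λ κ → ∑-cong (allFin n) λ v → cong (λ z → [ A (proj₂ z) ]ᵇ) (remQuot-combine κ v))
    (trans (∑ᶠ-const r (size A)) (trans (cong (_* size A) r≡) (*-assoc 16 ρ (size A)))))

  agree : (Fin n → Bool) → Subset (r * m) → Subset L → ℕ
  agree A c s = agreement (mask A) (target c) s

  -- Here c guesses one side of every line. The event is that among the pairs of a slope and a point
  -- of A, at least 15/16 lie on the guessed side; avoiding it for all c prevents a large set from
  -- being concentrated on one side of its lines.
  bad : Subset n → Subset (r * m) → Subset L → Bool
  bad A c s = (X ≤ᵇ size (lookup A)) ∧ (15 * (ρ * size (lookup A)) ≤ᵇ agree (lookup A) c s)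

  -- For fixed c the probability is at most 2^(-10ρ|A|). There are 2^(rm) guesses, at most 2^(5ρ|A|)
  -- by `few-lines` and |A| ≥ X, so Y^(-|A|) is left.
  bad-sum : ∀ A → ∑ (allSubsets (r * m)) (λ c → ∑ (allSubsets L) (λ s → [ bad A c s ]ᵇ)) * Y ^ n
    ≤ 2 ^ L * ([ X ≤ᵇ size (lookup A) ]ᵇ * Y ^ size (not ∘ lookup A))
  bad-sum A with X ≤ᵇ size (lookup A) in big
  ... | false = ≤-trans (≤-reflexive (cong (_* Y ^ n) (trans (∑-cong (allSubsets (r * m)) λ _ → ∑-0 (allSubsets L)) (∑-0 (allSubsets (r * m)))))) z≤n
  ... | true = begin
      Z * Y ^ n ≡⟨ cong (λ k → Z * Y ^ k) (sym (size-not (lookup A))) ⟩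
      Z * Y ^ (a + a′) ≡⟨ trans (cong (Z *_) (^-distribˡ-+-* Y a a′)) (sym (*-assoc Z (Y ^ a) (Y ^ a′))) ⟩
      Z * Y ^ a * Y ^ a′ ≤⟨ *-monoˡ-≤ (Y ^ a′) core ⟩
      2 ^ L * Y ^ a′ ≡⟨ cong (2 ^ L *_) (sym (+-identityʳ _)) ⟩
      2 ^ L * (1 * Y ^ a′) ∎
    where
    open ≤-Reasoning
    a = size (lookup A)
    a′ = size (not ∘ lookup A)
    w = ρ * a
    Z = ∑ (allSubsets (r * m)) (λ c → ∑ (allSubsets L) (λ s → [ 15 * w ≤ᵇ agree (lookup A) c s ]ᵇ))
    core : Z * Y ^ a ≤ 2 ^ L
    core = *-cancelʳ-≤ _ _ (2 ^ (r * m)) ⦃ m^n≢0 2 (r * m) ⦄ (begin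
      Z * Y ^ a * 2 ^ (r * m) ≤⟨ *-monoʳ-≤ (Z * Y ^ a) (^-monoʳ-≤ 2 (≤-trans (≤-trans (m≤n*m (r * m) 4) few-lines) (≤-trans (*-monoʳ-≤ ρ (true-≤ᵇ X a big)) (m≤n*m w 5)))) ⟩
      Z * Y ^ a * 2 ^ (5 * w) ≡⟨ trans (cong (λ y → Z * y * 2 ^ (5 * w)) (trans (^-*-assoc 2 (5 * ρ) a) (cong (2 ^_) (*-assoc 5 ρ a)))) (trans (*-assoc Z _ _) (cong (Z *_) (trans (sym (^-distribˡ-+-* 2 (5 * w) (5 * w))) (cong (2 ^_) (sym (*-distribʳ-+ w 5 5)))))) ⟩
      Z * 2 ^ (10 * w) ≡⟨ sym (∑-*ʳ (allSubsets (r * m)) (2 ^ (10 * w)) _) ⟩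
      ∑ (allSubsets (r * m)) (λ c → ∑ (allSubsets L) (λ s → [ 15 * w ≤ᵇ agree (lookup A) c s ]ᵇ) * 2 ^ (10 * w)) ≤⟨ ∑-mono (allSubsets (r * m)) (λ c → agreement-tail L (mask (lookup A)) (target c) w (size-mask (lookup A))) ⟩
      ∑ (allSubsets (r * m)) (λ c → 2 ^ L) ≡⟨ trans (∑-cong (allSubsets (r * m)) λ _ → sym (+-identityʳ (2 ^ L))) (trans (∑-*ʳ (allSubsets (r * m)) (2 ^ L) (λ _ → 1)) (trans (cong (_* 2 ^ L) (∑-allSubsets-1 (r * m))) (*-comm _ (2 ^ L)))) ⟩
      2 ^ L * 2 ^ (r * m) ∎)

  badness : Subset L → ℕ
  badness s = ∑ (allSubsets n) λ A → ∑ (allSubsets (r * m)) λ c → [ bad A c s ]ᵇ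

  total-badness : ∑ (allSubsets L) badness < ∑ (allSubsets L) (λ _ → 1)
  total-badness = subst (∑ (allSubsets L) badness <_) (sym (∑-allSubsets-1 L)) (*-cancelʳ-< (Y ^ n) _ _ (begin-strict
    ∑ (allSubsets L) badness * Y ^ n
      ≡⟨ cong (_* Y ^ n) (trans (∑-swap (allSubsets L) (allSubsets n) (λ s A → ∑ (allSubsets (r * m)) λ c → [ bad A c s ]ᵇ)) (∑-cong (allSubsets n) λ A → ∑-swap (allSubsets L) (allSubsets (r * m)) (λ s c → [ bad A c s ]ᵇ))) ⟩
    ∑ (allSubsets n) (λ A → ∑ (allSubsets (r * m)) (λ c → ∑ (allSubsets L) (λ s → [ bad A c s ]ᵇ))) * Y ^ n
      ≡⟨ sym (∑-*ʳ (allSubsets n) (Y ^ n) _) ⟩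
    ∑ (allSubsets n) (λ A → ∑ (allSubsets (r * m)) (λ c → ∑ (allSubsets L) (λ s → [ bad A c s ]ᵇ)) * Y ^ n)
      ≤⟨ ∑-mono (allSubsets n) bad-sum ⟩
    ∑ (allSubsets n) (λ A → 2 ^ L * ([ X ≤ᵇ size (lookup A) ]ᵇ * Y ^ size (not ∘ lookup A)))
      ≡⟨ ∑-*ˡ (allSubsets n) (2 ^ L) _ ⟩
    2 ^ L * V <⟨ *-monoʳ-< (2 ^ L) ⦃ m^n≢0 2 L ⦄ V< ⟩
    2 ^ L * Y ^ n ∎))
    where
    open ≤-Reasoning
    V = ∑ (allSubsets n) (λ A → [ X ≤ᵇ size (lookup A) ]ᵇ * Y ^ size (not ∘ lookup A))
    split : ∀ A → [ X ≤ᵇ size (lookup A) ]ᵇ * Y ^ size (not ∘ lookup A) + [ size (lookup A) ≡ᵇ 0 ]ᵇ * Y ^ size (not ∘ lookup A) ≤ Y ^ size (not ∘ lookup A)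
    split A = ≤-trans (≤-reflexive (sym (*-distribʳ-+ y [ X ≤ᵇ size (lookup A) ]ᵇ _))) (≤-trans (*-monoˡ-≤ y (one (size (lookup A)))) (≤-reflexive (+-identityʳ y)))
      where
      y = Y ^ size (not ∘ lookup A)
      one : ∀ a → [ X ≤ᵇ a ]ᵇ + [ a ≡ᵇ 0 ]ᵇ ≤ 1
      one zero with X ≤ᵇ 0 in e
      ... | false = ≤-refl
      ... | true with () ← ≤-trans 1≤X (true-≤ᵇ X 0 e)
      one (suc a) = ≤-trans (≤-reflexive (+-identityʳ _)) ([]ᵇ≤1 (X ≤ᵇ suc a))
    -- The empty set is not among the large sets because 1 ≤ X. Its weight Y^n can therefore be
    -- subtracted from the total (Y + 1)^n < 2 Y^n.
    V< : V < Y ^ n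
    V< = +-cancelʳ-< (Y ^ n) V (Y ^ n) (begin-strict
      V + Y ^ n ≡⟨ cong (V +_) (sym (∑-Y^-empty n Y)) ⟩
      V + ∑ (allSubsets n) (λ A → [ size (lookup A) ≡ᵇ 0 ]ᵇ * Y ^ size (not ∘ lookup A)) ≡⟨ sym (∑-+ (allSubsets n) _ _) ⟩
      ∑ (allSubsets n) (λ A → [ X ≤ᵇ size (lookup A) ]ᵇ * Y ^ size (not ∘ lookup A) + [ size (lookup A) ≡ᵇ 0 ]ᵇ * Y ^ size (not ∘ lookup A)) ≤⟨ ∑-mono (allSubsets n) split ⟩
      ∑ (allSubsets n) (λ A → Y ^ size (not ∘ lookup A)) ≡⟨ ∑-Y^ n Y ⟩
      suc Y ^ n <⟨ almost-Y^ n Y few-points ⟩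
      2 * Y ^ n ≡⟨ cong (Y ^ n +_) (+-identityʳ _) ⟩
      Y ^ n + Y ^ n ∎)

  good-side : ∃ λ s → ∀ A c → bad A c s ≡ false
  good-side with ∑-witness (allSubsets L) badness (λ _ → 1) total-badness
  ... | s , h = s , λ A c → go A c (bad A c s) refl
    where
    go : ∀ A c b → bad A c s ≡ b → b ≡ false
    go A c false _ = refl
    go A c true e with s≤s () ← ≤-trans (s≤s (≤-trans (≤-reflexive (cong [_]ᵇ (sym e)))
      (≤-trans (term≤∑ (r * m) (λ c → [ bad A c s ]ᵇ) c) (term≤∑ n (λ A → ∑ (allSubsets (r * m)) λ c → [ bad A c s ]ᵇ) A)))) h

  module _ (M : ℕ) (wide : 4 * X ≤ M * ρ)
    (two-points : ∀ κ κ′ v u → lab κ v ≡ lab κ u → lab κ′ v ≡ lab κ′ u → ¬ v ≡ u → κ ≡ κ′) where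

    module _ (s : Subset L) (ok : ∀ A c → bad A c s ≡ false) where
      side : Fin r → Fin n → Bool
      side = sides s
      open Lines lab
      open Degrees two-points side

      module _ (Aᵛ : Subset n) (big : X ≤ size (lookup Aᵛ)) where
        A : Fin n → Bool
        A = lookup Aᵛ
        a w τ : ℕ
        a = size A
        w = ρ * a
        τ = (a / X) ⦃ >-nonZero 1≤X ⦄

        major : Fin r → Fin m → Bool
        major κ ℓ = on A false κ ℓ ≤ᵇ on A true κ ℓ
        c : Subset (r * m)
        c = tabulate λ i → major (proj₁ (remQuot {r} m i)) (proj₂ (remQuot {r} m i))

        hi lo : Fin r → Fin m → ℕ
        hi κ ℓ = on A (major κ ℓ) κ ℓ
        lo κ ℓ = on A (not (major κ ℓ)) κ ℓ

        c-at : ∀ κ ℓ → lookup c (combine κ ℓ) ≡ major κ ℓ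
        c-at κ ℓ = trans (lookup∘tabulate _ (combine κ ℓ)) (cong (λ z → major (proj₁ z) (proj₂ z)) (remQuot-combine κ ℓ))

        collect : ∀ κ (b : Fin m → Bool) → ∑ᶠ n (λ v → [ A v ∧ (side κ v == b (lab κ v)) ]ᵇ) ≡ ∑ᶠ m λ ℓ → on A (b ℓ) κ ℓ
        collect κ b = trans (∑-cong (allFin n) λ v → sym (∑-δ m (lab κ v) (λ ℓ → [ A v ∧ (side κ v == b ℓ) ]ᵇ)))
          (∑-swap (allFin n) (allFin m) (λ v ℓ → δ (lab κ v) ℓ * [ A v ∧ (side κ v == b ℓ) ]ᵇ))

        agree-hi : agree A c s ≡ ∑ᶠ r λ κ → ∑ᶠ m (hi κ)
        agree-hi = trans (∑ᶠ-combine r n (λ i → [ mask A i ∧ (lookup s i == target c i) ]ᵇ)) (∑-cong (allFin r) λ κ →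
          trans (∑-cong (allFin n) λ v → trans (cong (λ z → [ A (proj₂ z) ∧ (lookup s (combine κ v) == lookup c (combine (proj₁ z) (lab (proj₁ z) (proj₂ z)))) ]ᵇ) (remQuot-combine κ v))
              (cong (λ b → [ A v ∧ (side κ v == b) ]ᵇ) (c-at κ (lab κ v))))
            (collect κ (major κ)))

        total : ∑ᶠ r (λ κ → ∑ᶠ m (hi κ)) + ∑ᶠ r (λ κ → ∑ᶠ m (lo κ)) ≡ 16 * w
        total = trans (sym (∑-+ (allFin r) _ _)) (trans (∑-cong (allFin r) row) (trans (∑ᶠ-const r a) (trans (cong (_* a) r≡) (*-assoc 16 ρ a))))
          where
          row : ∀ κ → ∑ᶠ m (hi κ) + ∑ᶠ m (lo κ) ≡ a
          row κ = trans (cong₂ _+_ (sym (collect κ (major κ))) (sym (collect κ (not ∘ major κ)))) (trans (sym (∑-+ (allFin n) _ _))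
            (∑-cong (allFin n) λ v → go (A v) (side κ v) (major κ (lab κ v))))
            where
            go : ∀ x y z → [ x ∧ (y == z) ]ᵇ + [ x ∧ (y == not z) ]ᵇ ≡ [ x ]ᵇ
            go false _ _ = refl
            go true true true = refl
            go true true false = refl
            go true false true = refl
            go true false false = refl

        -- The guess c that takes the majority side of every line is not bad, so at least one
        -- sixteenth of all pairs is on minority sides.
        lo-sum : w ≤ ∑ᶠ r λ κ → ∑ᶠ m (lo κ)
        lo-sum = +-cancelˡ-≤ (15 * w) _ _ (≤-trans (≤-reflexive (trans (+-comm (15 * w) w) (sym total)))
          (+-monoˡ-≤ _ (≤-trans (≤-reflexive (sym agree-hi)) (<⇒≤ below))))
          where
          below : agree A c s < 15 * w
          below = ≰⇒> λ h → true≢false (trans (sym (cong₂ _∧_ (≤ᵇ-true X a big) (≤ᵇ-true (15 * w) (agree A c s) h))) (ok Aᵛ c))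
            where
            true≢false : ¬ true ≡ false
            true≢false ()

        -- A linear substitute for the Cauchy-Schwarz inequality: the product of the two sides is at
        -- least τ times the smaller one unless both are below τ, and then τ² pays for it. The
        -- choice τ = ⌊|A|/X⌋ keeps the total of these error terms small.
        τ-sq : ∀ κ ℓ → τ * lo κ ℓ ≤ on A true κ ℓ * on A false κ ℓ + τ * τ
        τ-sq κ ℓ = go (major κ ℓ) refl
          where
          cases : ∀ h l → l ≤ h → τ * l ≤ h * l + τ * τ
          cases h l l≤h with τ ≤? h
          ... | yes τ≤h = ≤-trans (*-monoˡ-≤ l τ≤h) (m≤m+n _ _)
          ... | no τ≰h = ≤-trans (*-monoʳ-≤ τ (≤-trans l≤h (<⇒≤ (≰⇒> τ≰h)))) (m≤n+m _ _)
          go : ∀ b → major κ ℓ ≡ b → τ * on A (not b) κ ℓ ≤ on A true κ ℓ * on A false κ ℓ + τ * τ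
          go true e = cases (on A true κ ℓ) (on A false κ ℓ) (true-≤ᵇ _ _ e)
          go false e = subst (λ z → τ * on A true κ ℓ ≤ z + τ * τ) (*-comm (on A false κ ℓ) (on A true κ ℓ))
            (cases (on A false κ ℓ) (on A true κ ℓ) (<⇒≤ (≰⇒> λ h → f≢t (trans (sym e) (≤ᵇ-true _ _ h)))))
            where
            f≢t : ¬ false ≡ true
            f≢t ()

        S : ℕ
        S = ∑ᶠ r λ κ → ∑ᶠ m λ ℓ → on A true κ ℓ * on A false κ ℓ

        S-bound : τ * w ≤ S + r * m * (τ * τ)
        S-bound = begin
          τ * w ≤⟨ *-monoʳ-≤ τ lo-sum ⟩
          τ * ∑ᶠ r (λ κ → ∑ᶠ m (lo κ)) ≡⟨ trans (sym (∑-*ˡ (allFin r) τ _)) (∑-cong (allFin r) λ κ → sym (∑-*ˡ (allFin m) τ _)) ⟩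
          ∑ᶠ r (λ κ → ∑ᶠ m λ ℓ → τ * lo κ ℓ) ≤⟨ ∑-mono (allFin r) (λ κ → ∑-mono (allFin m) (τ-sq κ)) ⟩
          ∑ᶠ r (λ κ → ∑ᶠ m λ ℓ → on A true κ ℓ * on A false κ ℓ + τ * τ) ≡⟨ trans (∑-cong (allFin r) λ κ → ∑-+ (allFin m) _ _) (∑-+ (allFin r) _ _) ⟩
          S + ∑ᶠ r (λ κ → ∑ᶠ m λ ℓ → τ * τ) ≡⟨ cong (S +_) (trans (∑-cong (allFin r) λ κ → ∑ᶠ-const m (τ * τ)) (trans (∑ᶠ-const r (m * (τ * τ))) (sym (*-assoc r m _)))) ⟩
          S + r * m * (τ * τ) ∎
          where open ≤-Reasoning

        τX≤a : τ * X ≤ a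
        τX≤a = m/n*n≤m a X ⦃ >-nonZero 1≤X ⦄

        a<X+τX : a < X + τ * X
        a<X+τX = ≤-<-trans (≤-reflexive (m≡m%n+[m/n]*n a X ⦃ >-nonZero 1≤X ⦄)) (+-monoˡ-< (τ * X) (m%n<n a X ⦃ >-nonZero 1≤X ⦄))

        1≤τ : 1 ≤ τ
        1≤τ = go τ a<X+τX
          where
          go : ∀ τ → a < X + τ * X → 1 ≤ τ
          go zero h = ⊥-elim (<-irrefl refl (<-≤-trans h (≤-trans (≤-reflexive (+-identityʳ X)) big)))
          go (suc τ) _ = s≤s z≤n

        a≤2τX : a ≤ 2 * (τ * X)
        a≤2τX = ≤-trans (<⇒≤ a<X+τX) (≤-trans (+-monoˡ-≤ (τ * X) (≤-trans (≤-reflexive (sym (*-identityˡ X))) (*-monoˡ-≤ X 1≤τ))) (≤-reflexive (cong (τ * X +_) (sym (+-identityʳ _)))))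

        -- The error r m τ² is at most a quarter of τ w, by `few-lines` and τ X ≤ |A|.
        τw≤2S : τ * w ≤ 2 * S
        τw≤2S = *-cancelˡ-≤ 2 (+-cancelʳ-≤ (τ * w) _ _ (begin
          2 * (τ * w) + τ * w ≤⟨ m≤m+n _ (τ * w) ⟩
          2 * (τ * w) + τ * w + τ * w ≡⟨ trans (+-assoc (2 * (τ * w)) _ _) (trans (cong (λ z → 2 * (τ * w) + (τ * w + z)) (sym (+-identityʳ _))) (sym (*-distribʳ-+ (τ * w) 2 2))) ⟩
          4 * (τ * w) ≤⟨ *-monoʳ-≤ 4 S-bound ⟩
          4 * (S + r * m * (τ * τ)) ≡⟨ trans (*-distribˡ-+ 4 S _) (cong (4 * S +_) (sym (*-assoc 4 (r * m) (τ * τ)))) ⟩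
          4 * S + 4 * (r * m) * (τ * τ) ≤⟨ +-monoʳ-≤ (4 * S) (≤-trans (*-monoˡ-≤ (τ * τ) few-lines) (≤-trans (≤-reflexive shuffle) (*-monoʳ-≤ τ (*-monoʳ-≤ ρ τX≤a)))) ⟩
          4 * S + τ * w ≡⟨ cong (_+ τ * w) (*-assoc 2 2 S) ⟩
          2 * (2 * S) + τ * w ∎))
          where
          open ≤-Reasoning
          shuffle : ρ * X * (τ * τ) ≡ τ * (ρ * (τ * X))
          shuffle = trans (*-swap4 ρ X τ τ) (trans (cong (_* (X * τ)) (*-comm ρ τ)) (trans (*-assoc τ ρ _) (cong (λ z → τ * (ρ * z)) (*-comm X τ))))

        D : ℕ
        D = ∑ᶠ n λ v → [ A v ]ᵇ * size (λ u → A u ∧ edge side v u)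

        aa≤MD : a * a ≤ M * D
        aa≤MD = ≤-trans (*-cancelˡ-≤ 2 (begin
          2 * (a * a) ≤⟨ *-monoʳ-≤ 2 (*-monoˡ-≤ a a≤2τX) ⟩
          2 * (2 * (τ * X) * a) ≡⟨ trans (sym (*-assoc 2 (2 * (τ * X)) a)) (cong (_* a) (trans (sym (*-assoc 2 2 (τ * X))) (trans (cong (4 *_) (*-comm τ X)) (sym (*-assoc 4 X τ))))) ⟩
          4 * X * τ * a ≤⟨ *-monoˡ-≤ a (*-monoˡ-≤ τ wide) ⟩
          M * ρ * τ * a ≡⟨ trans (*-assoc (M * ρ) τ a) (trans (*-swap4 M ρ τ a) (*-assoc M τ w)) ⟩
          M * (τ * w) ≤⟨ *-monoʳ-≤ M τw≤2S ⟩
          M * (2 * S) ≡⟨ trans (sym (*-assoc M 2 S)) (trans (cong (_* S) (*-comm M 2)) (*-assoc 2 M S)) ⟩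
          2 * (M * S) ∎)) (*-monoʳ-≤ M (degree-sum A))
          where open ≤-Reasoning

        deg : Fin n → ℕ
        deg v = size λ u → A u ∧ edge side v u

        -- The summand 1 makes the comparison strict, as averaging requires; over the integers it
        -- disappears again when a vertex has been found.
        average : ∑ᶠ n (λ v → [ A v ]ᵇ * a) < ∑ᶠ n (λ v → [ A v ]ᵇ * (1 + M * deg v))
        average = begin-strict
            ∑ᶠ n (λ v → [ A v ]ᵇ * a) ≡⟨ ∑-*ʳ (allFin n) a _ ⟩
            a * a ≤⟨ aa≤MD ⟩
            M * D <⟨ m<n+m (M * D) (≤-trans 1≤X big) ⟩
            a + M * D ≡⟨ cong (a +_) (trans (sym (∑-*ˡ (allFin n) M _)) (∑-cong (allFin n) λ v → trans (sym (*-assoc M [ A v ]ᵇ (deg v))) (trans (cong (_* deg v) (*-comm M [ A v ]ᵇ)) (*-assoc [ A v ]ᵇ M (deg v))))) ⟩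
            a + ∑ᶠ n (λ v → [ A v ]ᵇ * (M * deg v)) ≡⟨ sym (∑-+ (allFin n) _ _) ⟩
            ∑ᶠ n (λ v → [ A v ]ᵇ + [ A v ]ᵇ * (M * deg v)) ≡⟨ ∑-cong (allFin n) (λ v → sym (*-suc [ A v ]ᵇ (M * deg v))) ⟩
            ∑ᶠ n (λ v → [ A v ]ᵇ * (1 + M * deg v)) ∎
          where open ≤-Reasoning

        dense-vertex : ∃ λ v → A v ≡ true × a ≤ M * deg v
        dense-vertex = found (∑-witness (allFin n) (λ v → [ A v ]ᵇ * a) (λ v → [ A v ]ᵇ * (1 + M * deg v)) average)
          where
          go : ∀ v b → A v ≡ b → [ b ]ᵇ * a < [ b ]ᵇ * (1 + M * deg v) → A v ≡ true × a ≤ M * deg v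
          go v true e h = e , ≤-pred (subst₂ _<_ (+-identityʳ a) (+-identityʳ _) h)
          found : (∃ λ v → [ A v ]ᵇ * a < [ A v ]ᵇ * (1 + M * deg v)) → ∃ λ v → A v ≡ true × a ≤ M * deg v
          found (v , h) = v , go v (A v) refl h

    good-sides : ∃ λ side → ∀ A → X ≤ size A → ∃ λ v → A v ≡ true × size A ≤ M * size (λ u → A u ∧ Lines.edge lab side v u)
    good-sides = chosen good-side
      where
      chosen : (∃ λ s → ∀ A c → bad A c s ≡ false) → ∃ λ side → ∀ A → X ≤ size A → ∃ λ v → A v ≡ true × size A ≤ M * size (λ u → A u ∧ Lines.edge lab side v u)
      chosen (s , ok) = sides s , λ A big → transfer A (dense-vertex s ok (tabulate A) (subst (X ≤_) (sym (same-size A)) big))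
        where
        same-size : ∀ A → size (lookup (tabulate A)) ≡ size A
        same-size A = ∑-cong (allFin n) λ i → cong [_]ᵇ (lookup∘tabulate A i)
        transfer : ∀ A → (∃ λ v → lookup (tabulate A) v ≡ true × size (lookup (tabulate A)) ≤ M * size (λ u → lookup (tabulate A) u ∧ Lines.edge lab (sides s) v u))
          → ∃ λ v → A v ≡ true × size A ≤ M * size (λ u → A u ∧ Lines.edge lab (sides s) v u)
        transfer A (v , e , h) = v , trans (sym (lookup∘tabulate A v)) e , subst₂ _≤_ (same-size A)
          (cong (M *_) (∑-cong (allFin n) λ u → cong (λ b → [ b ∧ Lines.edge lab (sides s) v u ]ᵇ) (lookup∘tabulate A u))) h

-- Random maps into a geometry

∑-words-1 : ∀ n N → ∑ (words n N) (λ _ → 1) ≡ n ^ N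
∑-words-1 n zero = refl
∑-words-1 n (suc N) = trans (∑-words n N (λ _ → 1)) (trans (∑-cong (allFin n) λ _ → ∑-words-1 n N) (∑ᶠ-const n (n ^ N)))

someᵇ≤∑ : ∀ {r} (f : Fin r → Bool) → [ someᵇ f ]ᵇ ≤ size f
someᵇ≤∑ {r} f with someᵇ f in e
... | false = z≤n
... | true with someᵇ-elim f e
...   | i , h = ≤-trans (≤-reflexive (cong [_]ᵇ (sym h))) (term≤∑ᶠ r (λ i → [ f i ]ᵇ) i)

image : ∀ {t N} → (Fin t → Fin N) → Subset N
image f = tabulate λ v → someᵇ λ i → ⌊ f i ≟ v ⌋

image-elim : ∀ {t N} (f : Fin t → Fin N) v → lookup (image f) v ≡ true → ∃ λ i → f i ≡ v
image-elim f v e with someᵇ-elim (λ i → ⌊ f i ≟ v ⌋) (trans (sym (lookup∘tabulate _ v)) e)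
... | i , h with f i ≟ v
...   | yes p = i , p

∣image∣ : ∀ {t N} (f : Fin t → Fin N) → Injective _≡_ _≡_ f → ∣ image f ∣ ≡ t
∣image∣ {t} {N} f inj = trans (∣∣-size (image f)) (trans (∑-cong (allFin N) at) (trans (∑-swap (allFin N) (allFin t) (λ v i → [ ⌊ f i ≟ v ⌋ ]ᵇ))
    (trans (∑-cong (allFin t) λ i → trans (∑-cong (allFin N) λ v → sym (*-identityʳ (δ (f i) v))) (∑-δ N (f i) (λ _ → 1))) (trans (∑ᶠ-const t 1) (*-identityʳ t)))))
  where
  uniq : ∀ v i j → ⌊ f i ≟ v ⌋ ≡ true → ⌊ f j ≟ v ⌋ ≡ true → i ≡ j
  uniq v i j p q with f i ≟ v | f j ≟ v
  ... | yes a | yes b = inj (trans a (sym b))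
  at : ∀ v → [ lookup (image f) v ]ᵇ ≡ size (λ i → ⌊ f i ≟ v ⌋)
  at v = trans (cong [_]ᵇ (lookup∘tabulate _ v)) (≤-antisym (someᵇ≤∑ (λ i → ⌊ f i ≟ v ⌋)) (∑≤someᵇ (λ i → ⌊ f i ≟ v ⌋) (uniq v)))

module RandomMap {n : ℕ} (E : Fin n → Fin n → Bool) (E-sym : ∀ u v → E u v ≡ E v u) (E-irr : ∀ u → E u u ≡ false) where
  open Independent E E-sym E-irr using (count; _∖N_)

  -- The values of φ on p, read in increasing order of the vertices, form one of the sequences that
  -- `count` counts.
  ind : ∀ {N} → (Fin n → Bool) → Subset N → Vec (Fin n) N → Bool
  ind A [] [] = true
  ind A (true ∷ p) (x ∷ φ) = A x ∧ ind (A ∖N x) p φ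
  ind A (false ∷ p) (x ∷ φ) = ind A p φ

  ind-count : ∀ N A (p : Subset N) → ∑ (words n N) (λ φ → [ ind A p φ ]ᵇ) * n ^ ∣ p ∣ ≡ count ∣ p ∣ A * n ^ N
  ind-count zero A [] = refl
  ind-count (suc N) A (true ∷ p) = begin
    ∑ (words n (suc N)) (λ φ → [ ind A (true ∷ p) φ ]ᵇ) * (n * n ^ k)
      ≡⟨ cong (_* (n * n ^ k)) (trans (∑-words n N (λ φ → [ ind A (true ∷ p) φ ]ᵇ)) (∑-cong (allFin n) λ x →
           trans (∑-cong (words n N) λ φ → []ᵇ-∧ (A x) _) (∑-*ˡ (words n N) [ A x ]ᵇ _))) ⟩
    ∑ᶠ n (λ x → [ A x ]ᵇ * Z x) * (n * n ^ k)
      ≡⟨ trans (cong (∑ᶠ n (λ x → [ A x ]ᵇ * Z x) *_) (*-comm n (n ^ k))) (sym (*-assoc (∑ᶠ n (λ x → [ A x ]ᵇ * Z x)) (n ^ k) n)) ⟩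
    ∑ᶠ n (λ x → [ A x ]ᵇ * Z x) * n ^ k * n
      ≡⟨ cong (_* n) (trans (sym (∑-*ʳ (allFin n) (n ^ k) _)) (∑-cong (allFin n) λ x → trans (*-assoc [ A x ]ᵇ (Z x) (n ^ k)) (trans (cong ([ A x ]ᵇ *_) (ind-count N (A ∖N x) p)) (sym (*-assoc [ A x ]ᵇ _ _))))) ⟩
    ∑ᶠ n (λ x → [ A x ]ᵇ * count k (A ∖N x) * n ^ N) * n
      ≡⟨ trans (cong (_* n) (∑-*ʳ (allFin n) (n ^ N) _)) (trans (*-assoc (count (suc k) A) (n ^ N) n) (cong (count (suc k) A *_) (*-comm (n ^ N) n))) ⟩
    count (suc k) A * n ^ suc N ∎
    where
    open ≡-Reasoning
    k = ∣ p ∣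
    Z : Fin n → ℕ
    Z x = ∑ (words n N) (λ φ → [ ind (A ∖N x) p φ ]ᵇ)
  ind-count (suc N) A (false ∷ p) = trans (cong (_* n ^ ∣ p ∣) (trans (∑-words n N (λ φ → [ ind A (false ∷ p) φ ]ᵇ)) (∑ᶠ-const n _)))
    (trans (*-assoc n _ _) (trans (cong (n *_) (ind-count N A p)) (trans (sym (*-assoc n (count ∣ p ∣ A) (n ^ N))) (trans (cong (_* n ^ N) (*-comm n (count ∣ p ∣ A))) (*-assoc (count ∣ p ∣ A) n (n ^ N))))))

  ind-intro : ∀ {N} A (p : Subset N) φ → (∀ i → lookup p i ≡ true → A (lookup φ i) ≡ true)
    → (∀ i j → lookup p i ≡ true → lookup p j ≡ true → ¬ i ≡ j → E (lookup φ i) (lookup φ j) ≡ false) → ind A p φ ≡ true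
  ind-intro A [] [] _ _ = refl
  ind-intro A (true ∷ p) (x ∷ φ) inA free = cong₂ _∧_ (inA zero refl) (ind-intro (A ∖N x) p φ
    (λ i pi → cong₂ _∧_ (inA (suc i) pi) (cong not (free zero (suc i) refl pi λ ())))
    λ i j pi pj ne → free (suc i) (suc j) pi pj λ { refl → ne refl })
  ind-intro A (false ∷ p) (x ∷ φ) inA free = ind-intro A p φ (λ i → inA (suc i)) λ i j pi pj ne → free (suc i) (suc j) pi pj λ { refl → ne refl }

  module _ ⦃ _ : NonZero n ⦄ {N t : ℕ} (G : Graph N) (few : numKs t G * count t (λ _ → true) < n ^ t) where
    open Clique G

    mono : Vec (Fin n) N → ℕ
    mono φ = ∑ (allSubsets N) λ p → [ isK t (λ _ → true) p ]ᵇ * [ ind (λ _ → true) p φ ]ᵇ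

    -- The expected number of copies of K_t sent to independent sequences is below 1.
    total-mono : ∑ (words n N) mono < ∑ (words n N) (λ _ → 1)
    total-mono = subst (∑ (words n N) mono <_) (sym (∑-words-1 n N)) (*-cancelʳ-< (n ^ t) _ _ (begin-strict
      ∑ (words n N) mono * n ^ t
        ≡⟨ cong (_* n ^ t) (trans (∑-swap (words n N) (allSubsets N) (λ φ p → [ isK t (λ _ → true) p ]ᵇ * [ ind (λ _ → true) p φ ]ᵇ)) (∑-cong (allSubsets N) λ p → ∑-*ˡ (words n N) [ isK t (λ _ → true) p ]ᵇ _)) ⟩
      ∑ (allSubsets N) (λ p → [ isK t (λ _ → true) p ]ᵇ * ∑ (words n N) (λ φ → [ ind (λ _ → true) p φ ]ᵇ)) * n ^ t
        ≡⟨ trans (sym (∑-*ʳ (allSubsets N) (n ^ t) _)) (∑-cong (allSubsets N) per) ⟩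
      ∑ (allSubsets N) (λ p → [ isK t (λ _ → true) p ]ᵇ * (count t (λ _ → true) * n ^ N))
        ≡⟨ trans (∑-*ʳ (allSubsets N) (count t (λ _ → true) * n ^ N) _) (trans (cong (_* (count t (λ _ → true) * n ^ N)) (sym (numKs≡cliques t))) (sym (*-assoc (numKs t G) _ _))) ⟩
      numKs t G * count t (λ _ → true) * n ^ N <⟨ *-monoˡ-< (n ^ N) ⦃ m^n≢0 n N ⦄ few ⟩
      n ^ t * n ^ N ≡⟨ *-comm (n ^ t) (n ^ N) ⟩
      n ^ N * n ^ t ∎))
      where
      open ≤-Reasoning
      per : ∀ p → [ isK t (λ _ → true) p ]ᵇ * ∑ (words n N) (λ φ → [ ind (λ _ → true) p φ ]ᵇ) * n ^ t ≡ [ isK t (λ _ → true) p ]ᵇ * (count t (λ _ → true) * n ^ N)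
      per p with isK t (λ _ → true) p in e
      ... | false = refl
      ... | true with IsK.card (isK-sound t (λ _ → true) p e)
      ...   | refl = trans (cong (_* n ^ ∣ p ∣) (+-identityʳ (∑ (words n N) λ φ → [ ind (λ _ → true) p φ ]ᵇ))) (trans (ind-count N (λ _ → true) p) (sym (+-identityʳ _)))

    good-map : ∃ λ (φ : Vec (Fin n) N) → ∀ p → IsK t (λ _ → true) p → ind (λ _ → true) p φ ≡ false
    good-map = found (∑-witness (words n N) mono (λ _ → 1) total-mono)
      where
      go : ∀ φ → mono φ < 1 → ∀ p → IsK t (λ _ → true) p → ∀ b → ind (λ _ → true) p φ ≡ b → b ≡ false
      go φ h p k false _ = refl
      go φ h p k true e = ⊥-elim (<⇒≱ h (≤-trans (≤-reflexive (sym (cong₂ (λ a b → [ a ]ᵇ * [ b ]ᵇ) (isK-complete t _ p k) e)))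
        (term≤∑ N (λ p → [ isK t (λ _ → true) p ]ᵇ * [ ind (λ _ → true) p φ ]ᵇ) p)))
      found : (∃ λ φ → mono φ < 1) → ∃ λ φ → ∀ p → IsK t (λ _ → true) p → ind (λ _ → true) p φ ≡ false
      found (φ , h) = φ , λ p k → go φ h p k _ refl

    -- An edge is red when its images are adjacent. A red copy of H yields a map w that preserves
    -- edges but may identify vertices, hence the hypothesis speaks of all w. An edge whose ends
    -- have the same image is blue, as there are no loops.
    not-Ramsey : ∀ {ℓ} (H : Graph ℓ) → (∀ (w : Fin ℓ → Fin n) → ¬ (∀ i j → adj H i j ≡ true → E (w i) (w j) ≡ true)) → ¬ IsRamsey H (K t) G
    not-Ramsey {ℓ} H no-walk ramsey = refute good-map
      where
      true≢false : ¬ true ≡ false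
      true≢false ()
      adjacent : ∀ i j → ¬ i ≡ j → adj (K t) i j ≡ true
      adjacent i j ne with i ≟ j
      ... | yes e = ⊥-elim (ne e)
      ... | no _ = refl
      module _ (φ : Vec (Fin n) N) (good : ∀ p → IsK t (λ _ → true) p → ind (λ _ → true) p φ ≡ false) where
        colour : Colouring N
        colour u v = E (lookup φ u) (lookup φ v)
        no-red : ¬ MonoCopy H G colour true
        no-red (f , _ , red) = no-walk (λ i → lookup φ (f i)) λ i j ij → proj₂ (red i j ij)
        no-blue : ¬ MonoCopy (K t) G colour false
        no-blue (f , inj , blue) = true≢false (trans (sym (ind-intro _ (image f) φ (λ _ _ → refl) free)) (good (image f) (isk (∣image∣ f inj) complete λ _ _ → refl)))
          where
          apart : ∀ {u v} → ¬ u ≡ v → (∃ λ i → f i ≡ u) → (∃ λ j → f j ≡ v) → adj G u v ≡ true × colour u v ≡ false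
          apart ne (i , refl) (j , refl) = blue i j (adjacent i j λ { refl → ne refl })
          pair : ∀ u v → lookup (image f) u ≡ true → lookup (image f) v ≡ true → ¬ u ≡ v → adj G u v ≡ true × colour u v ≡ false
          pair u v pu pv ne = apart ne (image-elim f u pu) (image-elim f v pv)
          complete : ∀ u v → lookup (image f) u ≡ true → lookup (image f) v ≡ true → ¬ u ≡ v → adj G u v ≡ true
          complete u v pu pv ne = proj₁ (pair u v pu pv ne)
          free : ∀ u v → lookup (image f) u ≡ true → lookup (image f) v ≡ true → ¬ u ≡ v → E (lookup φ u) (lookup φ v) ≡ false
          free u v pu pv ne = proj₂ (pair u v pu pv ne)
        absurd : MonoCopy H G colour true ⊎ MonoCopy (K t) G colour false → ⊥
        absurd (inj₁ red) = no-red red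
        absurd (inj₂ blue) = no-blue blue
      refute : (∃ λ φ → ∀ p → IsK t (λ _ → true) p → ind (λ _ → true) p φ ≡ false) → ⊥
      refute (φ , good) = absurd φ good (ramsey (colour φ good) λ u v → E-sym _ _)

-- n points on 16ρ parallel classes of m lines each.
record Geometry {ℓ} (H : Graph ℓ) (n ρ m : ℕ) : Set where
  field
    line-of : Fin (16 * ρ) → Fin n → Fin m
    two-points : ∀ κ κ′ v u → line-of κ v ≡ line-of κ u → line-of κ′ v ≡ line-of κ′ u → ¬ v ≡ u → κ ≡ κ′
    no-walk : ∀ side (w : Fin ℓ → Fin n) → ¬ (∀ i j → adj H i j ≡ true → Lines.edge line-of side (w i) (w j) ≡ true)

module FromGeometry {ℓ} {H : Graph ℓ} {n ρ m : ℕ} (geo : Geometry H n ρ m) (X M e : ℕ) (1≤X : 1 ≤ X) (1≤M : 1 ≤ M)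
  (few-lines : 4 * (16 * ρ * m) ≤ ρ * X) (few-points : 2 * n < 2 ^ (5 * ρ)) (wide : 4 * X ≤ M * ρ) (n≤ : n ≤ 2 ^ e * X) where
  open Geometry geo

  -- The hypothesis turns the whole peeling cost into 2^t: a random t-tuple is independent with
  -- probability at most (2X/n)^t.
  few-independent : ∀ t → (1 + n * t) ^ (M * e) ≤ 2 ^ t → ∃ λ side →
    Independent.count (Lines.edge line-of side) (Lines.edge-sym line-of side) (Lines.edge-irrefl line-of side) t (λ _ → true) ≤ X ^ t * 2 ^ t
  few-independent t h = bound (Sampling.good-sides line-of ρ X refl 1≤X few-lines few-points M wide two-points)
    where
    bound : (∃ λ side → ∀ A → X ≤ size A → ∃ λ v → A v ≡ true × size A ≤ M * size (λ u → A u ∧ Lines.edge line-of side v u)) → ∃ λ side →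
      Independent.count (Lines.edge line-of side) (Lines.edge-sym line-of side) (Lines.edge-irrefl line-of side) t (λ _ → true) ≤ X ^ t * 2 ^ t
    bound (side , dense) = side , ≤-trans (Independent.Bound.count-all (Lines.edge line-of side) (Lines.edge-sym line-of side) (Lines.edge-irrefl line-of side)
          X M t 1≤X dense e t 1≤M ≤-refl n≤) (*-monoʳ-≤ (X ^ t) h)

  -- With fewer than `N C s` copies of K_s there are at most (8N/t)^t copies of K_t, and the
  -- expected number of them mapped to independent tuples is at most (16NX/(nt))^t < 1.
  Ramsey-cliques : ∀ t s → 1 ≤ s → s ≤ t → (1 + n * t) ^ (M * e) ≤ 2 ^ t → ∀ N → 16 * N * X < n * t →
    ∀ v (G : Graph v) → IsRamsey H (K t) G → N C s ≤ numKs s G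
  Ramsey-cliques t (suc s) _ s≤t h N small v G ramsey = decide (N C suc s ≤? numKs (suc s) G)
    where
    n>0 : ∀ n {x} → x < n * t → 0 < n
    n>0 (suc n) _ = s≤s z≤n
    d = t ∸ suc s
    s+d≡t : suc s + d ≡ t
    s+d≡t = m+[n∸m]≡n s≤t
    1≤t : 1 ≤ t
    1≤t = ≤-trans (s≤s z≤n) s≤t
    cliques≤ : ¬ N C suc s ≤ numKs (suc s) G → numKs t G * t ^ t ≤ (8 * N) ^ t
    cliques≤ gt = subst (λ t → numKs t G * t ^ t ≤ (8 * N) ^ t) s+d≡t (≤-trans (*-monoˡ-≤ ((suc s + d) ^ (suc s + d)) (Clique.few-cliques G s d N (≰⇒> gt)))
      (binom-product (suc s) d N))
    few : ∀ cnt → cnt ≤ X ^ t * 2 ^ t → numKs t G * t ^ t ≤ (8 * N) ^ t → numKs t G * cnt < n ^ t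
    few cnt count≤ cliques≤ = *-cancelʳ-< (t ^ t) _ _ (begin-strict
      numKs t G * cnt * t ^ t ≤⟨ *-monoˡ-≤ (t ^ t) (*-monoʳ-≤ (numKs t G) count≤) ⟩
      numKs t G * (X ^ t * 2 ^ t) * t ^ t ≡⟨ trans (*-assoc (numKs t G) _ _) (trans (cong (numKs t G *_) (*-comm _ (t ^ t))) (sym (*-assoc (numKs t G) _ _))) ⟩
      numKs t G * t ^ t * (X ^ t * 2 ^ t) ≤⟨ *-monoˡ-≤ (X ^ t * 2 ^ t) cliques≤ ⟩
      (8 * N) ^ t * (X ^ t * 2 ^ t) ≡⟨ trans (cong ((8 * N) ^ t *_) (sym (^-distribʳ-* t X 2))) (trans (sym (^-distribʳ-* t (8 * N) (X * 2))) (cong (_^ t) shuffle)) ⟩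
      (16 * N * X) ^ t <⟨ ^-monoˡ-< t ⦃ >-nonZero 1≤t ⦄ small ⟩
      (n * t) ^ t ≡⟨ ^-distribʳ-* t n t ⟩
      n ^ t * t ^ t ∎)
      where
      open ≤-Reasoning
      shuffle : 8 * N * (X * 2) ≡ 16 * N * X
      shuffle = trans (cong (8 * N *_) (*-comm X 2)) (trans (*-swap4 8 N 2 X) (sym (*-assoc 16 N X)))
    refute : numKs t G * t ^ t ≤ (8 * N) ^ t → (∃ λ side → Independent.count (Lines.edge line-of side) (Lines.edge-sym line-of side) (Lines.edge-irrefl line-of side) t (λ _ → true) ≤ X ^ t * 2 ^ t) → ⊥
    refute cl (side , count≤) = RandomMap.not-Ramsey (Lines.edge line-of side) (Lines.edge-sym line-of side) (Lines.edge-irrefl line-of side)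
      ⦃ >-nonZero (n>0 n small) ⦄ G (few _ count≤ cl) H (no-walk side) ramsey
    decide : Dec (N C suc s ≤ numKs (suc s) G) → N C suc s ≤ numKs (suc s) G
    decide (yes le) = le
    decide (no gt) = ⊥-elim (refute (cliques≤ gt) (few-independent t h))

-- Walks along lines

module Walk {Point Slope Line : Set} (_≟ᴾ_ : (p q : Point) → Dec (p ≡ q)) (_≟ˢ_ : (κ κ′ : Slope) → Dec (κ ≡ κ′))
  (lab : Slope → Point → Line) where

  data Walk : Point → Point → Set where
    [] : ∀ {p} → Walk p p
    step : ∀ {p} κ q {r} → lab κ p ≡ lab κ q → Walk q r → Walk p r

  length : ∀ {p q} → Walk p q → ℕ
  length [] = 0
  length (step _ _ _ ω) = suc (length ω)

  Starts≢ : Slope → ∀ {p q} → Walk p q → Set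
  Starts≢ κ [] = ⊤
  Starts≢ κ (step κ′ _ _ _) = ¬ κ ≡ κ′

  Ends≢ : Slope → ∀ {p q} → Walk p q → Set
  Ends≢ κ [] = ⊤
  Ends≢ κ (step κ′ _ _ []) = ¬ κ ≡ κ′
  Ends≢ κ (step _ _ _ ω@(step _ _ _ _)) = Ends≢ κ ω

  Reduced : ∀ {p q} → Walk p q → Set
  Reduced [] = ⊤
  Reduced {p} (step κ q _ ω) = ¬ p ≡ q × Starts≢ κ ω × Reduced ω

  -- Closed walks in which consecutive slopes differ, also at the base point.
  Girth : ℕ → Set
  Girth ℓ = ∀ {p q} κ e (ω : Walk q p) → 1 ≤ length ω → suc (length ω) ≤ ℓ → Reduced (step {p} κ q e ω) → Ends≢ κ ω → ⊥

  module Parity (side : Slope → Point → Bool) where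
    turn : Slope → Point → Point → Bool
    turn κ p q = side κ p xor side κ q

    parity : ∀ {p q} → Walk p q → Bool
    parity [] = false
    parity {p} (step κ q _ ω) = turn κ p q xor parity ω

    turn-self : ∀ a b → (a xor a) xor b ≡ b
    turn-self true b = refl
    turn-self false b = refl

    xor-merge : ∀ a b c d → (a xor b) xor ((b xor c) xor d) ≡ (a xor c) xor d
    xor-merge true true c d = go c d
      where
      go : ∀ c d → false xor ((true xor c) xor d) ≡ (true xor c) xor d
      go c d = refl
    xor-merge true false true true = refl
    xor-merge true false true false = refl
    xor-merge true false false true = refl
    xor-merge true false false false = refl
    xor-merge false true true true = refl
    xor-merge false true true false = refl
    xor-merge false true false true = refl
    xor-merge false true false false = refl
    xor-merge false false c d = refl

    Shorter : ∀ {p q} → Walk p q → Set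
    Shorter {p} {q} ω = Σ[ ω′ ∈ Walk p q ] (length ω′ < length ω × parity ω′ ≡ parity ω)

    -- A step that stays in place turns no side, and two steps of equal slope lie on one line, where
    -- the middle side cancels. Both shortenings preserve the parity.
    reduce : ∀ {p q} (ω : Walk p q) → Reduced ω ⊎ Shorter ω
    reduce [] = inj₁ tt
    reduce {p} (step κ q e ω) with p ≟ᴾ q
    ... | yes refl = inj₂ (ω , ≤-refl , sym (turn-self (side κ p) (parity ω)))
    ... | no p≢q with reduce ω
    ...   | inj₂ (ω′ , lt , par) = inj₂ (step κ q e ω′ , s≤s lt , cong (turn κ p q xor_) par)
    reduce {p} (step κ q e []) | no p≢q | inj₁ red = inj₁ (p≢q , tt , tt)
    reduce {p} (step κ q e (step κ′ r e′ ω)) | no p≢q | inj₁ red with κ ≟ˢ κ′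
    ... | yes refl = inj₂ (step κ r (trans e e′) ω , ≤-refl , sym (xor-merge (side κ p) (side κ q) (side κ r) (parity ω)))
    ... | no κ≢κ′ = inj₁ (p≢q , κ≢κ′ , red)

    -- Reduction across the base point: the first step, of slope κ, is moved behind the last one and
    -- merged with it if the slopes agree. The closed walk then starts at the second point and has
    -- lost one step.
    ends : ∀ κ {p q r} (e : lab κ q ≡ lab κ r) (ω : Walk p q) → Ends≢ κ ω ⊎ Σ[ ω′ ∈ Walk p r ] (length ω′ ≡ length ω × parity ω′ ≡ turn κ q r xor parity ω)
    ends κ e [] = inj₁ tt
    ends κ {p} {q} {r} e (step κ′ _ e′ []) with κ ≟ˢ κ′
    ... | yes refl = inj₂ (step κ r (trans e′ e) [] , refl , go (side κ p) (side κ q) (side κ r))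
      where
      go : ∀ a b c → (a xor c) xor false ≡ (b xor c) xor ((a xor b) xor false)
      go true true true = refl
      go true true false = refl
      go true false true = refl
      go true false false = refl
      go false true true = refl
      go false true false = refl
      go false false true = refl
      go false false false = refl
    ... | no ne = inj₁ ne
    ends κ {p} {q} {r} e (step κ′ p′ e′ ω@(step _ _ _ _)) with ends κ e ω
    ... | inj₁ ne = inj₁ ne
    ... | inj₂ (ω′ , len , par) = inj₂ (step κ′ p′ e′ ω′ , cong suc len , trans (cong (turn κ′ p p′ xor_) par) (go (turn κ′ p p′) (turn κ q r) (parity ω)))
      where
      go : ∀ a b c → a xor (b xor c) ≡ b xor (a xor c)
      go true true c = refl
      go true false c = refl
      go false b c = refl

    -- Shortening along the walk or across the base point leads to the empty walk, since what cannot
    -- be shortened is excluded by `Girth`. An edge of the graph contributes `true` to the parity,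
    -- so an odd closed walk of edges contradicts this.
    even : ∀ {ℓ} → Girth ℓ → ∀ fuel → fuel ≤ ℓ → ∀ {p} (ω : Walk p p) → length ω ≤ fuel → parity ω ≡ false
    even girth fuel le [] h = refl
    even girth (suc fuel) le ω@(step κ q e ω₀) (s≤s h) with reduce ω
    ... | inj₂ (ω′ , s≤s lt , par) = trans (sym par) (even girth fuel (≤-trans (n≤1+n fuel) le) ω′ (≤-trans lt h))
    even girth (suc fuel) le ω@(step κ q e []) (s≤s h) | inj₁ (p≢q , _) = ⊥-elim (p≢q refl)
    even girth (suc fuel) le {p} ω@(step κ q e ω₀@(step _ _ _ _)) (s≤s h) | inj₁ red with ends κ e ω₀
    ... | inj₁ ne = ⊥-elim (girth κ e ω₀ (s≤s z≤n) (≤-trans (s≤s h) le) red ne)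
    ... | inj₂ (ω′ , len , par) = trans (sym par) (even girth fuel (≤-trans (n≤1+n fuel) le) ω′ (subst (_≤ fuel) (sym len) h))

-- Identities in characteristic 2

-- Each formula below is written once over these operations and read twice: in the ring itself, and
-- on `Term`, where a polynomial is computed along with the value.
record Operations (A : Set) : Set where
  infixl 6 _⊞_
  infixl 7 _⊠_
  field
    _⊞_ _⊠_ : A → A → A
    𝟘 : A
    σ : A → A

record CharTwo : Set₁ where
  infixl 6 _⊕_
  infixl 7 _⊗_
  field
    Carrier : Set
    _⊕_ _⊗_ : Carrier → Carrier → Carrier
    0# 1# : Carrier
    ⊕-assoc : ∀ x y z → (x ⊕ y) ⊕ z ≡ x ⊕ (y ⊕ z)
    ⊕-comm : ∀ x y → x ⊕ y ≡ y ⊕ x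
    ⊕-identityˡ : ∀ x → 0# ⊕ x ≡ x
    ⊕-self : ∀ x → x ⊕ x ≡ 0#
    ⊗-assoc : ∀ x y z → (x ⊗ y) ⊗ z ≡ x ⊗ (y ⊗ z)
    ⊗-comm : ∀ x y → x ⊗ y ≡ y ⊗ x
    ⊗-identityˡ : ∀ x → 1# ⊗ x ≡ x
    ⊗-distribˡ : ∀ x y z → x ⊗ (y ⊕ z) ≡ x ⊗ y ⊕ x ⊗ z

  ⊕-identityʳ : ∀ x → x ⊕ 0# ≡ x
  ⊕-identityʳ x = trans (⊕-comm x 0#) (⊕-identityˡ x)
  ⊗-identityʳ : ∀ x → x ⊗ 1# ≡ x
  ⊗-identityʳ x = trans (⊗-comm x 1#) (⊗-identityˡ x)
  ⊗-distribʳ : ∀ x y z → (y ⊕ z) ⊗ x ≡ y ⊗ x ⊕ z ⊗ x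
  ⊗-distribʳ x y z = trans (⊗-comm _ x) (trans (⊗-distribˡ x y z) (cong₂ _⊕_ (⊗-comm x y) (⊗-comm x z)))
  ⊕-cancelʳ0 : ∀ x y → x ⊕ y ≡ 0# → x ≡ y
  ⊕-cancelʳ0 x y e = trans (sym (⊕-identityʳ x)) (trans (cong (x ⊕_) (sym (⊕-self y)))
    (trans (sym (⊕-assoc x y y)) (trans (cong (_⊕ y) e) (⊕-identityˡ y))))
  ⊗-zeroʳ : ∀ x → x ⊗ 0# ≡ 0#
  ⊗-zeroʳ x = trans (cong (x ⊗_) (sym (⊕-self 0#))) (trans (⊗-distribˡ x 0# 0#) (⊕-self _))
  ⊗-zeroˡ : ∀ x → 0# ⊗ x ≡ 0#
  ⊗-zeroˡ x = trans (⊗-comm 0# x) (⊗-zeroʳ x)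
  ⊕-swap : ∀ a b c d → (a ⊕ b) ⊕ (c ⊕ d) ≡ (a ⊕ c) ⊕ (b ⊕ d)
  ⊕-swap a b c d = trans (⊕-assoc a b _) (trans (cong (a ⊕_) (trans (sym (⊕-assoc b c d))
    (trans (cong (_⊕ d) (⊕-comm b c)) (⊕-assoc c b d)))) (sym (⊕-assoc a c _)))
  ⊗-swap : ∀ a b c d → (a ⊗ b) ⊗ (c ⊗ d) ≡ (a ⊗ c) ⊗ (b ⊗ d)
  ⊗-swap a b c d = trans (⊗-assoc a b _) (trans (cong (a ⊗_) (trans (sym (⊗-assoc b c d))
    (trans (cong (_⊗ d) (⊗-comm b c)) (⊗-assoc c b d)))) (sym (⊗-assoc a c _)))

  ⊕-cancelˡ : ∀ x {y z} → x ⊕ y ≡ x ⊕ z → y ≡ z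
  ⊕-cancelˡ x {y} {z} e = trans (sym (lem y)) (trans (cong (x ⊕_) e) (lem z))
    where
    lem : ∀ y → x ⊕ (x ⊕ y) ≡ y
    lem y = trans (sym (⊕-assoc x x y)) (trans (cong (_⊕ y) (⊕-self x)) (⊕-identityˡ y))

  ⊕-cancelʳ : ∀ x {y z} → y ⊕ x ≡ z ⊕ x → y ≡ z
  ⊕-cancelʳ x {y} {z} e = ⊕-cancelˡ x (trans (⊕-comm x y) (trans e (⊕-comm z x)))

  Integral : Set
  Integral = ∀ x y → x ⊗ y ≡ 0# → x ≡ 0# ⊎ y ≡ 0#

  pow : Carrier → ℕ → Carrier
  pow x zero = 1#
  pow x (suc n) = x ⊗ pow x n

  pow-+ : ∀ x m n → pow x (m + n) ≡ pow x m ⊗ pow x n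
  pow-+ x zero n = sym (⊗-identityˡ _)
  pow-+ x (suc m) n = trans (cong (x ⊗_) (pow-+ x m n)) (sym (⊗-assoc x _ _))
  pow-⊗ : ∀ x y n → pow (x ⊗ y) n ≡ pow x n ⊗ pow y n
  pow-⊗ x y zero = sym (⊗-identityˡ _)
  pow-⊗ x y (suc n) = trans (cong ((x ⊗ y) ⊗_) (pow-⊗ x y n)) (⊗-swap x y _ _)

  -- frob n x = x ^ (2 ^ n)
  frob : ℕ → Carrier → Carrier
  frob zero x = x
  frob (suc n) x = frob n (x ⊗ x)

  frob-⊗ : ∀ n x y → frob n (x ⊗ y) ≡ frob n x ⊗ frob n y
  frob-⊗ zero x y = refl
  frob-⊗ (suc n) x y = trans (cong (frob n) (⊗-swap x y x y)) (frob-⊗ n (x ⊗ x) (y ⊗ y))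

  square-⊕ : ∀ x y → (x ⊕ y) ⊗ (x ⊕ y) ≡ x ⊗ x ⊕ y ⊗ y
  square-⊕ x y = trans (⊗-distribˡ (x ⊕ y) x y) (trans (cong₂ _⊕_ (⊗-distribʳ x x y) (⊗-distribʳ y x y))
    (trans (⊕-assoc (x ⊗ x) (y ⊗ x) _) (cong (x ⊗ x ⊕_) (trans (sym (⊕-assoc (y ⊗ x) (x ⊗ y) (y ⊗ y)))
      (trans (cong (_⊕ y ⊗ y) (trans (cong (y ⊗ x ⊕_) (⊗-comm x y)) (⊕-self _))) (⊕-identityˡ _))))))

  frob-⊕ : ∀ n x y → frob n (x ⊕ y) ≡ frob n x ⊕ frob n y
  frob-⊕ zero x y = refl
  frob-⊕ (suc n) x y = trans (cong (frob n) (square-⊕ x y)) (frob-⊕ n (x ⊗ x) (y ⊗ y))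

  frob-+ : ∀ m n x → frob (m + n) x ≡ frob n (frob m x)
  frob-+ zero n x = refl
  frob-+ (suc m) n x = frob-+ m n (x ⊗ x)

  frob-1 : ∀ n → frob n 1# ≡ 1#
  frob-1 zero = refl
  frob-1 (suc n) = trans (cong (frob n) (⊗-identityˡ 1#)) (frob-1 n)

  frob-0 : ∀ n → frob n 0# ≡ 0#
  frob-0 zero = refl
  frob-0 (suc n) = trans (cong (frob n) (⊗-zeroˡ 0#)) (frob-0 n)

  frob-pow : ∀ n x → frob n x ≡ pow x (2 ^ n)
  frob-pow zero x = sym (⊗-identityʳ x)
  frob-pow (suc n) x = trans (frob-pow n (x ⊗ x)) (trans (pow-⊗ x x (2 ^ n)) (trans (sym (pow-+ x (2 ^ n) (2 ^ n))) (cong (λ k → pow x (2 ^ n + k)) (sym (+-identityʳ (2 ^ n))))))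

record TitsRing : Set₁ where
  field
    ring : CharTwo
  open CharTwo ring public
  field
    σ : Carrier → Carrier
    σ-⊕ : ∀ x y → σ (x ⊕ y) ≡ σ x ⊕ σ y
    σ-⊗ : ∀ x y → σ (x ⊗ y) ≡ σ x ⊗ σ y
    σ-1 : σ 1# ≡ 1#
    σ-σ : ∀ x → σ (σ x) ≡ x ⊗ x

  σ-0 : σ 0# ≡ 0#
  σ-0 = trans (cong σ (sym (⊕-self 0#))) (trans (σ-⊕ 0# 0#) (⊕-self _))
  operations : Operations Carrier
  operations = record { _⊞_ = _⊕_ ; _⊠_ = _⊗_ ; 𝟘 = 0# ; σ = σ }

  σ-pow : ∀ x n → σ (pow x n) ≡ pow (σ x) n
  σ-pow x zero = σ-1
  σ-pow x (suc n) = trans (σ-⊗ x _) (cong (σ x ⊗_) (σ-pow x n))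

-- A monomial is its list of exponents: the entry (a , b) for x stands for x ^ a * (σ x) ^ b.
data Mono : Set where
  ε : Mono
  _,_◂_ : ℕ → ℕ → Mono → Mono

Poly : Set
Poly = List Mono

data Order : Set where
  below level above : Order

cmpℕ : ℕ → ℕ → Order → Order
cmpℕ a b o = if a ≡ᵇ b then o else (if a <ᵇ b then below else above)

cmp : Mono → Mono → Order
cmp ε ε = level
cmp ε (_ , _ ◂ _) = below
cmp (_ , _ ◂ _) ε = above
cmp (a , b ◂ m) (c , d ◂ n) = cmpℕ a c (cmpℕ b d (cmp m n))

_·_ : Mono → Mono → Mono
ε · n = n
(a , b ◂ m) · ε = a , b ◂ m
(a , b ◂ m) · (c , d ◂ n) = (a + c) , (b + d) ◂ (m · n)

-- The relation σ (σ x) = x² sends x^a (σ x)^b to x^(2b) (σ x)^a.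
twist : Mono → Mono
twist ε = ε
twist (a , b ◂ m) = (b + b) , a ◂ twist m

infixl 6 _+ᴾ_
infixl 7 _*ᴾ_

mutual
  _+ᴾ_ : Poly → Poly → Poly
  [] +ᴾ q = q
  (m ∷ p) +ᴾ q = insert m p q

  insert : Mono → Poly → Poly → Poly
  insert m p [] = m ∷ p
  insert m p (n ∷ q) = insert′ (cmp m n) m p n q

  insert′ : Order → Mono → Poly → Mono → Poly → Poly
  insert′ below m p n q = m ∷ (p +ᴾ (n ∷ q))
  -- Coefficients lie in the field with two elements, so a polynomial is a list of monomials and
  -- equal monomials cancel.
  insert′ level m p n q = p +ᴾ q
  insert′ above m p n q = n ∷ insert m p q

shift : Mono → Poly → Poly
shift m [] = []
shift m (n ∷ q) = (m · n) ∷ shift m q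

pairUp : List Poly → List Poly
pairUp (p ∷ q ∷ ps) = (p +ᴾ q) ∷ pairUp ps
pairUp ps = ps

total : List Poly → Poly
total [] = []
total (p ∷ ps) = p +ᴾ total ps

-- Merging in a balanced tree keeps large products feasible. Sixteen rounds reach 2^16 summands, and
-- the fallback `total` makes the result correct for any number.
balanced : ℕ → List Poly → Poly
balanced zero ps = total ps
balanced (suc n) [] = []
balanced (suc n) (p ∷ []) = p
balanced (suc n) (p ∷ q ∷ ps) = balanced n (pairUp (p ∷ q ∷ ps))

shifts : Poly → Poly → List Poly
shifts [] q = []
shifts (m ∷ p) q = shift m q ∷ shifts p q

_*ᴾ_ : Poly → Poly → Poly
p *ᴾ q = balanced 16 (shifts p q)

σ⁺ : Poly → Poly
σ⁺ [] = []
σ⁺ (m ∷ p) = (twist m ∷ []) +ᴾ σ⁺ p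

module Eval (R : TitsRing) where
  open TitsRing R

  evalM : Mono → List Carrier → Carrier
  evalM ε ρ = 1#
  evalM (a , b ◂ m) [] = 1#
  evalM (a , b ◂ m) (x ∷ ρ) = (pow x a ⊗ pow (σ x) b) ⊗ evalM m ρ

  evalP : Poly → List Carrier → Carrier
  evalP [] ρ = 0#
  evalP (m ∷ p) ρ = evalM m ρ ⊕ evalP p ρ

  eval-· : ∀ m n ρ → evalM (m · n) ρ ≡ evalM m ρ ⊗ evalM n ρ
  eval-· ε n ρ = sym (⊗-identityˡ _)
  eval-· (a , b ◂ m) ε [] = sym (⊗-identityʳ _)
  eval-· (a , b ◂ m) ε (x ∷ ρ) = sym (⊗-identityʳ _)
  eval-· (a , b ◂ m) (c , d ◂ n) [] = sym (⊗-identityˡ _)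
  eval-· (a , b ◂ m) (c , d ◂ n) (x ∷ ρ) =
    trans (cong₂ _⊗_ (trans (cong₂ _⊗_ (pow-+ x a c) (pow-+ (σ x) b d)) (⊗-swap _ _ _ _)) (eval-· m n ρ))
          (⊗-swap _ _ _ _)

  eval-twist : ∀ m ρ → evalM (twist m) ρ ≡ σ (evalM m ρ)
  eval-twist ε ρ = sym σ-1
  eval-twist (a , b ◂ m) [] = sym σ-1
  eval-twist (a , b ◂ m) (x ∷ ρ) = trans (cong₂ _⊗_ lem (eval-twist m ρ)) (sym (σ-⊗ _ _))
    where
    lem : pow x (b + b) ⊗ pow (σ x) a ≡ σ (pow x a ⊗ pow (σ x) b)
    lem = trans (⊗-comm _ _) (trans (cong₂ _⊗_ (sym (σ-pow x a))
      (trans (pow-+ x b b) (trans (sym (pow-⊗ x x b)) (trans (cong (λ z → pow z b) (sym (σ-σ x))) (sym (σ-pow (σ x) b))))))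
      (sym (σ-⊗ _ _)))

  cmpℕ-eq : ∀ a b o → cmpℕ a b o ≡ level → a ≡ b
  cmpℕ-eq a b o e with a ≡ᵇ b in h
  ... | true = ≡ᵇ⇒≡ a b (subst Bool.T (sym h) _)
  ... | false with a <ᵇ b | e
  ...   | true | ()
  ...   | false | ()

  cmpℕ-rest : ∀ a b o → cmpℕ a b o ≡ level → o ≡ level
  cmpℕ-rest a b o e with a ≡ᵇ b
  ... | true = e
  ... | false with a <ᵇ b | e
  ...   | true | ()
  ...   | false | ()

  cmp-eq : ∀ m n → cmp m n ≡ level → m ≡ n
  cmp-eq ε ε _ = refl
  cmp-eq (a , b ◂ m) (c , d ◂ n) e
    with refl ← cmpℕ-eq a c _ e
    with e′ ← cmpℕ-rest a a _ e
    with refl ← cmpℕ-eq b d _ e′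
    with refl ← cmp-eq m n (cmpℕ-rest b b _ e′) = refl

  mutual
    eval-+ : ∀ p q ρ → evalP (p +ᴾ q) ρ ≡ evalP p ρ ⊕ evalP q ρ
    eval-+ [] q ρ = sym (⊕-identityˡ _)
    eval-+ (m ∷ p) q ρ = eval-insert m p q ρ

    eval-insert : ∀ m p q ρ → evalP (insert m p q) ρ ≡ (evalM m ρ ⊕ evalP p ρ) ⊕ evalP q ρ
    eval-insert m p [] ρ = sym (⊕-identityʳ _)
    eval-insert m p (n ∷ q) ρ with cmp m n in e
    ... | below = trans (cong (evalM m ρ ⊕_) (eval-+ p (n ∷ q) ρ)) (sym (⊕-assoc _ _ _))
    ... | level with refl ← cmp-eq m n e = trans (eval-+ p q ρ) (trans (sym (⊕-identityˡ _))
            (trans (cong (_⊕ (evalP p ρ ⊕ evalP q ρ)) (sym (⊕-self (evalM m ρ)))) (⊕-swap _ _ _ _)))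
    ... | above = trans (cong (evalM n ρ ⊕_) (eval-insert m p q ρ)) (trans (sym (⊕-assoc _ _ _))
            (trans (cong (_⊕ evalP q ρ) (⊕-comm _ _)) (⊕-assoc _ _ _)))

  eval-shift : ∀ m q ρ → evalP (shift m q) ρ ≡ evalM m ρ ⊗ evalP q ρ
  eval-shift m [] ρ = sym (⊗-zeroʳ _)
  eval-shift m (n ∷ q) ρ = trans (cong₂ _⊕_ (eval-· m n ρ) (eval-shift m q ρ)) (sym (⊗-distribˡ _ _ _))

  eval-pairUp : ∀ ps ρ → evalP (total (pairUp ps)) ρ ≡ evalP (total ps) ρ
  eval-pairUp [] ρ = refl
  eval-pairUp (p ∷ []) ρ = refl
  eval-pairUp (p ∷ q ∷ ps) ρ = trans (eval-+ (p +ᴾ q) _ ρ) (trans (cong₂ _⊕_ (eval-+ p q ρ) (eval-pairUp ps ρ))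
    (trans (⊕-assoc _ _ _) (sym (trans (eval-+ p _ ρ) (cong (evalP p ρ ⊕_) (eval-+ q _ ρ))))))

  eval-balanced : ∀ n ps ρ → evalP (balanced n ps) ρ ≡ evalP (total ps) ρ
  eval-balanced zero ps ρ = refl
  eval-balanced (suc n) [] ρ = refl
  eval-balanced (suc n) (p ∷ []) ρ = sym (trans (eval-+ p [] ρ) (⊕-identityʳ _))
  eval-balanced (suc n) (p ∷ q ∷ ps) ρ = trans (eval-balanced n (pairUp (p ∷ q ∷ ps)) ρ) (eval-pairUp (p ∷ q ∷ ps) ρ)

  eval-shifts : ∀ p q ρ → evalP (total (shifts p q)) ρ ≡ evalP p ρ ⊗ evalP q ρ
  eval-shifts [] q ρ = sym (⊗-zeroˡ _)
  eval-shifts (m ∷ p) q ρ = trans (eval-+ (shift m q) _ ρ) (trans (cong₂ _⊕_ (eval-shift m q ρ) (eval-shifts p q ρ))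
    (sym (⊗-distribʳ _ _ _)))

  eval-* : ∀ p q ρ → evalP (p *ᴾ q) ρ ≡ evalP p ρ ⊗ evalP q ρ
  eval-* p q ρ = trans (eval-balanced 16 (shifts p q) ρ) (eval-shifts p q ρ)

  eval-σ : ∀ p ρ → evalP (σ⁺ p) ρ ≡ σ (evalP p ρ)
  eval-σ [] ρ = sym σ-0
  eval-σ (m ∷ p) ρ = trans (eval-+ (twist m ∷ []) (σ⁺ p) ρ)
    (trans (cong₂ _⊕_ (trans (⊕-identityʳ _) (eval-twist m ρ)) (eval-σ p ρ)) (sym (σ-⊕ _ _)))

  -- Proof by computation without a syntax tree: `val` unfolds to the ring expression of a lemma,
  -- while `poly` evaluates to its normal form. In characteristic 2 two terms agree when the normal
  -- form of their sum is empty, which `refl` checks.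
  record Term (ρ : List Carrier) : Set where
    constructor term
    field
      poly : Poly
      val : Carrier
      sound : evalP poly ρ ≡ val
  open Term public

  module Ops {ρ : List Carrier} where
    infixl 6 _⊞_
    infixl 7 _⊠_
    _⊞_ _⊠_ : Term ρ → Term ρ → Term ρ
    (x ⊞ y) .poly = x .poly +ᴾ y .poly
    (x ⊞ y) .val = x .val ⊕ y .val
    (x ⊞ y) .sound = trans (eval-+ (x .poly) (y .poly) ρ) (cong₂ _⊕_ (x .sound) (y .sound))
    (x ⊠ y) .poly = x .poly *ᴾ y .poly
    (x ⊠ y) .val = x .val ⊗ y .val
    (x ⊠ y) .sound = trans (eval-* (x .poly) (y .poly) ρ) (cong₂ _⊗_ (x .sound) (y .sound))
    σ̂ : Term ρ → Term ρ
    σ̂ x .poly = σ⁺ (x .poly)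
    σ̂ x .val = σ (x .val)
    σ̂ x .sound = trans (eval-σ (x .poly) ρ) (cong σ (x .sound))
    𝟘 : Term ρ
    𝟘 = term [] 0# refl

    agree : (x y : Term ρ) → (x ⊞ y) .poly ≡ [] → x .val ≡ y .val
    agree x y e = ⊕-cancelʳ0 _ _ (trans (sym ((x ⊞ y) .sound)) (cong (λ p → evalP p ρ) e))

    term-operations : Operations (Term ρ)
    term-operations = record { _⊞_ = _⊞_ ; _⊠_ = _⊠_ ; 𝟘 = 𝟘 ; σ = σ̂ }

  -- Padding to the full number of variables gives equal monomials equal lists, so that `cmp`
  -- recognises them.
  zeros : ℕ → Mono
  zeros zero = ε
  zeros (suc n) = 0 , 0 ◂ zeros n

  varM : ℕ → ℕ → Mono
  varM zero n = ε
  varM (suc n) zero = 1 , 0 ◂ zeros n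
  varM (suc n) (suc i) = 0 , 0 ◂ varM n i

  nth : List Carrier → ℕ → Carrier
  nth [] i = 1#
  nth (x ∷ ρ) zero = x
  nth (x ∷ ρ) (suc i) = nth ρ i

  eval-zeros : ∀ n ρ → evalM (zeros n) ρ ≡ 1#
  eval-zeros zero ρ = refl
  eval-zeros (suc n) [] = refl
  eval-zeros (suc n) (x ∷ ρ) = trans (cong₂ _⊗_ (⊗-identityˡ 1#) (eval-zeros n ρ)) (⊗-identityˡ 1#)

  eval-varM : ∀ ρ i → evalM (varM (List.length ρ) i) ρ ≡ nth ρ i
  eval-varM [] i = refl
  eval-varM (x ∷ ρ) zero = trans (cong₂ _⊗_ (trans (⊗-identityʳ _) (⊗-identityʳ x)) (eval-zeros (List.length ρ) ρ)) (⊗-identityʳ x)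
  eval-varM (x ∷ ρ) (suc i) = trans (cong₂ _⊗_ (⊗-identityˡ 1#) (eval-varM ρ i)) (⊗-identityˡ _)

  var : ∀ {ρ} → ℕ → Term ρ
  var {ρ} i = term (varM (List.length ρ) i ∷ []) (nth ρ i) (trans (⊕-identityʳ _) (eval-varM ρ i))

-- The octagon

module Formulas {A : Set} (operations : Operations A) where
  open Operations operations

  record V4 : Set where
    constructor v4
    field c₀ c₁ c₂ c₃ : A
  open V4 public

  record Line : Set where
    constructor line
    field
      vec : V4
      mid : A
      mom : V4
      cub : A
  open Line public

  form : V4 → V4 → A
  form x y = (c₀ x ⊠ c₃ y ⊞ c₃ x ⊠ c₀ y) ⊞ (c₁ x ⊠ c₂ y ⊞ c₂ x ⊠ c₁ y)

  _⊞⁴_ : V4 → V4 → V4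
  v4 a b c d ⊞⁴ v4 a′ b′ c′ d′ = v4 (a ⊞ a′) (b ⊞ b′) (c ⊞ c′) (d ⊞ d′)

  act : V4 → A → V4 → V4
  act (v4 o₀ o₁ o₂ o₃) w (v4 x₀ x₁ x₂ x₃) = v4
    (σ o₀ ⊠ x₂ ⊞ σ o₁ ⊠ x₁ ⊞ w ⊠ x₀)
    (σ o₀ ⊠ x₃ ⊞ σ o₂ ⊠ x₀ ⊞ w ⊠ x₁)
    (σ o₁ ⊠ x₃ ⊞ σ o₃ ⊠ x₀ ⊞ w ⊠ x₂)
    (σ o₂ ⊠ x₂ ⊞ σ o₃ ⊠ x₁ ⊞ w ⊠ x₃)

  theta : V4 → A → V4 → A
  theta (v4 o₀ o₁ o₂ o₃) w (v4 x₀ x₁ x₂ x₃) =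
    σ o₀ ⊠ (x₂ ⊠ x₃) ⊞ σ o₁ ⊠ (x₁ ⊠ x₃) ⊞ σ o₂ ⊠ (x₀ ⊠ x₂) ⊞ σ o₃ ⊠ (x₀ ⊠ x₁) ⊞ w ⊠ (x₀ ⊠ x₃ ⊞ x₁ ⊠ x₂)

  -- Multiplication of a group element, which labels a line, by a generator with coordinates (x , y).
  step : Line → V4 → A → Line
  step (line s w p r) x y = line (s ⊞⁴ x) (w ⊞ y) (p ⊞⁴ act s w x)
    (r ⊞ (form p x ⊞ (theta s w x ⊞ w ⊠ σ y)))

  origin : Line
  origin = line (v4 𝟘 𝟘 𝟘 𝟘) 𝟘 (v4 𝟘 𝟘 𝟘 𝟘) 𝟘

  -- The anisotropic form t^(σ+2) + t u + u^σ of the Suzuki group.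
  norm : A → A → A
  norm t u = σ t ⊠ (t ⊠ t) ⊞ t ⊠ u ⊞ σ u

  -- κ times the point (1 : t : u : N(t,u)) of the Suzuki-Tits ovoid in projective 3-space.
  dir : A → A → A → V4
  dir κ t u = v4 κ (κ ⊠ t) (κ ⊠ u) (κ ⊠ norm t u)
  dirʷ : A → A → A → A
  dirʷ κ t u = σ κ ⊠ (σ t ⊠ t ⊞ u)

  move : Line → A → A → A → Line
  move ℓ κ t u = step ℓ (dir κ t u) (dirʷ κ t u)

  -- Found by linear algebra on the monomials of the right weight: it vanishes on three letters and factors on four.
  opp : Line → A
  opp (line (v4 s₀ s₁ s₂ s₃) w (v4 p₀ p₁ p₂ p₃) r) =
    go (σ s₀) (σ s₁) (σ s₂) (σ s₃) (σ w) (σ p₀) (σ p₁) (σ p₂) (σ p₃) (s₀ ⊠ s₃ ⊞ s₁ ⊠ s₂)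
    where
    go : A → A → A → A → A → A → A → A → A → A → A
    go s₀′ s₁′ s₂′ s₃′ w′ p₀′ p₁′ p₂′ p₃′ h =
      r ⊠ (r ⊞ (s₀ ⊠ p₃ ⊞ s₃ ⊠ p₀ ⊞ (s₁ ⊠ p₂ ⊞ s₂ ⊠ p₁))) ⊞ σ r ⊠ (w′ ⊞ h)
      ⊞ p₃ ⊠ (p₀ ⊠ (w′ ⊞ h) ⊞ s₁ ⊠ p₁′ ⊞ s₂ ⊠ p₀′ ⊞ s₂ ⊠ (s₀′ ⊠ (w′ ⊞ s₁ ⊠ s₂) ⊞ s₂′ ⊠ (s₀ ⊠ s₀) ⊞ s₁′ ⊠ (s₁ ⊠ s₁)) ⊞ s₁ ⊠ (w′ ⊠ s₁′ ⊞ s₃′ ⊠ (s₀ ⊠ s₀)))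
      ⊞ p₂ ⊠ (p₁ ⊠ (w′ ⊞ h) ⊞ s₀ ⊠ p₂′ ⊞ s₃ ⊠ p₀′ ⊞ s₃ ⊠ (s₀′ ⊠ (w′ ⊞ s₀ ⊠ s₃) ⊞ s₂′ ⊠ (s₀ ⊠ s₀) ⊞ s₁′ ⊠ (s₁ ⊠ s₁)) ⊞ s₀ ⊠ (w′ ⊠ s₂′ ⊞ s₃′ ⊠ (s₁ ⊠ s₁)))
      ⊞ p₁ ⊠ (s₀ ⊠ p₃′ ⊞ s₃ ⊠ p₁′ ⊞ s₃ ⊠ (s₁′ ⊠ (w′ ⊞ s₀ ⊠ s₃) ⊞ s₃′ ⊠ (s₀ ⊠ s₀) ⊞ s₀′ ⊠ (s₂ ⊠ s₂)) ⊞ s₀ ⊠ (w′ ⊠ s₃′ ⊞ s₂′ ⊠ (s₂ ⊠ s₂)))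
      ⊞ p₀ ⊠ (s₁ ⊠ p₃′ ⊞ s₂ ⊠ p₂′ ⊞ s₂ ⊠ (s₂′ ⊠ (w′ ⊞ s₁ ⊠ s₂) ⊞ s₃′ ⊠ (s₁ ⊠ s₁) ⊞ s₀′ ⊠ (s₃ ⊠ s₃)) ⊞ s₁ ⊠ (w′ ⊠ s₃′ ⊞ s₁′ ⊠ (s₃ ⊠ s₃)))
      ⊞ p₃′ ⊠ (p₀′ ⊞ s₀′ ⊠ h ⊞ s₂′ ⊠ (s₀ ⊠ s₀) ⊞ s₁′ ⊠ (s₁ ⊠ s₁))
      ⊞ p₂′ ⊠ (p₁′ ⊞ s₁′ ⊠ h ⊞ s₃′ ⊠ (s₀ ⊠ s₀) ⊞ s₀′ ⊠ (s₂ ⊠ s₂))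
      ⊞ p₁′ ⊠ (s₂′ ⊠ h ⊞ s₃′ ⊠ (s₁ ⊠ s₁) ⊞ s₀′ ⊠ (s₃ ⊠ s₃))
      ⊞ p₀′ ⊠ (s₃′ ⊠ h ⊞ s₂′ ⊠ (s₂ ⊠ s₂) ⊞ s₁′ ⊠ (s₃ ⊠ s₃))
      ⊞ w′ ⊠ (w ⊠ (w ⊠ (w′ ⊞ h)) ⊞ s₃′ ⊠ (s₀′ ⊠ h ⊞ s₂′ ⊠ (s₀ ⊠ s₀) ⊞ s₁′ ⊠ (s₁ ⊠ s₁)) ⊞ s₂′ ⊠ (s₁′ ⊠ h ⊞ s₀′ ⊠ (s₂ ⊠ s₂)) ⊞ s₀′ ⊠ (s₁′ ⊠ (s₃ ⊠ s₃)))
      ⊞ s₃ ⊠ (s₃ ⊠ (s₁′ ⊠ (s₀′ ⊠ h ⊞ s₂′ ⊠ (s₀ ⊠ s₀) ⊞ s₁′ ⊠ (s₁ ⊠ s₁)) ⊞ s₀′ ⊠ (s₃′ ⊠ (s₀ ⊠ s₀) ⊞ s₀′ ⊠ (s₂ ⊠ s₂))) ⊞ s₀ ⊠ (s₃′ ⊠ (s₂′ ⊠ (s₀ ⊠ s₀) ⊞ s₁′ ⊠ (s₁ ⊠ s₁)) ⊞ s₀′ ⊠ (s₂′ ⊠ (s₂ ⊠ s₂))))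
      ⊞ s₂ ⊠ (s₁ ⊠ (s₃′ ⊠ (s₁ ⊠ (s₁′ ⊠ s₁ ⊞ s₀′ ⊠ s₂) ⊞ s₂′ ⊠ (s₀ ⊠ s₀)) ⊞ s₂′ ⊠ (s₂ ⊠ (s₁′ ⊠ s₁ ⊞ s₀′ ⊠ s₂))) ⊞ s₂′ ⊠ (s₂′ ⊠ (s₂ ⊠ (s₀ ⊠ s₀))))
      ⊞ s₃′ ⊠ (s₃′ ⊠ (s₁ ⊠ (s₁ ⊠ (s₀ ⊠ s₀))))

module OctagonGroup (R : TitsRing) where
  open TitsRing R
  open Eval R
  open Formulas operations
  module _ {ρ : List Carrier} where
    open Ops {ρ} public
    module 𝕋 = Formulas term-operations

    vals : 𝕋.V4 → V4
    vals (𝕋.v4 a b c d) = v4 (a .val) (b .val) (c .val) (d .val)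
    valℓ : 𝕋.Line → Line
    valℓ (𝕋.line s w p r) = line (vals s) (w .val) (vals p) (r .val)

    infix 4 _≈_ _≈ℓ_
    _≈_ : Term ρ → Term ρ → Set
    x ≈ y = (x ⊞ y) .poly ≡ []

    agree⁴ : ∀ x y → 𝕋.c₀ x ≈ 𝕋.c₀ y → 𝕋.c₁ x ≈ 𝕋.c₁ y → 𝕋.c₂ x ≈ 𝕋.c₂ y → 𝕋.c₃ x ≈ 𝕋.c₃ y → vals x ≡ vals y
    agree⁴ x y e₀ e₁ e₂ e₃ with agree (𝕋.c₀ x) (𝕋.c₀ y) e₀ | agree (𝕋.c₁ x) (𝕋.c₁ y) e₁ | agree (𝕋.c₂ x) (𝕋.c₂ y) e₂ | agree (𝕋.c₃ x) (𝕋.c₃ y) e₃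
    ... | a | b | c | d = cong₂ (λ p q → v4 (proj₁ p) (proj₂ p) (proj₁ q) (proj₂ q)) (cong₂ _,_ a b) (cong₂ _,_ c d)

    record _≈ℓ_ (x y : 𝕋.Line) : Set where
      constructor same
      field
        s₀ : 𝕋.c₀ (𝕋.vec x) ≈ 𝕋.c₀ (𝕋.vec y)
        s₁ : 𝕋.c₁ (𝕋.vec x) ≈ 𝕋.c₁ (𝕋.vec y)
        s₂ : 𝕋.c₂ (𝕋.vec x) ≈ 𝕋.c₂ (𝕋.vec y)
        s₃ : 𝕋.c₃ (𝕋.vec x) ≈ 𝕋.c₃ (𝕋.vec y)
        w : 𝕋.mid x ≈ 𝕋.mid y
        p₀ : 𝕋.c₀ (𝕋.mom x) ≈ 𝕋.c₀ (𝕋.mom y)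
        p₁ : 𝕋.c₁ (𝕋.mom x) ≈ 𝕋.c₁ (𝕋.mom y)
        p₂ : 𝕋.c₂ (𝕋.mom x) ≈ 𝕋.c₂ (𝕋.mom y)
        p₃ : 𝕋.c₃ (𝕋.mom x) ≈ 𝕋.c₃ (𝕋.mom y)
        r : 𝕋.cub x ≈ 𝕋.cub y

    agreeℓ : ∀ x y → x ≈ℓ y → valℓ x ≡ valℓ y
    agreeℓ x y (same a b c d e f g h i j) = cong₂ (λ p q → line (proj₁ p) (proj₂ p) (proj₁ q) (proj₂ q))
      (cong₂ _,_ (agree⁴ (𝕋.vec x) (𝕋.vec y) a b c d) (agree (𝕋.mid x) (𝕋.mid y) e))
      (cong₂ _,_ (agree⁴ (𝕋.mom x) (𝕋.mom y) f g h i) (agree (𝕋.cub x) (𝕋.cub y) j))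

  -- The product of two arbitrary group elements; `step` is the case where the right factor has
  -- `mom` and `cub` zero. Left multiplication commutes with letters, so a relation between words at
  -- any line can be moved to `origin`.
  compose : Line → Line → Line
  compose (line s w p r) (line s′ w′ p′ r′) = line (s ⊞⁴ s′) (w ⊕ w′) (p ⊞⁴ (p′ ⊞⁴ act s w s′)) (r ⊕ (r′ ⊕ (form p s′ ⊕ (theta s w s′ ⊕ w ⊗ σ w′))))

  line-vars : ∀ {ρ} → ℕ → 𝕋.Line {ρ}
  line-vars i = 𝕋.line (𝕋.v4 (var i) (var (1 + i)) (var (2 + i)) (var (3 + i))) (var (4 + i)) (𝕋.v4 (var (5 + i)) (var (6 + i)) (var (7 + i)) (var (8 + i))) (var (9 + i))

  -- For fixed t and u the letters form a copy of the additive group, the one-parameter subgroup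
  -- whose cosets are the points.
  move-move : ∀ x κ κ′ t u → move (move x κ t u) κ′ t u ≡ move x (κ ⊕ κ′) t u
  move-move (line (v4 a b c d) w (v4 e f g h) r) κ κ′ t u = agreeℓ {ρ} (𝕋.move (𝕋.move x k T U) k′ T U) (𝕋.move x (k ⊞ k′) T U) (same refl refl refl refl refl refl refl refl refl refl)
    where
    ρ = a ∷ b ∷ c ∷ d ∷ w ∷ e ∷ f ∷ g ∷ h ∷ r ∷ κ ∷ κ′ ∷ t ∷ u ∷ []
    x = line-vars {ρ} 0
    k k′ T U : Term ρ
    k = var 10
    k′ = var 11
    T = var 12
    U = var 13

  move-0 : ∀ x t u → move x 0# t u ≡ x
  move-0 (line (v4 a b c d) w (v4 e f g h) r) t u = agreeℓ {ρ} (𝕋.move x 𝟘 (var 10) (var 11)) x (same refl refl refl refl refl refl refl refl refl refl)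
    where
    ρ = a ∷ b ∷ c ∷ d ∷ w ∷ e ∷ f ∷ g ∷ h ∷ r ∷ t ∷ u ∷ []
    x = line-vars {ρ} 0

  move-involutive : ∀ x κ t u → move (move x κ t u) κ t u ≡ x
  move-involutive x κ t u = trans (move-move x κ κ t u) (trans (cong (λ z → move x z t u) (⊕-self κ)) (move-0 x t u))

  compose-origin : ∀ x → compose x origin ≡ x
  compose-origin (line (v4 a b c d) w (v4 e f g h) r) = agreeℓ {ρ} y x (same refl refl refl refl refl refl refl refl refl refl)
    where
    ρ = a ∷ b ∷ c ∷ d ∷ w ∷ e ∷ f ∷ g ∷ h ∷ r ∷ []
    x = line-vars {ρ} 0
    y : 𝕋.Line {ρ}
    y = 𝕋.line (𝕋._⊞⁴_ (𝕋.vec x) (𝕋.v4 𝟘 𝟘 𝟘 𝟘)) (𝕋.mid x ⊞ 𝟘) (𝕋._⊞⁴_ (𝕋.mom x) (𝕋._⊞⁴_ (𝕋.v4 𝟘 𝟘 𝟘 𝟘) (𝕋.act (𝕋.vec x) (𝕋.mid x) (𝕋.v4 𝟘 𝟘 𝟘 𝟘))))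
      (𝕋.cub x ⊞ (𝟘 ⊞ (𝕋.form (𝕋.mom x) (𝕋.v4 𝟘 𝟘 𝟘 𝟘) ⊞ (𝕋.theta (𝕋.vec x) (𝕋.mid x) (𝕋.v4 𝟘 𝟘 𝟘 𝟘) ⊞ 𝕋.mid x ⊠ σ̂ 𝟘))))

  compose-step : ∀ x y v z → compose x (step y v z) ≡ step (compose x y) v z
  compose-step (line (v4 a b c d) w (v4 e f g h) r) (line (v4 a′ b′ c′ d′) w′ (v4 e′ f′ g′ h′) r′) (v4 i j k l) z =
      agreeℓ {ρ} (∘ᵀ x (𝕋.step y v (var 24))) (𝕋.step (∘ᵀ x y) v (var 24)) (same refl refl refl refl refl refl refl refl refl refl)
    where
    ρ = a ∷ b ∷ c ∷ d ∷ w ∷ e ∷ f ∷ g ∷ h ∷ r ∷ a′ ∷ b′ ∷ c′ ∷ d′ ∷ w′ ∷ e′ ∷ f′ ∷ g′ ∷ h′ ∷ r′ ∷ i ∷ j ∷ k ∷ l ∷ z ∷ []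
    x y : 𝕋.Line {ρ}
    x = line-vars {ρ} 0
    y = line-vars {ρ} 10
    v : 𝕋.V4 {ρ}
    v = 𝕋.v4 (var 20) (var 21) (var 22) (var 23)
    ∘ᵀ : 𝕋.Line {ρ} → 𝕋.Line {ρ} → 𝕋.Line {ρ}
    ∘ᵀ (𝕋.line s w p r) (𝕋.line s′ w′ p′ r′) = 𝕋.line (𝕋._⊞⁴_ s s′) (w ⊞ w′) (𝕋._⊞⁴_ p (𝕋._⊞⁴_ p′ (𝕋.act s w s′))) (r ⊞ (r′ ⊞ (𝕋.form p s′ ⊞ (𝕋.theta s w s′ ⊞ w ⊠ σ̂ w′))))

  ⊞⁴-cancelˡ : ∀ x {y z} → x ⊞⁴ y ≡ x ⊞⁴ z → y ≡ z
  ⊞⁴-cancelˡ (v4 a b c d) {v4 e f g h} {v4 i j k l} h′ = trans (cong₂ (λ p q → v4 p q g h) (⊕-cancelˡ a (cong c₀ h′)) (⊕-cancelˡ b (cong c₁ h′)))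
    (cong₂ (λ p q → v4 i j p q) (⊕-cancelˡ c (cong c₂ h′)) (⊕-cancelˡ d (cong c₃ h′)))

  ⊞⁴-cancelʳ : ∀ x {y z} → y ⊞⁴ x ≡ z ⊞⁴ x → y ≡ z
  ⊞⁴-cancelʳ (v4 a b c d) {v4 e f g h} {v4 i j k l} h′ = trans (cong₂ (λ p q → v4 p q g h) (⊕-cancelʳ a (cong c₀ h′)) (⊕-cancelʳ b (cong c₁ h′)))
    (cong₂ (λ p q → v4 i j p q) (⊕-cancelʳ c (cong c₂ h′)) (⊕-cancelʳ d (cong c₃ h′)))

  compose-cancel : ∀ x {y z} → compose x y ≡ compose x z → y ≡ z
  compose-cancel (line s w p r) {line s₁ w₁ p₁ r₁} {line s₂ w₂ p₂ r₂} e
    with refl ← ⊞⁴-cancelˡ s (cong vec e) | refl ← ⊕-cancelˡ w (cong mid e)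
    with refl ← ⊞⁴-cancelʳ _ (⊞⁴-cancelˡ p (cong mom e))
    with refl ← ⊕-cancelʳ _ (⊕-cancelˡ r (cong cub e)) = refl

  record Letter : Set where
    no-eta-equality
    pattern
    constructor letter
    field
      weight pos₁ pos₂ : Carrier
  open Letter

  infixl 5 _▷_
  _▷_ : Line → Letter → Line
  x ▷ letter κ t u = move x κ t u

  ▷-involutive : ∀ x l → x ▷ l ▷ l ≡ x
  ▷-involutive x (letter κ t u) = move-involutive x κ t u

  compose-▷ : ∀ x y l → compose x (y ▷ l) ≡ compose x y ▷ l
  compose-▷ x y (letter κ t u) = compose-step x y _ _

  from-origin₃ : ∀ x a b c → compose x (origin ▷ a ▷ b ▷ c) ≡ x ▷ a ▷ b ▷ c
  from-origin₃ x a b c = trans (compose-▷ x _ c) (cong (_▷ c) (trans (compose-▷ x _ b) (cong (_▷ b) (trans (compose-▷ x _ a) (cong (_▷ a) (compose-origin x))))))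

  norm-difference : Letter → Letter → Carrier
  norm-difference (letter _ t u) (letter _ t′ u′) = norm (t ⊕ t′) (u ⊕ u′ ⊕ σ t ⊗ (t ⊕ t′))

  formᴸ : Letter → Letter → Carrier
  formᴸ (letter κ t u) (letter κ′ t′ u′) = form (dir κ t u) (dir κ′ t′ u′)

  -- No two points of the ovoid are perpendicular. The argument of the norm is the quotient of the
  -- positions under the law (t,u)(t′,u′) = (t + t′, u + u′ + σ(t) t′), so anisotropy applies.
  formᴸ-norm : ∀ l l′ → formᴸ l l′ ≡ weight l ⊗ weight l′ ⊗ norm-difference l l′
  formᴸ-norm (letter κ t u) (letter κ′ t′ u′) = agree (𝕋.form (𝕋.dir (var 0) T U) (𝕋.dir (var 3) T′ U′))
      (var 0 ⊠ var 3 ⊠ 𝕋.norm (T ⊞ T′) (U ⊞ U′ ⊞ σ̂ T ⊠ (T ⊞ T′))) refl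
    where
    ρ = κ ∷ t ∷ u ∷ κ′ ∷ t′ ∷ u′ ∷ []
    T U T′ U′ : Term ρ
    T = var 1
    U = var 2
    T′ = var 4
    U′ = var 5

  letter-var : ∀ {ρ} → ℕ → 𝕋.Line {ρ} → 𝕋.Line {ρ}
  letter-var i x = 𝕋.move x (var i) (var (suc i)) (var (suc (suc i)))

  opp-three : ∀ a b c → opp (origin ▷ a ▷ b ▷ c) ≡ 0#
  opp-three (letter κ t u) (letter κ′ t′ u′) (letter κ″ t″ u″) = agree {ρ} (𝕋.opp (letter-var 6 (letter-var 3 (letter-var 0 𝕋.origin)))) 𝟘 refl
    where
    ρ = κ ∷ t ∷ u ∷ κ′ ∷ t′ ∷ u′ ∷ κ″ ∷ t″ ∷ u″ ∷ []

module OctagonIdentity (R : TitsRing) where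
  open TitsRing R
  open Eval R
  open OctagonGroup R
  open Formulas operations

  -- A computation in twelve variables. Each factor involves two consecutive letters only, so it is
  -- nonzero as soon as these have nonzero weights and distinct positions.
  opp-four : ∀ a b c d → opp (origin ▷ a ▷ b ▷ c ▷ d) ≡ formᴸ a b ⊗ σ (formᴸ b c) ⊗ formᴸ c d
  opp-four (letter κ t u) (letter κ′ t′ u′) (letter κ″ t″ u″) (letter κ‴ t‴ u‴) =
    agree {ρ} (𝕋.opp (letter-var 9 (letter-var 6 (letter-var 3 (letter-var 0 𝕋.origin)))))
      (𝕋.form (v 0) (v 3) ⊠ σ̂ (𝕋.form (v 3) (v 6)) ⊠ 𝕋.form (v 6) (v 9)) refl
    where
    ρ = κ ∷ t ∷ u ∷ κ′ ∷ t′ ∷ u′ ∷ κ″ ∷ t″ ∷ u″ ∷ κ‴ ∷ t‴ ∷ u‴ ∷ []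
    v : ℕ → 𝕋.V4 {ρ}
    v i = 𝕋.dir (var i) (var (suc i)) (var (suc (suc i)))

module OctagonGirth (R : TitsRing) (_≟_ : (x y : TitsRing.Carrier R) → Dec (x ≡ y)) (integral : TitsRing.Integral R) where
  open TitsRing R
  open Eval R
  open OctagonGroup R
  open OctagonIdentity R
  open Formulas operations
  open Letter

  square-zero : ∀ x → x ⊗ x ≡ 0# → x ≡ 0#
  square-zero x e with integral x x e
  ... | inj₁ h = h
  ... | inj₂ h = h

  σ-zero : ∀ x → σ x ≡ 0# → x ≡ 0#
  σ-zero x e = square-zero x (trans (sym (σ-σ x)) (trans (cong σ e) σ-0))

  -- From N(t,u) = 0 one gets u² = t^{σ+1} u, and both u = 0 and u = t^{σ+1} force t^{σ+2} = 0.
  norm-anisotropic : ∀ t u → norm t u ≡ 0# → t ≡ 0# × u ≡ 0#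
  norm-anisotropic t u e = finish (integral u (u ⊕ σ t ⊗ t) product)
    where
    ρ = t ∷ u ∷ []
    T U : Term ρ
    T = var 0
    U = var 1
    product : u ⊗ (u ⊕ σ t ⊗ t) ≡ 0#
    product = trans (agree (U ⊠ (U ⊞ σ̂ T ⊠ T)) (σ̂ (𝕋.norm T U) ⊞ σ̂ T ⊠ 𝕋.norm T U) refl)
      (trans (cong₂ (λ a b → a ⊕ σ t ⊗ b) (trans (cong σ e) σ-0) e) (trans (⊕-identityˡ _) (⊗-zeroʳ (σ t))))
    cube : σ t ⊗ (t ⊗ t) ≡ 0# → t ≡ 0#
    cube h with integral (σ t) (t ⊗ t) h
    ... | inj₁ a = σ-zero t a
    ... | inj₂ b = square-zero t b
    at-0 : u ≡ 0# → t ≡ 0#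
    at-0 refl = cube (trans (agree {t ∷ []} (σ̂ (var 0) ⊠ (var 0 ⊠ var 0)) (𝕋.norm (var 0) 𝟘) refl) e)
    u-of-t : t ≡ 0# → u ≡ 0#
    u-of-t refl = σ-zero u (trans (agree {u ∷ []} (σ̂ (var 0)) (𝕋.norm 𝟘 (var 0)) refl) e)
    finish : u ≡ 0# ⊎ u ⊕ σ t ⊗ t ≡ 0# → t ≡ 0# × u ≡ 0#
    finish (inj₁ h) = at-0 h , h
    finish (inj₂ h) = t0 , u-of-t t0
      where
      h′ : u ≡ σ t ⊗ t
      h′ = ⊕-cancelʳ0 _ _ h
      t0 : t ≡ 0#
      t0 = cube (trans (agree {t ∷ []} (σ̂ (var 0) ⊠ (var 0 ⊠ var 0)) (𝕋.norm (var 0) (σ̂ (var 0) ⊠ var 0)) refl) (trans (cong (norm t) (sym h′)) e))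

  Apart : Letter → Letter → Set
  Apart l l′ = ¬ (pos₁ l ≡ pos₁ l′ × pos₂ l ≡ pos₂ l′)

  formᴸ≢0 : ∀ l l′ → ¬ weight l ≡ 0# → ¬ weight l′ ≡ 0# → Apart l l′ → ¬ formᴸ l l′ ≡ 0#
  formᴸ≢0 l l′ nz nz′ apart e = split (integral (weight l ⊗ weight l′) (norm-difference l l′) (trans (sym (formᴸ-norm l l′)) e))
    where
    separate : ∀ l l′ → norm-difference l l′ ≡ 0# → pos₁ l ≡ pos₁ l′ × pos₂ l ≡ pos₂ l′
    separate (letter _ t u) (letter _ t′ u′) h with norm-anisotropic (t ⊕ t′) (u ⊕ u′ ⊕ σ t ⊗ (t ⊕ t′)) h
    ... | t0 , u0 = ⊕-cancelʳ0 t t′ t0 , ⊕-cancelʳ0 u u′ (trans (sym (⊕-identityʳ _)) (trans (cong (u ⊕ u′ ⊕_) (sym (trans (cong (σ t ⊗_) t0) (⊗-zeroʳ (σ t))))) u0))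
    split : weight l ⊗ weight l′ ≡ 0# ⊎ norm-difference l l′ ≡ 0# → ⊥
    split (inj₂ h) = apart (separate l l′ h)
    split (inj₁ h) with integral (weight l) (weight l′) h
    ... | inj₁ a = nz a
    ... | inj₂ b = nz′ b

  -- The opposition form vanishes on products of three letters but not on products of four.
  no-relation : ∀ x a b c d e f g → x ▷ a ▷ b ▷ c ▷ d ≡ x ▷ e ▷ f ▷ g
    → ¬ weight a ≡ 0# → ¬ weight b ≡ 0# → ¬ weight c ≡ 0# → ¬ weight d ≡ 0# → Apart a b → Apart b c → Apart c d → ⊥
  no-relation x a b c d e f g eqn a≢0 b≢0 c≢0 d≢0 ab bc cd = outer (integral (formᴸ a b ⊗ σ (formᴸ b c)) (formᴸ c d) zero-product)
    where
    same-word : origin ▷ a ▷ b ▷ c ▷ d ≡ origin ▷ e ▷ f ▷ g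
    same-word = compose-cancel x (trans (compose-▷ x _ d) (trans (cong (_▷ d) (from-origin₃ x a b c)) (trans eqn (sym (from-origin₃ x e f g)))))
    zero-product : formᴸ a b ⊗ σ (formᴸ b c) ⊗ formᴸ c d ≡ 0#
    zero-product = trans (sym (opp-four a b c d)) (trans (cong opp same-word) (opp-three e f g))
    inner : formᴸ a b ≡ 0# ⊎ σ (formᴸ b c) ≡ 0# → ⊥
    inner (inj₁ h) = formᴸ≢0 a b a≢0 b≢0 ab h
    inner (inj₂ h) = formᴸ≢0 b c b≢0 c≢0 bc (σ-zero _ h)
    outer : formᴸ a b ⊗ σ (formᴸ b c) ≡ 0# ⊎ formᴸ c d ≡ 0# → ⊥
    outer (inj₁ h) = inner (integral (formᴸ a b) (σ (formᴸ b c)) h)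
    outer (inj₂ h) = formᴸ≢0 c d c≢0 d≢0 cd h

  -- A coset of the subgroup of letters with position (`pt₁`, `pt₂`), given by its only element
  -- whose first coordinate is 0. Its elements are the lines through the point; their first
  -- coordinate is the slope.
  record Point : Set where
    constructor point
    field
      pt₁ pt₂ : Carrier
      s₁ s₂ s₃ : Carrier
      mid′ : Carrier
      mom′ : V4
      cub′ : Carrier
  open Point

  base : Point → Line
  base p = line (v4 0# (s₁ p) (s₂ p) (s₃ p)) (mid′ p) (mom′ p) (cub′ p)

  lineOf : Carrier → Point → Line
  lineOf κ p = base p ▷ letter κ (pt₁ p) (pt₂ p)

  turnAt : Carrier → Carrier → Point → Letter
  turnAt κ κ′ p = letter (κ ⊕ κ′) (pt₁ p) (pt₂ p)

  lineOf-turn : ∀ κ κ′ p → lineOf κ′ p ≡ lineOf κ p ▷ turnAt κ κ′ p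
  lineOf-turn κ κ′ p = sym (trans (move-move (base p) κ (κ ⊕ κ′) _ _) (cong (λ z → move (base p) z (pt₁ p) (pt₂ p))
    (trans (sym (⊕-assoc κ κ κ′)) (trans (cong (_⊕ κ′) (⊕-self κ)) (⊕-identityˡ κ′)))))

  base-injective : ∀ p q → pt₁ p ≡ pt₁ q → pt₂ p ≡ pt₂ q → base p ≡ base q → p ≡ q
  base-injective p q refl refl refl = refl

  apart : ∀ κ p q → lineOf κ p ≡ lineOf κ q → ¬ p ≡ q → ¬ (pt₁ p ≡ pt₁ q × pt₂ p ≡ pt₂ q)
  apart κ p q e ne (e₁ , e₂) = ne (base-injective p q e₁ e₂ (trans (sym (▷-involutive (base p) (letter κ (pt₁ p) (pt₂ p))))
    (trans (cong₂ (λ x l → x ▷ l) e (cong₂ (letter κ) e₁ e₂)) (▷-involutive (base q) (letter κ (pt₁ q) (pt₂ q))))))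

  turn≢0 : ∀ {κ κ′} p → ¬ κ ≡ κ′ → ¬ weight (turnAt κ κ′ p) ≡ 0#
  turn≢0 p ne e = ne (⊕-cancelʳ0 _ _ e)

  idle : Letter
  idle = letter 0# 0# 0#

  ▷-idle : ∀ x → x ▷ idle ≡ x
  ▷-idle x = move-0 x 0# 0#

  module _ (_≟ᴾ_ : (p q : Point) → Dec (p ≡ q)) where
    open Walk _≟ᴾ_ _≟_ lineOf

    next : ∀ κ κ′ p q → lineOf κ p ≡ lineOf κ q → lineOf κ p ▷ turnAt κ κ′ q ≡ lineOf κ′ q
    next κ κ′ p q e = trans (cong (_▷ turnAt κ κ′ q) e) (sym (lineOf-turn κ κ′ q))

    back : ∀ κ κ′ p q → lineOf κ p ≡ lineOf κ q → lineOf κ′ q ▷ turnAt κ κ′ q ≡ lineOf κ p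
    back κ κ′ p q e = trans (cong (_▷ turnAt κ κ′ q) (sym (next κ κ′ p q e))) (▷-involutive (lineOf κ p) (turnAt κ κ′ q))

    -- A closed walk of k steps multiplies a line by k letters and returns to it. For k from 4 to 7
    -- the first four letters are compared with the inverse of the other at most three, filled up by
    -- `idle`. For k = 2 and k = 3 there are too few letters, so the walk is continued round the
    -- circuit until four have been used.
    girth : Girth 7
    girth {p} κ₁ e₁ (step {p₁} κ₂ p₂ e₂ []) _ _ (n₁ , k₁₂ , n₂ , _) k₂₁ =
      no-relation (lineOf κ₁ p) a b a b idle idle idle
        (trans (cong (λ x → x ▷ a ▷ b) loop) (trans loop (sym (trans (cong (λ x → x ▷ idle ▷ idle) (▷-idle _)) (trans (cong (_▷ idle) (▷-idle _)) (▷-idle _))))))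
        (turn≢0 p₁ k₁₂) (turn≢0 p (λ h → k₂₁ (sym h))) (turn≢0 p₁ k₁₂) (turn≢0 p (λ h → k₂₁ (sym h)))
        (apart κ₂ p₁ p e₂ n₂) (apart κ₁ p p₁ e₁ n₁) (apart κ₂ p₁ p e₂ n₂)
      where
      a = turnAt κ₁ κ₂ p₁
      b = turnAt κ₂ κ₁ p
      loop : lineOf κ₁ p ▷ a ▷ b ≡ lineOf κ₁ p
      loop = trans (cong (_▷ b) (next κ₁ κ₂ p p₁ e₁)) (next κ₂ κ₁ p₁ p e₂)
    girth {p} κ₁ e₁ (step {p₁} κ₂ p₂ e₂ (step κ₃ _ e₃ [])) _ _ (n₁ , k₁₂ , n₂ , k₂₃ , n₃ , _) k₃₁ =
      no-relation (lineOf κ₁ p) a b c a c b idle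
        (trans (cong (_▷ a) (trans (cong (λ x → x ▷ b ▷ c) (next κ₁ κ₂ p p₁ e₁)) (trans (cong (_▷ c) (next κ₂ κ₃ p₁ p₂ e₂)) (next κ₃ κ₁ p₂ p e₃))))
          (trans (next κ₁ κ₂ p p₁ e₁) (sym (trans (▷-idle _) (trans (cong (_▷ b) (back κ₃ κ₁ p₂ p e₃)) (back κ₂ κ₃ p₁ p₂ e₂))))))
        (turn≢0 p₁ k₁₂) (turn≢0 p₂ k₂₃) (turn≢0 p (λ h → k₃₁ (sym h))) (turn≢0 p₁ k₁₂)
        (apart κ₂ p₁ p₂ e₂ n₂) (apart κ₃ p₂ p e₃ n₃) (apart κ₁ p p₁ e₁ n₁)
      where
      a = turnAt κ₁ κ₂ p₁
      b = turnAt κ₂ κ₃ p₂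
      c = turnAt κ₃ κ₁ p
    girth {p} κ₁ e₁ (step {p₁} κ₂ p₂ e₂ (step κ₃ p₃ e₃ (step κ₄ _ e₄ []))) _ _ (n₁ , k₁₂ , n₂ , k₂₃ , n₃ , k₃₄ , n₄ , _) k₄₁ =
      no-relation (lineOf κ₁ p) (turnAt κ₁ κ₂ p₁) (turnAt κ₂ κ₃ p₂) (turnAt κ₃ κ₄ p₃) (turnAt κ₄ κ₁ p) idle idle idle
        (trans (cong (_▷ turnAt κ₄ κ₁ p) (trans (cong (λ x → x ▷ turnAt κ₂ κ₃ p₂ ▷ turnAt κ₃ κ₄ p₃) (next κ₁ κ₂ p p₁ e₁)) (trans (cong (_▷ turnAt κ₃ κ₄ p₃) (next κ₂ κ₃ p₁ p₂ e₂)) (next κ₃ κ₄ p₂ p₃ e₃))))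
          (trans (next κ₄ κ₁ p₃ p e₄) (sym (trans (cong (λ x → x ▷ idle ▷ idle) (▷-idle _)) (trans (cong (_▷ idle) (▷-idle _)) (▷-idle _))))))
        (turn≢0 p₁ k₁₂) (turn≢0 p₂ k₂₃) (turn≢0 p₃ k₃₄) (turn≢0 p (λ h → k₄₁ (sym h)))
        (apart κ₂ p₁ p₂ e₂ n₂) (apart κ₃ p₂ p₃ e₃ n₃) (apart κ₄ p₃ p e₄ n₄)
    girth {p} κ₁ e₁ (step {p₁} κ₂ p₂ e₂ (step κ₃ p₃ e₃ (step κ₄ p₄ e₄ (step κ₅ q e₅ ω)))) _ len (n₁ , k₁₂ , n₂ , k₂₃ , n₃ , k₃₄ , n₄ , k₄₅ , _) ends = tail ω e₅ len
      where
      four : lineOf κ₁ p ▷ turnAt κ₁ κ₂ p₁ ▷ turnAt κ₂ κ₃ p₂ ▷ turnAt κ₃ κ₄ p₃ ▷ turnAt κ₄ κ₅ p₄ ≡ lineOf κ₅ p₄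
      four = trans (cong (λ x → x ▷ turnAt κ₂ κ₃ p₂ ▷ turnAt κ₃ κ₄ p₃ ▷ turnAt κ₄ κ₅ p₄) (next κ₁ κ₂ p p₁ e₁)) (trans (cong (λ x → x ▷ turnAt κ₃ κ₄ p₃ ▷ turnAt κ₄ κ₅ p₄) (next κ₂ κ₃ p₁ p₂ e₂))
        (trans (cong (_▷ turnAt κ₄ κ₅ p₄) (next κ₃ κ₄ p₂ p₃ e₃)) (next κ₄ κ₅ p₃ p₄ e₄)))
      close : ∀ e f g → lineOf κ₁ p ▷ e ▷ f ▷ g ≡ lineOf κ₅ p₄ → ⊥
      close e f g h = no-relation (lineOf κ₁ p) _ _ _ _ e f g (trans four (sym h)) (turn≢0 p₁ k₁₂) (turn≢0 p₂ k₂₃) (turn≢0 p₃ k₃₄) (turn≢0 p₄ k₄₅)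
        (apart κ₂ p₁ p₂ e₂ n₂) (apart κ₃ p₂ p₃ e₃ n₃) (apart κ₄ p₃ p₄ e₄ n₄)
      tail : ∀ {q} (ω : Walk q p) → lineOf κ₅ p₄ ≡ lineOf κ₅ q → 5 + length ω ≤ 7 → ⊥
      tail [] e₅ _ = close (turnAt κ₅ κ₁ p) idle idle (trans (▷-idle _) (trans (▷-idle _) (back κ₅ κ₁ p₄ p e₅)))
      tail {p₅} (step κ₆ _ e₆ []) e₅ _ = close (turnAt κ₆ κ₁ p) (turnAt κ₅ κ₆ p₅) idle
        (trans (▷-idle _) (trans (cong (_▷ turnAt κ₅ κ₆ p₅) (back κ₆ κ₁ p₅ p e₆)) (back κ₅ κ₆ p₄ p₅ e₅)))
      tail {p₅} (step κ₆ p₆ e₆ (step κ₇ _ e₇ [])) e₅ _ = close (turnAt κ₇ κ₁ p) (turnAt κ₆ κ₇ p₆) (turnAt κ₅ κ₆ p₅)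
        (trans (cong (λ x → x ▷ turnAt κ₆ κ₇ p₆ ▷ turnAt κ₅ κ₆ p₅) (back κ₇ κ₁ p₆ p e₇)) (trans (cong (_▷ turnAt κ₅ κ₆ p₅) (back κ₆ κ₇ p₅ p₆ e₆)) (back κ₅ κ₆ p₄ p₅ e₅)))
      tail (step _ _ _ (step _ _ _ (step _ _ _ _))) _ (s≤s (s≤s (s≤s (s≤s (s≤s (s≤s (s≤s ())))))))

-- The hexagon

module HexFormulas {A : Set} (operations : Operations A) where
  open Operations operations

  -- Coordinates in a Heisenberg group with centre `height`. A letter is κ (1, b, b♯, N(b)) for the
  -- split cubic algebra of triples b = (b, b′, b″) with b♯ = (b′b″, b″b, bb′) and N(b) = bb′b″. The
  -- three entries are independent variables in all identities; only afterwards they become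
  -- conjugates under θ.
  record Hex : Set where
    constructor hex
    field
      one : A
      lin lin′ lin″ : A
      sharp sharp′ sharp″ : A
      cube : A
      height : A
  open Hex public

  infixl 6 _∙_

  pairing : Hex → Hex → A
  pairing x y = cube x ⊠ one y ⊞ (lin x ⊠ sharp y ⊞ lin′ x ⊠ sharp′ y ⊞ lin″ x ⊠ sharp″ y)

  _∙_ : Hex → Hex → Hex
  x ∙ y = hex (one x ⊞ one y) (lin x ⊞ lin y) (lin′ x ⊞ lin′ y) (lin″ x ⊞ lin″ y)
    (sharp x ⊞ sharp y) (sharp′ x ⊞ sharp′ y) (sharp″ x ⊞ sharp″ y) (cube x ⊞ cube y) (height x ⊞ height y ⊞ pairing x y)

  letterʰ : A → A → A → A → Hex
  letterʰ κ b b′ b″ = hex κ (κ ⊠ b) (κ ⊠ b′) (κ ⊠ b″) (κ ⊠ (b′ ⊠ b″)) (κ ⊠ (b″ ⊠ b)) (κ ⊠ (b ⊠ b′)) (κ ⊠ (b ⊠ (b′ ⊠ b″))) 𝟘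

  originʰ : Hex
  originʰ = hex 𝟘 𝟘 𝟘 𝟘 𝟘 𝟘 𝟘 𝟘 𝟘

  -- Equals Σ_{i<j} κᵢ κⱼ (bᵢ + c)(bᵢ + bⱼ)♯(bⱼ + d) on a product of letters (κᵢ , bᵢ)
  oppʰ : A → A → Hex → A
  oppʰ c d (hex s a a′ a″ e e′ e″ n τ) =
    n ⊠ a ⊞ e′ ⊠ e″ ⊞ d ⊠ (τ ⊞ a′ ⊠ e′ ⊞ a″ ⊠ e″) ⊞ c ⊠ (τ ⊞ s ⊠ n ⊞ a ⊠ e) ⊞ c ⊠ d ⊠ (s ⊠ e ⊞ a′ ⊠ a″)

module HexagonGroup (R : TitsRing) where
  open TitsRing R
  open Eval R
  open HexFormulas operations public
  module _ {ρ : List Carrier} where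
    open Ops {ρ} public
    module ℍ = HexFormulas term-operations

    valʰ : ℍ.Hex → Hex
    valʰ (ℍ.hex a b c d e f g h i) = hex (a .val) (b .val) (c .val) (d .val) (e .val) (f .val) (g .val) (h .val) (i .val)

    record _≈ʰ_ (x y : ℍ.Hex) : Set where
      constructor same
      field
        e₁ : (ℍ.one x ⊞ ℍ.one y) .poly ≡ []
        e₂ : (ℍ.lin x ⊞ ℍ.lin y) .poly ≡ []
        e₃ : (ℍ.lin′ x ⊞ ℍ.lin′ y) .poly ≡ []
        e₄ : (ℍ.lin″ x ⊞ ℍ.lin″ y) .poly ≡ []
        e₅ : (ℍ.sharp x ⊞ ℍ.sharp y) .poly ≡ []
        e₆ : (ℍ.sharp′ x ⊞ ℍ.sharp′ y) .poly ≡ []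
        e₇ : (ℍ.sharp″ x ⊞ ℍ.sharp″ y) .poly ≡ []
        e₈ : (ℍ.cube x ⊞ ℍ.cube y) .poly ≡ []
        e₉ : (ℍ.height x ⊞ ℍ.height y) .poly ≡ []

    agreeʰ : ∀ x y → x ≈ʰ y → valʰ x ≡ valʰ y
    agreeʰ x y (same a b c d e f g h i) = trans
      (cong₂ (λ p q → hex (proj₁ p) (proj₂ p) (proj₁ q) (proj₂ q) (ℍ.sharp x .val) (ℍ.sharp′ x .val) (ℍ.sharp″ x .val) (ℍ.cube x .val) (ℍ.height x .val))
        (cong₂ _,_ (agree (ℍ.one x) (ℍ.one y) a) (agree (ℍ.lin x) (ℍ.lin y) b)) (cong₂ _,_ (agree (ℍ.lin′ x) (ℍ.lin′ y) c) (agree (ℍ.lin″ x) (ℍ.lin″ y) d)))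
      (trans (cong₂ (λ p q → hex (ℍ.one y .val) (ℍ.lin y .val) (ℍ.lin′ y .val) (ℍ.lin″ y .val) (proj₁ p) (proj₂ p) (proj₁ q) (proj₂ q) (ℍ.height x .val))
        (cong₂ _,_ (agree (ℍ.sharp x) (ℍ.sharp y) e) (agree (ℍ.sharp′ x) (ℍ.sharp′ y) f)) (cong₂ _,_ (agree (ℍ.sharp″ x) (ℍ.sharp″ y) g) (agree (ℍ.cube x) (ℍ.cube y) h)))
        (cong (hex _ _ _ _ _ _ _ _) (agree (ℍ.height x) (ℍ.height y) i)))

    hex-vars : ℕ → ℍ.Hex
    hex-vars i = ℍ.hex (var i) (var (1 + i)) (var (2 + i)) (var (3 + i)) (var (4 + i)) (var (5 + i)) (var (6 + i)) (var (7 + i)) (var (8 + i))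

    letter-vars : ℕ → ℍ.Hex
    letter-vars i = ℍ.letterʰ (var i) (var (1 + i)) (var (2 + i)) (var (3 + i))

  ∙-assoc : ∀ x y z → (x ∙ y) ∙ z ≡ x ∙ (y ∙ z)
  ∙-assoc (hex a b c d e f g h i) (hex a₁ b₁ c₁ d₁ e₁ f₁ g₁ h₁ i₁) (hex a₂ b₂ c₂ d₂ e₂ f₂ g₂ h₂ i₂) =
      agreeʰ {ρ} (ℍ._∙_ (ℍ._∙_ x y) z) (ℍ._∙_ x (ℍ._∙_ y z)) (same refl refl refl refl refl refl refl refl refl)
    where
    ρ = a ∷ b ∷ c ∷ d ∷ e ∷ f ∷ g ∷ h ∷ i ∷ a₁ ∷ b₁ ∷ c₁ ∷ d₁ ∷ e₁ ∷ f₁ ∷ g₁ ∷ h₁ ∷ i₁ ∷ a₂ ∷ b₂ ∷ c₂ ∷ d₂ ∷ e₂ ∷ f₂ ∷ g₂ ∷ h₂ ∷ i₂ ∷ []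
    x y z : ℍ.Hex {ρ}
    x = hex-vars 0
    y = hex-vars 9
    z = hex-vars 18

  ∙-identityʳ : ∀ x → x ∙ originʰ ≡ x
  ∙-identityʳ (hex a b c d e f g h i) = agreeʰ {ρ} (ℍ._∙_ x ℍ.originʰ) x (same refl refl refl refl refl refl refl refl refl)
    where
    ρ = a ∷ b ∷ c ∷ d ∷ e ∷ f ∷ g ∷ h ∷ i ∷ []
    x : ℍ.Hex {ρ}
    x = hex-vars 0

  letter-merge : ∀ κ κ′ b b′ b″ → letterʰ κ b b′ b″ ∙ letterʰ κ′ b b′ b″ ≡ letterʰ (κ ⊕ κ′) b b′ b″
  letter-merge κ κ′ b b′ b″ = agreeʰ {ρ} (ℍ._∙_ (ℍ.letterʰ (var 0) (var 2) (var 3) (var 4)) (ℍ.letterʰ (var 1) (var 2) (var 3) (var 4)))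
      (ℍ.letterʰ (var 0 ⊞ var 1) (var 2) (var 3) (var 4)) (same refl refl refl refl refl refl refl refl refl)
    where
    ρ = κ ∷ κ′ ∷ b ∷ b′ ∷ b″ ∷ []

  letter-0 : ∀ b b′ b″ → letterʰ 0# b b′ b″ ≡ originʰ
  letter-0 b b′ b″ = agreeʰ {ρ} (ℍ.letterʰ 𝟘 (var 0) (var 1) (var 2)) ℍ.originʰ (same refl refl refl refl refl refl refl refl refl)
    where
    ρ = b ∷ b′ ∷ b″ ∷ []

  ∙-cancelˡ : ∀ x {y z} → x ∙ y ≡ x ∙ z → y ≡ z
  ∙-cancelˡ x {hex _ _ _ _ _ _ _ _ _} {hex _ _ _ _ _ _ _ _ _} e
    with refl ← ⊕-cancelˡ (one x) (cong one e) | refl ← ⊕-cancelˡ (lin x) (cong lin e) | refl ← ⊕-cancelˡ (lin′ x) (cong lin′ e) | refl ← ⊕-cancelˡ (lin″ x) (cong lin″ e)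
       | refl ← ⊕-cancelˡ (sharp x) (cong sharp e) | refl ← ⊕-cancelˡ (sharp′ x) (cong sharp′ e) | refl ← ⊕-cancelˡ (sharp″ x) (cong sharp″ e) | refl ← ⊕-cancelˡ (cube x) (cong cube e)
    with refl ← ⊕-cancelˡ (height x) (⊕-cancelʳ _ (cong height e)) = refl

  -- In the sum over pairs of letters, those containing the first letter vanish because c is its
  -- position, and the remaining pair vanishes because d is the position of the last letter.
  opp-three : ∀ κ a a′ a″ λ′ b b′ b″ μ c c′ c″ → oppʰ a c (letterʰ κ a a′ a″ ∙ letterʰ λ′ b b′ b″ ∙ letterʰ μ c c′ c″) ≡ 0#
  opp-three κ a a′ a″ λ′ b b′ b″ μ c c′ c″ = agree {ρ} (ℍ.oppʰ (var 1) (var 9) (ℍ._∙_ (ℍ._∙_ (letter-vars 0) (letter-vars 4)) (letter-vars 8))) 𝟘 refl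
    where
    ρ = κ ∷ a ∷ a′ ∷ a″ ∷ λ′ ∷ b ∷ b′ ∷ b″ ∷ μ ∷ c ∷ c′ ∷ c″ ∷ []

  opp-two : ∀ c d κ a a′ a″ λ′ b b′ b″ → oppʰ c d (letterʰ κ a a′ a″ ∙ letterʰ λ′ b b′ b″)
    ≡ κ ⊗ λ′ ⊗ ((a ⊕ c) ⊗ ((a′ ⊕ b′) ⊗ (a″ ⊕ b″) ⊗ (b ⊕ d)))
  opp-two c d κ a a′ a″ λ′ b b′ b″ = agree {ρ} (ℍ.oppʰ (var 0) (var 1) (ℍ._∙_ (letter-vars 2) (letter-vars 6)))
      (var 2 ⊠ var 6 ⊠ ((var 3 ⊞ var 0) ⊠ ((var 4 ⊞ var 8) ⊠ (var 5 ⊞ var 9) ⊠ (var 7 ⊞ var 1)))) refl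
    where
    ρ = c ∷ d ∷ κ ∷ a ∷ a′ ∷ a″ ∷ λ′ ∷ b ∷ b′ ∷ b″ ∷ []

module HexagonGirth (R : TitsRing) (integral : TitsRing.Integral R)
  (θ : TitsRing.Carrier R → TitsRing.Carrier R) (θ-⊕ : ∀ x y → θ (TitsRing._⊕_ R x y) ≡ TitsRing._⊕_ R (θ x) (θ y)) (θ³ : ∀ x → θ (θ (θ x)) ≡ x) where
  open TitsRing R
  open HexagonGroup R

  θ-injective : ∀ {x y} → θ x ≡ θ y → x ≡ y
  θ-injective {x} {y} e = trans (sym (θ³ x)) (trans (cong (λ z → θ (θ z)) e) (θ³ y))

  record Letter : Set where
    constructor letter
    field
      weight pos : Carrier
  open Letter

  ⟦_⟧ : Letter → Hex
  ⟦ letter κ b ⟧ = letterʰ κ b (θ b) (θ (θ b))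

  infixl 6 _▷_
  _▷_ : Hex → Letter → Hex
  x ▷ l = x ∙ ⟦ l ⟧

  ▷-▷ : ∀ x κ κ′ b → x ▷ letter κ b ▷ letter κ′ b ≡ x ▷ letter (κ ⊕ κ′) b
  ▷-▷ x κ κ′ b = trans (∙-assoc x _ _) (cong (x ∙_) (letter-merge κ κ′ b _ _))

  ▷-idle : ∀ x b → x ▷ letter 0# b ≡ x
  ▷-idle x b = trans (cong (x ∙_) (letter-0 b _ _)) (∙-identityʳ x)

  ▷-involutive : ∀ x l → x ▷ l ▷ l ≡ x
  ▷-involutive x (letter κ b) = trans (▷-▷ x κ κ b) (trans (cong (λ z → x ▷ letter z b) (⊕-self κ)) (▷-idle x b))

  -- The parameters of `oppʰ` are the positions of e and g, so it vanishes on the right word. On the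
  -- left word it is a product of weights and differences of positions; the two middle factors are
  -- conjugates under θ, nonzero because θ is injective.
  no-relation : ∀ x a b e f g → x ▷ a ▷ b ≡ x ▷ e ▷ f ▷ g → ¬ weight a ≡ 0# → ¬ weight b ≡ 0#
    → ¬ pos a ≡ pos e → ¬ pos a ≡ pos b → ¬ pos b ≡ pos g → ⊥
  no-relation x a b e f g eqn a≢0 b≢0 ae ab bg = split (integral _ _ (trans (sym (opp-two (pos e) (pos g) (weight a) (pos a) _ _ (weight b) (pos b) _ _))
      (trans (cong (oppʰ (pos e) (pos g)) same-word) (opp-three (weight e) (pos e) _ _ (weight f) (pos f) _ _ (weight g) (pos g) _ _))))
    where
    same-word : ⟦ a ⟧ ∙ ⟦ b ⟧ ≡ ⟦ e ⟧ ∙ ⟦ f ⟧ ∙ ⟦ g ⟧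
    same-word = ∙-cancelˡ x (trans (sym (∙-assoc x _ _)) (trans eqn (trans (cong (_▷ g) (∙-assoc x _ _)) (∙-assoc x _ _))))
    distinct : ∀ {x y} → ¬ x ≡ y → ¬ x ⊕ y ≡ 0#
    distinct ne e = ne (⊕-cancelʳ0 _ _ e)
    split : weight a ⊗ weight b ≡ 0# ⊎ (pos a ⊕ pos e) ⊗ ((θ (pos a) ⊕ θ (pos b)) ⊗ (θ (θ (pos a)) ⊕ θ (θ (pos b))) ⊗ (pos b ⊕ pos g)) ≡ 0# → ⊥
    split (inj₁ h) with integral _ _ h
    ... | inj₁ z = a≢0 z
    ... | inj₂ z = b≢0 z
    split (inj₂ h) with integral _ _ h
    ... | inj₁ z = distinct ae z
    ... | inj₂ h′ with integral _ _ h′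
    ...   | inj₂ z = distinct bg z
    ...   | inj₁ h″ with integral _ _ h″
    ...     | inj₁ z = distinct (λ e → ab (θ-injective e)) z
    ...     | inj₂ z = distinct (λ e → ab (θ-injective (θ-injective e))) z

  record Fixed : Set where
    constructor fix
    field
      elt : Carrier
      fixed : θ elt ≡ elt
  open Fixed public

  fixed-≡ : ∀ {x y} → elt x ≡ elt y → x ≡ y
  fixed-≡ {fix x refl-x} {fix y refl-y} refl = cong (fix x) (uip refl-x refl-y)

  -- Again a coset representative with first coordinate 0, now in the subgroup fixed by triality: a
  -- triple of conjugates is given by its first entry, while `cube` and `height` lie in the fixed
  -- field.
  record Point : Set where
    constructor point
    field
      at : Carrier
      lin₀ sharp₀ : Carrier
      cube₀ height₀ : Fixed
  open Point

  base : Point → Hex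
  base p = hex 0# (lin₀ p) (θ (lin₀ p)) (θ (θ (lin₀ p))) (sharp₀ p) (θ (sharp₀ p)) (θ (θ (sharp₀ p))) (elt (cube₀ p)) (elt (height₀ p))

  lineOf : Fixed → Point → Hex
  lineOf κ p = base p ▷ letter (elt κ) (at p)

  turnAt : Fixed → Fixed → Point → Letter
  turnAt κ κ′ p = letter (elt κ ⊕ elt κ′) (at p)

  lineOf-turn : ∀ κ κ′ p → lineOf κ′ p ≡ lineOf κ p ▷ turnAt κ κ′ p
  lineOf-turn κ κ′ p = sym (trans (▷-▷ (base p) (elt κ) (elt κ ⊕ elt κ′) (at p)) (cong (λ z → base p ▷ letter z (at p))
    (trans (sym (⊕-assoc (elt κ) (elt κ) (elt κ′))) (trans (cong (_⊕ elt κ′) (⊕-self (elt κ))) (⊕-identityˡ (elt κ′))))))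

  base-injective : ∀ p q → at p ≡ at q → base p ≡ base q → p ≡ q
  base-injective (point b x y z w) (point _ x′ y′ z′ w′) refl e
    with refl ← cong lin e | refl ← cong sharp e | refl ← fixed-≡ {z} {z′} (cong cube e) | refl ← fixed-≡ {w} {w′} (cong height e) = refl

  apart : ∀ κ p q → lineOf κ p ≡ lineOf κ q → ¬ p ≡ q → ¬ at p ≡ at q
  apart κ p q e ne same-at = ne (base-injective p q same-at (trans (sym (▷-involutive (base p) (letter (elt κ) (at p))))
    (trans (cong₂ (λ x b → x ▷ letter (elt κ) b) e same-at) (▷-involutive (base q) (letter (elt κ) (at q))))))

  turn≢0 : ∀ {κ κ′} p → ¬ κ ≡ κ′ → ¬ weight (turnAt κ κ′ p) ≡ 0#
  turn≢0 p ne e = ne (fixed-≡ (⊕-cancelʳ0 _ _ e))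

  module _ (_≟ᴾ_ : (p q : Point) → Dec (p ≡ q)) (_≟_ : (x y : Fixed) → Dec (x ≡ y)) where
    open Walk _≟ᴾ_ _≟_ lineOf

    next : ∀ κ κ′ p q → lineOf κ p ≡ lineOf κ q → lineOf κ p ▷ turnAt κ κ′ q ≡ lineOf κ′ q
    next κ κ′ p q e = trans (cong (_▷ turnAt κ κ′ q) e) (sym (lineOf-turn κ κ′ q))

    back : ∀ κ κ′ p q → lineOf κ p ≡ lineOf κ q → lineOf κ′ q ▷ turnAt κ κ′ q ≡ lineOf κ p
    back κ κ′ p q e = trans (cong (_▷ turnAt κ κ′ q) (sym (next κ κ′ p q e))) (▷-involutive (lineOf κ p) (turnAt κ κ′ q))

    idle : Point → Letter
    idle p = letter 0# (at p)

    -- The first two letters are compared with the inverse of the other at most three. An idle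
    -- letter still has a position, and this enters `oppʰ`; taking it at the base point keeps the
    -- required positions distinct. For length two the loop ab = 1 is compared with ba = 1.
    girth : Girth 5
    girth {p} κ₁ e₁ (step {p₁} κ₂ _ e₂ []) _ _ (n₁ , k₁₂ , n₂ , _) k₂₁ =
      no-relation (lineOf κ₁ p) a b b (idle p) a (trans loop (sym (trans (cong (_▷ a) (▷-idle _ _)) (trans (cong (λ x → x ▷ b ▷ a) (sym loop)) (trans (cong (_▷ a) (▷-involutive _ b)) (▷-involutive _ a))))))
        (turn≢0 p₁ k₁₂) (turn≢0 p (λ h → k₂₁ (sym h))) (λ e → apart κ₁ p p₁ e₁ n₁ (sym e)) (apart κ₂ p₁ p e₂ n₂) (apart κ₁ p p₁ e₁ n₁)
      where
      a = turnAt κ₁ κ₂ p₁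
      b = turnAt κ₂ κ₁ p
      loop : lineOf κ₁ p ▷ a ▷ b ≡ lineOf κ₁ p
      loop = trans (cong (_▷ b) (next κ₁ κ₂ p p₁ e₁)) (next κ₂ κ₁ p₁ p e₂)
    girth {p} κ₁ e₁ (step {p₁} κ₂ p₂ e₂ (step κ₃ q e₃ ω)) _ len (n₁ , k₁₂ , n₂ , k₂₃ , n₃ , _) _ = tail ω e₃ n₃ len
      where
      two : lineOf κ₁ p ▷ turnAt κ₁ κ₂ p₁ ▷ turnAt κ₂ κ₃ p₂ ≡ lineOf κ₃ p₂
      two = trans (cong (_▷ turnAt κ₂ κ₃ p₂) (next κ₁ κ₂ p p₁ e₁)) (next κ₂ κ₃ p₁ p₂ e₂)
      close : ∀ e f g → pos e ≡ at p → ¬ at p₂ ≡ pos g → lineOf κ₁ p ▷ e ▷ f ▷ g ≡ lineOf κ₃ p₂ → ⊥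
      close e f g refl ne h = no-relation (lineOf κ₁ p) _ _ e f g (trans two (sym h)) (turn≢0 p₁ k₁₂) (turn≢0 p₂ k₂₃)
        (λ z → apart κ₁ p p₁ e₁ n₁ (sym z)) (apart κ₂ p₁ p₂ e₂ n₂) ne
      tail : ∀ {q} (ω : Walk q p) → lineOf κ₃ p₂ ≡ lineOf κ₃ q → ¬ p₂ ≡ q → 3 + length ω ≤ 5 → ⊥
      tail [] e₃ n₃ _ = close (turnAt κ₃ κ₁ p) (idle p) (idle p) refl (apart κ₃ p₂ p e₃ n₃)
        (trans (▷-idle _ _) (trans (▷-idle _ _) (back κ₃ κ₁ p₂ p e₃)))
      tail {p₃} (step κ₄ _ e₄ []) e₃ n₃ _ = close (turnAt κ₄ κ₁ p) (idle p) (turnAt κ₃ κ₄ p₃) refl (apart κ₃ p₂ p₃ e₃ n₃)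
        (trans (cong (_▷ turnAt κ₃ κ₄ p₃) (trans (▷-idle _ _) (back κ₄ κ₁ p₃ p e₄))) (back κ₃ κ₄ p₂ p₃ e₃))
      tail {p₃} (step κ₄ p₄ e₄ (step κ₅ _ e₅ [])) e₃ n₃ _ = close (turnAt κ₅ κ₁ p) (turnAt κ₄ κ₅ p₄) (turnAt κ₃ κ₄ p₃) refl (apart κ₃ p₂ p₃ e₃ n₃)
        (trans (cong (λ x → x ▷ turnAt κ₄ κ₅ p₄ ▷ turnAt κ₃ κ₄ p₃) (back κ₅ κ₁ p₄ p e₅)) (trans (cong (_▷ turnAt κ₃ κ₄ p₃) (back κ₄ κ₅ p₃ p₄ e₄)) (back κ₃ κ₄ p₂ p₃ e₃)))
      tail (step _ _ _ (step _ _ _ (step _ _ _ _))) _ _ (s≤s (s≤s (s≤s (s≤s (s≤s ())))))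

-- Finite fields of characteristic 2

module Roots (R : CharTwo) (1≢0 : ¬ CharTwo.1# R ≡ CharTwo.0# R) (integral : CharTwo.Integral R) where
  open CharTwo R

  infixr 5 _∷_
  data Monic : ℕ → Set where
    one : Monic 0
    _∷_ : ∀ {n} → Carrier → Monic n → Monic (suc n)

  eval : ∀ {n} → Monic n → Carrier → Carrier
  eval one x = 1#
  eval (a ∷ p) x = a ⊕ x ⊗ eval p x

  quotient : ∀ {n} → Monic (suc n) → Carrier → Monic n
  quotient (a ∷ one) r = one
  quotient (a ∷ p@(_ ∷ _)) r = eval p r ∷ quotient p r

  quotient-eval : ∀ {n} (p : Monic (suc n)) x r → eval p x ⊕ eval p r ≡ (x ⊕ r) ⊗ eval (quotient p r) x
  quotient-eval (a ∷ one) x r = trans (⊕-swap a _ a _) (trans (cong₂ _⊕_ (⊕-self a) (cong₂ _⊕_ (⊗-identityʳ x) (⊗-identityʳ r)))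
    (trans (⊕-identityˡ _) (sym (⊗-identityʳ _))))
  quotient-eval (a ∷ p@(_ ∷ _)) x r = begin
    (a ⊕ x ⊗ eval p x) ⊕ (a ⊕ r ⊗ eval p r) ≡⟨ trans (⊕-swap a _ a _) (trans (cong (_⊕ (x ⊗ eval p x ⊕ r ⊗ eval p r)) (⊕-self a)) (⊕-identityˡ _)) ⟩
    x ⊗ eval p x ⊕ r ⊗ eval p r ≡⟨ cong (λ z → x ⊗ z ⊕ r ⊗ eval p r) px ⟩
    x ⊗ (eval p r ⊕ (x ⊕ r) ⊗ Q) ⊕ r ⊗ eval p r ≡⟨ cong (_⊕ r ⊗ eval p r) (trans (⊗-distribˡ x _ _) (⊕-comm _ _)) ⟩
    x ⊗ ((x ⊕ r) ⊗ Q) ⊕ x ⊗ eval p r ⊕ r ⊗ eval p r ≡⟨ trans (⊕-assoc _ _ _) (⊕-comm _ _) ⟩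
    x ⊗ eval p r ⊕ r ⊗ eval p r ⊕ x ⊗ ((x ⊕ r) ⊗ Q) ≡⟨ cong₂ _⊕_ (sym (⊗-distribʳ (eval p r) x r)) (trans (sym (⊗-assoc x _ Q)) (trans (cong (_⊗ Q) (⊗-comm x _)) (⊗-assoc _ x Q))) ⟩
    (x ⊕ r) ⊗ eval p r ⊕ (x ⊕ r) ⊗ (x ⊗ Q) ≡⟨ sym (⊗-distribˡ (x ⊕ r) _ _) ⟩
    (x ⊕ r) ⊗ (eval p r ⊕ x ⊗ Q) ∎
    where
    open ≡-Reasoning
    Q = eval (quotient p r) x
    px : eval p x ≡ eval p r ⊕ (x ⊕ r) ⊗ Q
    px = trans (sym (⊕-identityʳ _)) (trans (cong (eval p x ⊕_) (sym (⊕-self (eval p r)))) (trans (sym (⊕-assoc _ _ _)) (trans (cong (_⊕ eval p r) (quotient-eval p x r)) (⊕-comm _ _))))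

  too-many-roots : ∀ {n} (p : Monic n) (r : Fin (suc n) → Carrier) → (∀ {i j} → r i ≡ r j → i ≡ j) → (∀ i → eval p (r i) ≡ 0#) → ⊥
  too-many-roots one r inj root = 1≢0 (root zero)
  too-many-roots {suc n} p r inj root = too-many-roots (quotient p (r zero)) (λ i → r (suc i)) (λ e → suc-injective′ (inj e)) λ i →
      other i (integral (r (suc i) ⊕ r zero) _ (trans (sym (quotient-eval p (r (suc i)) (r zero))) (trans (cong₂ _⊕_ (root (suc i)) (root zero)) (⊕-self 0#))))
    where
    suc-injective′ : ∀ {k} {i j : Fin k} → suc i ≡ suc j → i ≡ j
    suc-injective′ refl = refl
    other : ∀ i → r (suc i) ⊕ r zero ≡ 0# ⊎ eval (quotient p (r zero)) (r (suc i)) ≡ 0# → eval (quotient p (r zero)) (r (suc i)) ≡ 0#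
    other i (inj₂ h) = h
    other i (inj₁ h) with () ← inj (⊕-cancelʳ0 _ _ h)

  power : ∀ n → Monic n
  power zero = one
  power (suc n) = 0# ∷ power n

  eval-power : ∀ n x → eval (power n) x ≡ pow x n
  eval-power zero x = refl
  eval-power (suc n) x = trans (⊕-identityˡ _) (cong (x ⊗_) (eval-power n x))

  plus : ∀ {n} → Monic n → (i : ℕ) → i < n → Carrier → Monic n
  plus (a ∷ p) zero _ c = (a ⊕ c) ∷ p
  plus (a ∷ p) (suc i) (s≤s h) c = a ∷ plus p i h c

  eval-plus : ∀ {n} (p : Monic n) i h c x → eval (plus p i h c) x ≡ eval p x ⊕ c ⊗ pow x i
  eval-plus (a ∷ p) zero h c x = trans (⊕-assoc a c _) (trans (cong (a ⊕_) (⊕-comm c _)) (trans (sym (⊕-assoc a _ c)) (cong (a ⊕ x ⊗ eval p x ⊕_) (sym (⊗-identityʳ c)))))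
  eval-plus (a ∷ p) (suc i) (s≤s h) c x = trans (cong (λ z → a ⊕ x ⊗ z) (eval-plus p i h c x)) (trans (cong (a ⊕_) (trans (⊗-distribˡ x _ _)
    (cong (x ⊗ eval p x ⊕_) (trans (sym (⊗-assoc x c _)) (trans (cong (_⊗ pow x i) (⊗-comm x c)) (⊗-assoc c x _)))))) (sym (⊕-assoc a _ _)))

  root-bound : ∀ {n k} (p : Monic n) (r : Fin k → Carrier) → (∀ {i j} → r i ≡ r j → i ≡ j) → (∀ i → eval p (r i) ≡ 0#) → k ≤ n
  root-bound {n} {k} p r inj root = ≮⇒≥ λ n<k → too-many-roots p (λ i → r (inject≤ i n<k)) (λ e → inject≤-injective n<k n<k _ _ (inj e)) λ i → root _

  bit : Bool → Carrier
  bit true = 1#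
  bit false = 0#

  evalᵇ : ∀ {m} → Vec Bool m → Carrier → Carrier
  evalᵇ [] x = 0#
  evalᵇ (b ∷ v) x = bit b ⊕ x ⊗ evalᵇ v x

  -- Over the field with two elements a nonzero polynomial becomes monic once its leading zeros are
  -- dropped.
  leading : ∀ {m} (v : Vec Bool m) → (∀ x → evalᵇ v x ≡ 0#) × v ≡ Vec.replicate m false ⊎ Σ ℕ λ n → n < m × Σ (Monic n) λ p → ∀ x → eval p x ≡ evalᵇ v x
  leading [] = inj₁ ((λ x → refl) , refl)
  leading (b ∷ v) with leading v
  ... | inj₂ (n , lt , p , e) = inj₂ (suc n , s≤s lt , bit b ∷ p , λ x → cong (λ z → bit b ⊕ x ⊗ z) (e x))
  leading (false ∷ v) | inj₁ (z , e) = inj₁ ((λ x → trans (⊕-identityˡ _) (trans (cong (x ⊗_) (z x)) (⊗-zeroʳ x))) , cong (false ∷_) e)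
  leading (true ∷ v) | inj₁ (z , e) = inj₂ (0 , s≤s z≤n , one , λ x → sym (trans (cong (1# ⊕_) (trans (cong (x ⊗_) (z x)) (⊗-zeroʳ x))) (⊕-identityʳ _)))

  frob-bit : ∀ n b → frob n (bit b) ≡ bit b
  frob-bit n true = frob-1 n
  frob-bit n false = frob-0 n

  frob-evalᵇ : ∀ {m} n (v : Vec Bool m) x → frob n (evalᵇ v x) ≡ evalᵇ v (frob n x)
  frob-evalᵇ n [] x = frob-0 n
  frob-evalᵇ n (b ∷ v) x = trans (frob-⊕ n _ _) (cong₂ _⊕_ (frob-bit n b) (trans (frob-⊗ n x _) (cong (frob n x ⊗_) (frob-evalᵇ n v x))))

  frob-injective : ∀ n {x} → frob n x ≡ 0# → x ≡ 0#
  frob-injective zero e = e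
  frob-injective (suc n) {x} e with integral x x (frob-injective n e)
  ... | inj₁ h = h
  ... | inj₂ h = h

  bit-xor : ∀ a b → bit (a xor b) ≡ bit a ⊕ bit b
  bit-xor true true = sym (⊕-self 1#)
  bit-xor true false = sym (⊕-identityʳ _)
  bit-xor false b = sym (⊕-identityˡ _)

  evalᵇ-xor : ∀ {m} (v w : Vec Bool m) x → evalᵇ (Vec.zipWith _xor_ v w) x ≡ evalᵇ v x ⊕ evalᵇ w x
  evalᵇ-xor [] [] x = sym (⊕-self 0#)
  evalᵇ-xor (a ∷ v) (b ∷ w) x = trans (cong₂ _⊕_ (bit-xor a b) (trans (cong (x ⊗_) (evalᵇ-xor v w x)) (⊗-distribˡ x _ _))) (⊕-swap _ _ _ _)

  xor-zero : ∀ {m} (v w : Vec Bool m) → Vec.zipWith _xor_ v w ≡ Vec.replicate m false → v ≡ w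
  xor-zero [] [] _ = refl
  xor-zero (true ∷ v) (true ∷ w) e = cong (true ∷_) (xor-zero v w (cong Vec.tail e))
  xor-zero (false ∷ v) (false ∷ w) e = cong (false ∷_) (xor-zero v w (cong Vec.tail e))

  -- An element with m distinct conjugates is a root of no nonzero polynomial over F₂ of degree < m.
  module Generator (m : ℕ) (x : Carrier) (conjugates : ∀ d → 0 < d → d < m → ¬ frob d x ≡ x) where
    distinct : ∀ i d → d + i < m → frob (d + i) x ≡ frob i x → d ≡ 0
    distinct i zero h e = refl
    distinct i (suc d) h e = ⊥-elim (conjugates (suc d) (s≤s z≤n) (≤-<-trans (m≤m+n (suc d) i) h)
      (⊕-cancelʳ0 _ _ (frob-injective i (trans (frob-⊕ i _ _) (trans (cong (_⊕ frob i x) (trans (sym (frob-+ (suc d) i x)) e)) (⊕-self _))))))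

    conj-injective : ∀ i j → i < m → j < m → frob i x ≡ frob j x → i ≡ j
    conj-injective i j hi hj e with ≤-total i j
    ... | inj₁ i≤j = sym (trans (sym (m∸n+n≡m i≤j)) (cong (_+ i) (distinct i (j ∸ i) (subst (_< m) (sym (m∸n+n≡m i≤j)) hj) (trans (cong (λ k → frob k x) (m∸n+n≡m i≤j)) (sym e)))))
    ... | inj₂ j≤i = trans (sym (m∸n+n≡m j≤i)) (cong (_+ j) (distinct j (i ∸ j) (subst (_< m) (sym (m∸n+n≡m j≤i)) hi) (trans (cong (λ k → frob k x) (m∸n+n≡m j≤i)) e)))

    evalᵇ-injective : ∀ (v w : Vec Bool m) → evalᵇ v x ≡ evalᵇ w x → v ≡ w
    evalᵇ-injective v w e with leading (Vec.zipWith _xor_ v w)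
    ... | inj₁ (_ , z) = xor-zero v w z
    ... | inj₂ (n , n<m , p , ev) = ⊥-elim (too-many-roots p (λ i → frob (toℕ i) x)
            (λ {i} {j} h → toℕ-injective (conj-injective (toℕ i) (toℕ j) (small i) (small j) h))
            λ i → trans (ev _) (trans (sym (frob-evalᵇ (toℕ i) (Vec.zipWith _xor_ v w) x))
              (trans (cong (frob (toℕ i)) (trans (evalᵇ-xor v w x) (trans (cong (_⊕ evalᵇ w x) e) (⊕-self _)))) (frob-0 (toℕ i)))))
      where
      small : ∀ (i : Fin (suc n)) → toℕ i < m
      small i = <-≤-trans (toℕ<n i) n<m

-- The group algebra of a cyclic group over the field with two elements

⨁ : ∀ {n} → (Fin n → Bool) → Bool
⨁ {zero} f = false
⨁ {suc n} f = f zero xor ⨁ (f ∘ suc)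

⨁-cong : ∀ {n} {f g : Fin n → Bool} → (∀ i → f i ≡ g i) → ⨁ f ≡ ⨁ g
⨁-cong {zero} e = refl
⨁-cong {suc n} e = cong₂ _xor_ (e zero) (⨁-cong (e ∘ suc))

xor-swap : ∀ a b c d → (a xor b) xor (c xor d) ≡ (a xor c) xor (b xor d)
xor-swap a b c d = trans (xor-assoc a b _) (trans (cong (a xor_) (trans (sym (xor-assoc b c d)) (trans (cong (_xor d) (xor-comm b c)) (xor-assoc c b d)))) (sym (xor-assoc a c _)))

⨁-false : ∀ n → ⨁ {n} (λ _ → false) ≡ false
⨁-false zero = refl
⨁-false (suc n) = ⨁-false n

⨁-xor : ∀ {n} (f g : Fin n → Bool) → ⨁ (λ i → f i xor g i) ≡ ⨁ f xor ⨁ g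
⨁-xor {zero} f g = refl
⨁-xor {suc n} f g = trans (cong ((f zero xor g zero) xor_) (⨁-xor (f ∘ suc) (g ∘ suc))) (xor-swap (f zero) (g zero) _ _)

⨁-∧ˡ : ∀ {n} a (f : Fin n → Bool) → ⨁ (λ i → a ∧ f i) ≡ a ∧ ⨁ f
⨁-∧ˡ {n} true f = refl
⨁-∧ˡ {n} false f = ⨁-false n

⨁-swap : ∀ {m n} (f : Fin m → Fin n → Bool) → ⨁ (λ i → ⨁ (f i)) ≡ ⨁ (λ j → ⨁ (λ i → f i j))
⨁-swap {zero} {n} f = sym (⨁-false n)
⨁-swap {suc m} f = trans (cong (⨁ (f zero) xor_) (⨁-swap (f ∘ suc))) (sym (⨁-xor (f zero) _))

module Pairing {n : ℕ} where
  ⟨_,_⟩ : (Fin n → Bool) → (Fin n → Bool) → Bool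
  ⟨ f , φ ⟩ = ⨁ λ i → f i ∧ φ i

  ⟨⟩-cong : ∀ {f g φ ψ} → (∀ i → f i ≡ g i) → (∀ i → φ i ≡ ψ i) → ⟨ f , φ ⟩ ≡ ⟨ g , ψ ⟩
  ⟨⟩-cong e h = ⨁-cong λ i → cong₂ _∧_ (e i) (h i)

  ⟨⟩-fubini : ∀ f g (ψ : Fin n → Fin n → Bool) → ⟨ f , (λ i → ⟨ g , ψ i ⟩) ⟩ ≡ ⟨ g , (λ j → ⟨ f , (λ i → ψ i j) ⟩) ⟩
  ⟨⟩-fubini f g ψ = trans (⨁-cong λ i → sym (⨁-∧ˡ (f i) (λ j → g j ∧ ψ i j))) (trans (⨁-swap (λ i j → f i ∧ (g j ∧ ψ i j)))
    (⨁-cong λ j → trans (⨁-cong λ i → trans (sym (∧-assoc (f i) (g j) (ψ i j))) (trans (cong (_∧ ψ i j) (∧-comm (f i) (g j))) (∧-assoc (g j) (f i) (ψ i j))))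
      (⨁-∧ˡ (g j) (λ i → f i ∧ ψ i j))))

  ⟨⟩-comm : ∀ f φ → ⟨ f , φ ⟩ ≡ ⟨ φ , f ⟩
  ⟨⟩-comm f φ = ⨁-cong λ i → ∧-comm (f i) (φ i)

  ⟨⟩-xorˡ : ∀ f g φ → ⟨ (λ i → f i xor g i) , φ ⟩ ≡ ⟨ f , φ ⟩ xor ⟨ g , φ ⟩
  ⟨⟩-xorˡ f g φ = trans (⨁-cong λ i → ∧-distribʳ-xor (φ i) (f i) (g i)) (⨁-xor (λ i → f i ∧ φ i) (λ i → g i ∧ φ i))

  χ : Fin n → Fin n → Bool
  χ i k = ⌊ i ≟ k ⌋

  χ-sym : ∀ i j → χ i j ≡ χ j i
  χ-sym i j with i ≟ j | j ≟ i
  ... | yes _ | yes _ = refl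
  ... | yes p | no q = ⊥-elim (q (sym p))
  ... | no p | yes q = ⊥-elim (p (sym q))
  ... | no _ | no _ = refl

χ-pick : ∀ {n} (a : Fin n) φ → Pairing.⟨_,_⟩ (Pairing.χ a) φ ≡ φ a
χ-pick {suc n} zero φ = trans (cong (φ zero xor_) (⨁-false n)) (xor-false (φ zero))
  where
  xor-false : ∀ b → b xor false ≡ b
  xor-false true = refl
  xor-false false = refl
χ-pick {suc n} (suc a) φ = trans (⨁-cong same) (χ-pick a (φ ∘ suc))
  where
  same : ∀ i → ⌊ suc a ≟ suc i ⌋ ∧ φ (suc i) ≡ ⌊ a ≟ i ⌋ ∧ φ (suc i)
  same i with a ≟ i
  ... | yes refl = refl
  ... | no _ = refl

module CyclicAlgebra (M : ℕ) ⦃ M≢0 : NonZero M ⦄ where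
  open Pairing {M}

  infixl 7 _∙_
  abstract
    _∙_ : Fin M → Fin M → Fin M
    i ∙ j = (toℕ i + toℕ j) mod M

    toℕ-∙ : ∀ i j → toℕ (i ∙ j) ≡ (toℕ i + toℕ j) % M
    toℕ-∙ i j = toℕ-fromℕ< (m%n<n (toℕ i + toℕ j) M)

    exponent : ℕ → Fin M
    exponent e = e mod M

    toℕ-exponent : ∀ e → toℕ (exponent e) ≡ e % M
    toℕ-exponent e = toℕ-fromℕ< (m%n<n e M)

  ∙-comm : ∀ i j → i ∙ j ≡ j ∙ i
  ∙-comm i j = toℕ-injective (trans (toℕ-∙ i j) (trans (cong (_% M) (+-comm (toℕ i) (toℕ j))) (sym (toℕ-∙ j i))))

  %-absorbʳ : ∀ a b → (a + b % M) % M ≡ (a + b) % M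
  %-absorbʳ a b = trans (%-distribˡ-+ a (b % M) M) (trans (cong (λ z → (a % M + z) % M) (m%n%n≡m%n b M)) (sym (%-distribˡ-+ a b M)))

  ∙-assoc : ∀ i j k → (i ∙ j) ∙ k ≡ i ∙ (j ∙ k)
  ∙-assoc i j k = toℕ-injective (trans (toℕ-∙ (i ∙ j) k) (trans (cong (λ z → (z + toℕ k) % M) (toℕ-∙ i j)) (trans (cong (_% M) (+-comm _ (toℕ k)))
    (trans (%-absorbʳ (toℕ k) _) (trans (cong (_% M) (trans (+-comm (toℕ k) _) (+-assoc (toℕ i) _ _))) (trans (sym (%-absorbʳ (toℕ i) _))
      (trans (cong (λ z → (toℕ i + z) % M) (sym (toℕ-∙ j k))) (sym (toℕ-∙ i (j ∙ k))))))))))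

  exponent-∙ : ∀ a b → exponent a ∙ exponent b ≡ exponent (a + b)
  exponent-∙ a b = toℕ-injective (trans (toℕ-∙ (exponent a) (exponent b)) (trans (cong₂ (λ x y → (x + y) % M) (toℕ-exponent a) (toℕ-exponent b))
    (trans (sym (%-distribˡ-+ a b M)) (sym (toℕ-exponent (a + b))))))

  exponent-toℕ : ∀ i → exponent (toℕ i) ≡ i
  exponent-toℕ i = toℕ-injective (trans (toℕ-exponent (toℕ i)) (m<n⇒m%n≡m (toℕ<n i)))

  0∙ : ∀ j → exponent 0 ∙ j ≡ j
  0∙ j = trans (cong (exponent 0 ∙_) (sym (exponent-toℕ j))) (trans (exponent-∙ 0 (toℕ j)) (exponent-toℕ j))

  conv : (Fin M → Bool) → (Fin M → Bool) → Fin M → Bool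
  conv f g k = ⟨ f , (λ i → ⟨ g , (λ j → χ (i ∙ j) k) ⟩) ⟩

  -- Testing a convolution against an arbitrary φ reduces associativity of the product to
  -- associativity of adding exponents.
  conv-pair : ∀ f g φ → ⟨ conv f g , φ ⟩ ≡ ⟨ f , (λ i → ⟨ g , (λ j → φ (i ∙ j)) ⟩) ⟩
  conv-pair f g φ = trans (⟨⟩-comm (conv f g) φ) (trans (⟨⟩-fubini φ f (λ k i → ⟨ g , (λ j → χ (i ∙ j) k) ⟩)) (⟨⟩-cong {f} {f} (λ _ → refl) λ i →
    trans (⟨⟩-fubini φ g (λ k j → χ (i ∙ j) k)) (⟨⟩-cong {g} {g} (λ _ → refl) λ j → trans (⟨⟩-comm φ (χ (i ∙ j))) (χ-pick (i ∙ j) φ))))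

  Elt : Set
  Elt = Vec Bool M

  ext : ∀ {x y : Elt} → (∀ i → lookup x i ≡ lookup y i) → x ≡ y
  ext {x} {y} e = trans (sym (tabulate∘lookup x)) (trans (tabulate-cong e) (tabulate∘lookup y))

  monomial : Fin M → Elt
  monomial a = tabulate (χ a)

  abstract
    add mul : Elt → Elt → Elt
    add x y = tabulate λ i → lookup x i xor lookup y i
    mul x y = tabulate (conv (lookup x) (lookup y))

    at-add : ∀ x y i → lookup (add x y) i ≡ lookup x i xor lookup y i
    at-add x y i = lookup∘tabulate _ i

    at-mul : ∀ x y i → lookup (mul x y) i ≡ conv (lookup x) (lookup y) i
    at-mul x y i = lookup∘tabulate _ i

    mul-tabulate : ∀ x y → mul x y ≡ tabulate (conv (lookup x) (lookup y))
    mul-tabulate x y = refl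

  algebra : CharTwo
  algebra = record
    { Carrier = Elt
    ; _⊕_ = add
    ; _⊗_ = mul
    ; 0# = tabulate λ _ → false
    ; 1# = monomial (exponent 0)
    ; ⊕-assoc = λ x y z → ext λ i → trans (at-add (add x y) z i) (trans (cong (_xor lookup z i) (at-add x y i)) (trans (xor-assoc (lookup x i) _ _)
        (sym (trans (at-add x (add y z) i) (cong (lookup x i xor_) (at-add y z i))))))
    ; ⊕-comm = λ x y → ext λ i → trans (at-add x y i) (trans (xor-comm (lookup x i) _) (sym (at-add y x i)))
    ; ⊕-identityˡ = λ x → ext λ i → trans (at-add (tabulate λ _ → false) x i) (cong (_xor lookup x i) (lookup∘tabulate (λ _ → false) i))
    ; ⊕-self = λ x → ext λ i → trans (at-add x x i) (trans (xor-same (lookup x i)) (sym (lookup∘tabulate _ i)))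
    ; ⊗-assoc = λ x y z → ext λ k → trans (at-mul (mul x y) z k) (trans (⟨⟩-cong {φ = λ a → ⟨ lookup z , (λ l → χ (a ∙ l) k) ⟩} (at-mul x y) (λ _ → refl))
        (trans (conv-pair (lookup x) (lookup y) (λ a → ⟨ lookup z , (λ l → χ (a ∙ l) k) ⟩))
        (trans (⟨⟩-cong {lookup x} (λ _ → refl) λ i → ⟨⟩-cong {lookup y} (λ _ → refl) λ j → ⟨⟩-cong {lookup z} (λ _ → refl) λ l → cong (λ a → χ a k) (∙-assoc i j l))
          (sym (trans (at-mul x (mul y z) k) (⟨⟩-cong {lookup x} (λ _ → refl) λ i → trans (⟨⟩-cong {φ = λ b → χ (i ∙ b) k} (at-mul y z) (λ _ → refl)) (conv-pair (lookup y) (lookup z) (λ b → χ (i ∙ b) k))))))))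
    ; ⊗-comm = λ x y → ext λ k → trans (at-mul x y k) (trans (⟨⟩-fubini (lookup x) (lookup y) (λ i j → χ (i ∙ j) k))
        (trans (⟨⟩-cong {lookup y} (λ _ → refl) λ j → ⟨⟩-cong {lookup x} (λ _ → refl) λ i → cong (λ a → χ a k) (∙-comm i j)) (sym (at-mul y x k))))
    ; ⊗-identityˡ = λ x → ext λ k → trans (at-mul (monomial (exponent 0)) x k) (trans (⟨⟩-cong {φ = λ i → ⟨ lookup x , (λ j → χ (i ∙ j) k) ⟩} (lookup∘tabulate (χ (exponent 0))) (λ _ → refl))
        (trans (χ-pick (exponent 0) (λ i → ⟨ lookup x , (λ j → χ (i ∙ j) k) ⟩))
        (trans (⟨⟩-cong {lookup x} (λ _ → refl) λ j → trans (cong (λ a → χ a k) (0∙ j)) (χ-sym j k)) (trans (⟨⟩-comm (lookup x) (χ k)) (χ-pick k (lookup x))))))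
    ; ⊗-distribˡ = λ x y z → ext λ k → trans (at-mul x (add y z) k) (trans (⟨⟩-cong {lookup x} (λ _ → refl) λ i →
          trans (⟨⟩-cong {φ = λ j → χ (i ∙ j) k} (at-add y z) (λ _ → refl)) (⟨⟩-xorˡ (lookup y) (lookup z) (λ j → χ (i ∙ j) k)))
        (trans (trans (⟨⟩-comm (lookup x) (λ i → row y i k xor row z i k)) (trans (⟨⟩-xorˡ (λ i → row y i k) (λ i → row z i k) (lookup x))
            (cong₂ _xor_ (⟨⟩-comm (λ i → row y i k) (lookup x)) (⟨⟩-comm (λ i → row z i k) (lookup x)))))
          (sym (trans (at-add (mul x y) (mul x z) k) (cong₂ _xor_ (at-mul x y k) (at-mul x z k))))))
    }
    where
    row : Elt → Fin M → Fin M → Bool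
    row y i k = ⟨ lookup y , (λ j → χ (i ∙ j) k) ⟩

  open CharTwo algebra

  monomial-⊗ : ∀ a b → monomial a ⊗ monomial b ≡ monomial (a ∙ b)
  monomial-⊗ a b = trans (mul-tabulate (monomial a) (monomial b)) (tabulate-cong λ k → trans (⟨⟩-cong {φ = λ i → ⟨ lookup (monomial b) , (λ j → χ (i ∙ j) k) ⟩} (lookup∘tabulate (χ a)) (λ _ → refl))
    (trans (χ-pick a (λ i → ⟨ lookup (monomial b) , (λ j → χ (i ∙ j) k) ⟩)) (trans (⟨⟩-cong {φ = λ j → χ (a ∙ j) k} (lookup∘tabulate (χ b)) (λ _ → refl)) (χ-pick b (λ j → χ (a ∙ j) k)))))

  lookup-⊕ : ∀ x y i → lookup (x ⊕ y) i ≡ lookup x i xor lookup y i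
  lookup-⊕ = at-add

  lookup-monomial-⊗ : ∀ a g k → lookup (monomial a ⊗ g) k ≡ ⟨ lookup g , (λ j → χ (a ∙ j) k) ⟩
  lookup-monomial-⊗ a g k = trans (at-mul (monomial a) g k) (trans (⟨⟩-cong {φ = λ i → ⟨ lookup g , (λ j → χ (i ∙ j) k) ⟩} (lookup∘tabulate (χ a)) (λ _ → refl)) (χ-pick a (λ i → ⟨ lookup g , (λ j → χ (i ∙ j) k) ⟩)))

  pick : Bool → Elt → Elt
  pick true x = x
  pick false x = 0#

  combination : ∀ {n} → (Fin n → Bool) → (Fin n → Elt) → Elt
  combination {zero} c v = 0#
  combination {suc n} c v = pick (c zero) (v zero) ⊕ combination (c ∘ suc) (v ∘ suc)

  lookup-combination : ∀ {n} (c : Fin n → Bool) v k → lookup (combination c v) k ≡ ⨁ λ i → c i ∧ lookup (v i) k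
  lookup-combination {zero} c v k = lookup∘tabulate _ k
  lookup-combination {suc n} c v k with c zero
  ... | true = trans (lookup-⊕ (v zero) (combination (c ∘ suc) (v ∘ suc)) k) (cong (lookup (v zero) k xor_) (lookup-combination (c ∘ suc) (v ∘ suc) k))
  ... | false = trans (lookup-⊕ 0# (combination (c ∘ suc) (v ∘ suc)) k) (cong₂ _xor_ (lookup∘tabulate _ k) (lookup-combination (c ∘ suc) (v ∘ suc) k))

  as-combination : ∀ x → x ≡ combination (lookup x) monomial
  as-combination x = ext λ k → sym (trans (lookup-combination (lookup x) monomial k) (trans (⨁-cong λ i → cong (lookup x i ∧_) (trans (lookup∘tabulate _ k) (χ-sym i k))) (trans (⟨⟩-comm (lookup x) (χ k)) (χ-pick k (lookup x)))))

-- Finite types with a given number of elements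

record Enum (A : Set) (n : ℕ) : Set where
  field
    to : A → Fin n
    from : Fin n → A
    to-from : ∀ i → to (from i) ≡ i
    from-to : ∀ a → from (to a) ≡ a

  to-injective : ∀ {a b} → to a ≡ to b → a ≡ b
  to-injective {a} {b} e = trans (sym (from-to a)) (trans (cong from e) (from-to b))

  decide : (a b : A) → Dec (a ≡ b)
  decide a b with to a ≟ to b
  ... | yes e = yes (to-injective e)
  ... | no ne = no λ e → ne (cong to e)

  from-injective : ∀ {i j} → from i ≡ from j → i ≡ j
  from-injective {i} {j} e = trans (sym (to-from i)) (trans (cong to e) (to-from j))

open Enum

enum-≤ : ∀ {A B m n} → Enum A m → Enum B n → (f : A → B) → (∀ {x y} → f x ≡ f y → x ≡ y) → m ≤ n
enum-≤ E F f inj = injective⇒≤ {f = λ i → to F (f (from E i))} λ e → from-injective E (inj (to-injective F e))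

enum-via : ∀ {A B n} → Enum A n → (f : A → B) (g : B → A) → (∀ b → f (g b) ≡ b) → (∀ a → g (f a) ≡ a) → Enum B n
enum-via E f g fg gf = record { to = λ b → to E (g b) ; from = λ i → f (from E i)
  ; to-from = λ i → trans (cong (to E) (gf (from E i))) (to-from E i) ; from-to = λ b → trans (cong f (from-to E (g b))) (fg b) }

infixr 4 _×ᴱ_
_×ᴱ_ : ∀ {A B m n} → Enum A m → Enum B n → Enum (A × B) (m * n)
_×ᴱ_ {m = m} {n} E F = record
  { to = λ { (a , b) → combine (to E a) (to F b) }
  ; from = λ i → from E (proj₁ (remQuot {m} n i)) , from F (proj₂ (remQuot {m} n i))
  ; to-from = λ i → trans (cong₂ combine (to-from E _) (to-from F _)) (combine-remQuot {m} n i)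
  ; from-to = λ { (a , b) → cong₂ _,_ (trans (cong (λ z → from E (proj₁ z)) (remQuot-combine (to E a) (to F b))) (from-to E a))
                              (trans (cong (λ z → from F (proj₂ z)) (remQuot-combine (to E a) (to F b))) (from-to F b)) } }

enum-Fin : ∀ n → Enum (Fin n) n
enum-Fin n = record { to = λ i → i ; from = λ i → i ; to-from = λ _ → refl ; from-to = λ _ → refl }

enum-Bool : Enum Bool 2
enum-Bool = record { to = λ { false → zero ; true → suc zero } ; from = λ { zero → false ; (suc zero) → true }
  ; to-from = λ { zero → refl ; (suc zero) → refl } ; from-to = λ { false → refl ; true → refl } }

enum-Vec : ∀ {A q} → Enum A q → ∀ n → Enum (Vec A n) (q ^ n)
enum-Vec E zero = record { to = λ _ → zero ; from = λ _ → [] ; to-from = λ { zero → refl } ; from-to = λ { [] → refl } }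
enum-Vec E (suc n) = enum-via (E ×ᴱ enum-Vec E n) (λ { (b , v) → b ∷ v }) (λ { (b ∷ v) → b , v }) (λ { (b ∷ v) → refl }) (λ { (b , v) → refl })

enum-bits : ∀ n → Enum (Vec Bool n) (2 ^ n)
enum-bits = enum-Vec enum-Bool

enum-subset : ∀ n (P : Fin n → Set) → (∀ i → Dec (P i)) → (∀ i (p q : P i) → p ≡ q) → ∃ λ k → Enum (Σ (Fin n) P) k
enum-subset zero P P? prop = 0 , record { to = λ () ; from = λ () ; to-from = λ () ; from-to = λ () }
enum-subset (suc n) P P? prop with enum-subset n (λ i → P (suc i)) (λ i → P? (suc i)) (λ i → prop (suc i)) | P? zero
... | k , E | no ¬p = k , enum-via E (λ { (i , p) → suc i , p }) (λ { (zero , p) → ⊥-elim (¬p p) ; (suc i , p) → i , p })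
      (λ { (zero , p) → ⊥-elim (¬p p) ; (suc i , p) → refl }) (λ { (i , p) → refl })
... | k , E | yes p = suc k , record
      { to = λ { (zero , _) → zero ; (suc i , q) → suc (to E (i , q)) }
      ; from = λ { zero → zero , p ; (suc j) → suc (proj₁ (from E j)) , proj₂ (from E j) }
      ; to-from = λ { zero → refl ; (suc j) → cong suc (to-from E j) }
      ; from-to = λ { (zero , q) → cong (zero ,_) (prop zero p q) ; (suc i , q) → cong (λ { (i , q) → suc i , q }) (from-to E (i , q)) } }

enum-Σ : ∀ {A n} → Enum A n → (P : A → Set) → (∀ a → Dec (P a)) → (∀ a (p q : P a) → p ≡ q) → ∃ λ k → Enum (Σ A P) k
enum-Σ {A} E P P? prop with enum-subset _ (λ i → P (from E i)) (λ i → P? (from E i)) (λ i → prop (from E i))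
... | k , F = k , enum-via F (λ { (i , p) → from E i , p }) (λ { (a , p) → to E a , subst P (sym (from-to E a)) p })
      (λ { (a , p) → pair (from-to E a) }) (λ { (i , p) → pairᶠ (to-from E i) })
  where
  pair : ∀ {a a′} {p : P a} {p′ : P a′} → a ≡ a′ → _≡_ {A = Σ A P} (a , p) (a′ , p′)
  pair {a} {p = p} {p′} refl = cong (a ,_) (prop a p p′)
  pairᶠ : ∀ {i j} {p : P (from E i)} {q : P (from E j)} → i ≡ j → _≡_ {A = Σ _ λ i → P (from E i)} (i , p) (j , q)
  pairᶠ {i} {p = p} {q} refl = cong (i ,_) (prop (from E i) p q)

-- A map with fibres of at most k elements is injective together with the rank inside the fibre.
fibre-bound : ∀ {A B a b} k → Enum A a → Enum B b → (f : A → B) → (∀ y n → (r : Fin n → A) → (∀ {i j} → r i ≡ r j → i ≡ j) → (∀ i → f (r i) ≡ y) → n ≤ k) → a ≤ b * k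
fibre-bound {A} {B} k E F f small = enum-≤ E (F ×ᴱ enum-Fin k) (λ x → f x , rank x) λ {x} {x′} e →
    separate (cong proj₁ e) (trans (sym (toℕ-inject≤ _ (bounded (f x)))) (trans (cong (λ z → toℕ (proj₂ z)) e) (toℕ-inject≤ _ (bounded (f x′)))))
  where
  fibre : ∀ y → ∃ λ n → Enum (Σ A λ x → f x ≡ y) n
  fibre y = enum-Σ E (λ x → f x ≡ y) (λ x → decide F (f x) y) (λ x → uip)
  card = λ y → proj₁ (fibre y)
  pair : ∀ {y} {p q : Σ A λ x → f x ≡ y} → proj₁ p ≡ proj₁ q → p ≡ q
  pair {p = x , p} {.x , q} refl = cong (x ,_) (uip p q)
  bounded : ∀ y → card y ≤ k
  bounded y = small y (card y) (λ i → proj₁ (from (proj₂ (fibre y)) i)) (λ e → from-injective (proj₂ (fibre y)) (pair e)) (λ i → proj₂ (from (proj₂ (fibre y)) i))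
  rank : A → Fin k
  rank x = inject≤ (to (proj₂ (fibre (f x))) (x , refl)) (bounded (f x))
  separate : ∀ {x x′} → f x ≡ f x′ → toℕ (to (proj₂ (fibre (f x))) (x , refl)) ≡ toℕ (to (proj₂ (fibre (f x′))) (x′ , refl)) → x ≡ x′
  separate {x} {x′} e h = at (f x′) e refl (trans (sym (move (f x′) e)) h)
    where
    move : ∀ y (p : f x ≡ y) → toℕ (to (proj₂ (fibre (f x))) (x , refl)) ≡ toℕ (to (proj₂ (fibre y)) (x , p))
    move _ refl = refl
    at : ∀ y (p : f x ≡ y) (p′ : f x′ ≡ y) → toℕ (to (proj₂ (fibre y)) (x , p)) ≡ toℕ (to (proj₂ (fibre y)) (x′ , p′)) → x ≡ x′
    at y p p′ h = cong proj₁ (to-injective (proj₂ (fibre y)) (toℕ-injective h))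

-- The field with 2^m elements as a summand of the group algebra

record BinaryField (m : ℕ) : Set₁ where
  field
    ring : CharTwo
  open CharTwo ring public
  field
    1≢0 : ¬ 1# ≡ 0#
    integral : ∀ x y → x ⊗ y ≡ 0# → x ≡ 0# ⊎ y ≡ 0#
    fermat : ∀ x → frob m x ≡ x
    elements : Enum Carrier (2 ^ m)

-- A minimal idempotent below the support of Π (X^(2^i) + X) cuts a ring of exponent 2^m down to a field in which X has m conjugates.
module MinimalIdempotent (m′ M : ℕ) ⦃ M≢0 : NonZero M ⦄ (2^m : suc M ≡ 2 ^ suc (suc m′)) (R : CharTwo)
  {card : ℕ} (enum : Enum (CharTwo.Carrier R) card) (fermat₀ : ∀ x → CharTwo.frob R (suc (suc m′)) x ≡ x) (X : CharTwo.Carrier R) where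
  open CharTwo R
  m : ℕ
  m = suc (suc m′)

  _≟ᶜ_ = Enum.decide enum

  product : ℕ → Carrier
  product zero = 1#
  product (suc d) = (frob (suc d) X ⊕ X) ⊗ product d

  u : Carrier
  u = product (suc m′)

  -- Since y^(M+1) = y, this power is an idempotent acting as the identity on y.
  support : Carrier → Carrier
  support y = pow y M

  ⊗-support : ∀ y → y ⊗ support y ≡ y
  ⊗-support y = trans (cong (pow y) 2^m) (trans (sym (frob-pow m y)) (fermat₀ y))

  pow-≢0 : ∀ k → NonZero k → ∀ y → ∃ λ z → pow y k ≡ y ⊗ z
  pow-≢0 (suc k) _ y = pow y k , refl

  support-idem : ∀ y → support y ⊗ support y ≡ support y
  support-idem y with pow-≢0 M M≢0 y
  ... | z , e = trans (cong (_⊗ support y) (trans e (⊗-comm y z))) (trans (⊗-assoc z y _) (trans (cong (z ⊗_) (⊗-support y)) (trans (⊗-comm z y) (sym e))))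

  -- A greedy search through all elements g: the idempotent is cut by the support of g unless that
  -- would give 0. In the end each g is 0 or invertible on the piece, which makes the piece
  -- integral.
  refine : List Carrier → Carrier → Carrier
  refine [] e = e
  refine (g ∷ gs) e with (e ⊗ support g) ≟ᶜ 0#
  ... | yes _ = refine gs e
  ... | no _ = refine gs (e ⊗ support g)

  record Refined (gs : List Carrier) (e r : Carrier) : Set where
    field
      idem : r ⊗ r ≡ r
      nonzero : ¬ r ≡ 0#
      under : r ⊗ e ≡ r
      minimal : ∀ {g} → g ∈ gs → r ⊗ support g ≡ 0# ⊎ r ⊗ support g ≡ r
  open Refined

  absorb-⊗ : ∀ r e s → r ⊗ (e ⊗ s) ≡ r → e ⊗ e ≡ e → r ⊗ e ≡ r
  absorb-⊗ r e s h ee = trans (cong (_⊗ e) (sym h)) (trans (⊗-assoc r _ e) (trans (cong (r ⊗_) (trans (⊗-comm _ e) (trans (sym (⊗-assoc e e s)) (cong (_⊗ s) ee)))) h))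

  refined : ∀ gs e → e ⊗ e ≡ e → ¬ e ≡ 0# → Refined gs e (refine gs e)
  refined [] e ee nz = record { idem = ee ; nonzero = nz ; under = ee ; minimal = λ () }
  refined (g ∷ gs) e ee nz with (e ⊗ support g) ≟ᶜ 0#
  ... | yes z = record { idem = idem F ; nonzero = nonzero F ; under = under F ; minimal = λ { (Any.here refl) → inj₁ zero′ ; (Any.there h) → minimal F h } }
    where
    F = refined gs e ee nz
    r = refine gs e
    zero′ : r ⊗ support g ≡ 0#
    zero′ = trans (cong (_⊗ support g) (sym (under F))) (trans (⊗-assoc r e _) (trans (cong (r ⊗_) z) (⊗-zeroʳ r)))
  ... | no nz′ = record { idem = idem F ; nonzero = nonzero F ; under = absorb-⊗ r e s (under F) ee ; minimal = λ { (Any.here refl) → inj₂ (absorb-⊗ r s e (trans (cong (r ⊗_) (⊗-comm s e)) (under F)) (support-idem g)) ; (Any.there h) → minimal F h } }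
    where
    s = support g
    ee′ : (e ⊗ s) ⊗ (e ⊗ s) ≡ e ⊗ s
    ee′ = trans (⊗-swap e s e s) (cong₂ _⊗_ ee (support-idem g))
    F = refined gs (e ⊗ s) ee′ nz′
    r = refine gs (e ⊗ s)

  everything : List Carrier
  everything = List.map (Enum.from enum) (List.allFin card)

  complete : ∀ v → v ∈ everything
  complete v = subst (_∈ everything) (Enum.from-to enum v) (∈-map⁺ (Enum.from enum) (∈-allFin (Enum.to enum v)))

  e₀ e : Carrier
  e₀ = support u
  e = refine everything e₀

  module _ (u≢0 : ¬ u ≡ 0#) where
    e₀≢0 : ¬ e₀ ≡ 0#
    e₀≢0 h = u≢0 (trans (sym (⊗-support u)) (trans (cong (u ⊗_) h) (⊗-zeroʳ u)))

    e-refined : Refined everything e₀ e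
    e-refined = refined everything e₀ (support-idem u) e₀≢0

    ee : e ⊗ e ≡ e
    ee = idem e-refined

    Piece : Set
    Piece = Σ Carrier λ v → v ⊗ e ≡ v

    K-≡ : ∀ {x y : Piece} → proj₁ x ≡ proj₁ y → x ≡ y
    K-≡ {v , p} {.v , q} refl = cong (v ,_) (uip p q)

    K-ring : CharTwo
    K-ring = record
      { Carrier = Piece
      ; _⊕_ = λ { (x , p) (y , q) → x ⊕ y , trans (⊗-distribʳ e x y) (cong₂ _⊕_ p q) }
      ; _⊗_ = λ { (x , p) (y , q) → x ⊗ y , trans (⊗-assoc x y e) (cong (x ⊗_) q) }
      ; 0# = 0# , ⊗-zeroˡ e
      ; 1# = e , ee
      ; ⊕-assoc = λ x y z → K-≡ (⊕-assoc _ _ _)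
      ; ⊕-comm = λ x y → K-≡ (⊕-comm _ _)
      ; ⊕-identityˡ = λ x → K-≡ (⊕-identityˡ _)
      ; ⊕-self = λ x → K-≡ (⊕-self _)
      ; ⊗-assoc = λ x y z → K-≡ (⊗-assoc _ _ _)
      ; ⊗-comm = λ x y → K-≡ (⊗-comm _ _)
      ; ⊗-identityˡ = λ { (x , p) → K-≡ (trans (⊗-comm e x) p) }
      ; ⊗-distribˡ = λ x y z → K-≡ (⊗-distribˡ _ _ _)
      }

    module 𝕂 = CharTwo K-ring

    K-1≢0 : ¬ 𝕂.1# ≡ 𝕂.0#
    K-1≢0 h = nonzero e-refined (cong proj₁ h)

    K-integral : ∀ x y → x 𝕂.⊗ y ≡ 𝕂.0# → x ≡ 𝕂.0# ⊎ y ≡ 𝕂.0#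
    K-integral (x , p) (y , q) h with minimal e-refined (complete x)
    ... | inj₁ z = inj₁ (K-≡ (trans (sym (⊗-support x)) (trans (cong (_⊗ support x) (sym p)) (trans (⊗-assoc x e _) (trans (cong (x ⊗_) z) (⊗-zeroʳ x))))))
    ... | inj₂ z with pow-≢0 M M≢0 x
    ...   | w , s = inj₂ (K-≡ (trans (sym q) (trans (cong (y ⊗_) (trans (sym z) (trans (⊗-comm e _) (cong (_⊗ e) s))))
            (trans (sym (⊗-assoc y (x ⊗ w) e)) (trans (cong (_⊗ e) (trans (sym (⊗-assoc y x w)) (trans (cong (_⊗ w) (trans (⊗-comm y x) (cong proj₁ h))) (⊗-zeroˡ w)))) (⊗-zeroˡ e))))))

    frob-proj : ∀ n (x : Piece) → proj₁ (𝕂.frob n x) ≡ frob n (proj₁ x)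
    frob-proj zero x = refl
    frob-proj (suc n) x = frob-proj n (x 𝕂.⊗ x)

    K-fermat : ∀ x → 𝕂.frob m x ≡ x
    K-fermat x = K-≡ (trans (frob-proj m x) (fermat₀ (proj₁ x)))

    frob-e : ∀ n → frob n e ≡ e
    frob-e zero = refl
    frob-e (suc n) = trans (cong (frob n) ee) (frob-e n)

    Xᴷ : Piece
    Xᴷ = X ⊗ e , trans (⊗-assoc X e e) (cong (X ⊗_) ee)

    factor-kills : ∀ d n → 0 < d → d ≤ n → (frob d X ⊕ X) ⊗ e ≡ 0# → product n ⊗ e ≡ 0#
    factor-kills (suc d) (suc n) 0<d d≤n h with ≤-<-connex (suc n) (suc d)
    ... | inj₁ n≤d with refl ← ≤-antisym d≤n n≤d = trans (⊗-assoc _ (product n) e) (trans (cong ((frob (suc d) X ⊕ X) ⊗_) (⊗-comm (product n) e)) (trans (sym (⊗-assoc _ e _)) (trans (cong (_⊗ product n) h) (⊗-zeroˡ _))))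
    ... | inj₂ (s≤s d<n) = trans (⊗-assoc _ (product n) e) (trans (cong ((frob (suc n) X ⊕ X) ⊗_) (factor-kills (suc d) n 0<d d<n h)) (⊗-zeroʳ _))

    conjugates : ∀ d → 0 < d → d < m → ¬ 𝕂.frob d Xᴷ ≡ Xᴷ
    conjugates d 0<d (s≤s d<m) h = nonzero e-refined (trans (sym (under e-refined)) (killed (pow-≢0 M M≢0 u)))
      where
      fixed : frob d X ⊗ e ≡ X ⊗ e
      fixed = trans (cong (frob d X ⊗_) (sym (frob-e d))) (trans (sym (frob-⊗ d X e)) (trans (sym (frob-proj d Xᴷ)) (cong proj₁ h)))
      ue : u ⊗ e ≡ 0#
      ue = factor-kills d (suc m′) 0<d d<m (trans (⊗-distribʳ e _ _) (trans (cong (_⊕ X ⊗ e) fixed) (⊕-self _)))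
      killed : (∃ λ z → pow u M ≡ u ⊗ z) → e ⊗ e₀ ≡ 0#
      killed (z , s) = trans (cong (e ⊗_) s) (trans (sym (⊗-assoc e u z)) (trans (cong (_⊗ z) (trans (⊗-comm e u) ue)) (⊗-zeroˡ z)))

    open Roots K-ring K-1≢0 K-integral

    K-enum : ∃ λ Q → Enum Piece Q
    K-enum = enum-Σ enum (λ v → v ⊗ e ≡ v) (λ v → (v ⊗ e) ≟ᶜ v) (λ v p q → uip p q)

    -- Every element of the piece is a root of x^(2^m) + x.
    Q≤ : proj₁ K-enum ≤ 2 ^ m
    Q≤ = root-bound (plus (power (2 ^ m)) 1 1<2^m 𝕂.1#) (Enum.from (proj₂ K-enum)) (Enum.from-injective (proj₂ K-enum)) λ i →
        trans (eval-plus (power (2 ^ m)) 1 1<2^m 𝕂.1# _) (trans (cong₂ 𝕂._⊕_ (trans (eval-power (2 ^ m) _) (trans (sym (𝕂.frob-pow m _)) (K-fermat _)))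
          (trans (𝕂.⊗-identityˡ _) (𝕂.⊗-identityʳ _))) (𝕂.⊕-self _))
      where
      1<2^m : 1 < 2 ^ m
      1<2^m = ^-monoʳ-≤ 2 (s≤s (z≤n {suc m′}))

    -- The 2^m polynomials of degree below m over the two-element field take distinct values at X,
    -- because it has m distinct conjugates.
    ≤Q : 2 ^ m ≤ proj₁ K-enum
    ≤Q = enum-≤ (enum-bits m) (proj₂ K-enum) (λ v → evalᵇ v Xᴷ) (λ {v} {w} → Generator.evalᵇ-injective m Xᴷ conjugates v w)

    field-of-order : BinaryField m
    field-of-order = record { ring = K-ring ; 1≢0 = K-1≢0 ; integral = K-integral ; fermat = K-fermat
      ; elements = subst (Enum Piece) (≤-antisym Q≤ ≤Q) (proj₂ K-enum) }

module Build (m′ M : ℕ) ⦃ M≢0 : NonZero M ⦄ (2^m : suc M ≡ 2 ^ suc (suc m′)) where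
  m : ℕ
  m = suc (suc m′)

  open CyclicAlgebra M
  open Pairing {M}
  open CharTwo algebra

  X : Elt
  X = monomial (exponent 1)

  frob-monomial : ∀ n a → frob n (monomial (exponent a)) ≡ monomial (exponent (2 ^ n * a))
  frob-monomial zero a = cong (monomial ∘ exponent) (sym (+-identityʳ a))
  frob-monomial (suc n) a = trans (cong (frob n) (trans (monomial-⊗ _ _) (cong monomial (exponent-∙ a a)))) (trans (frob-monomial n (a + a))
    (cong (monomial ∘ exponent) (trans (*-distribˡ-+ (2 ^ n) a a) (trans (cong (2 ^ n * a +_) (sym (+-identityʳ _))) (sym (*-assoc 2 (2 ^ n) a))))))

  -- Exponents live modulo M = 2^m - 1, where 2^m acts as 1; additivity carries this over to all
  -- elements.
  fermat-monomial : ∀ i → frob m (monomial i) ≡ monomial i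
  fermat-monomial i = trans (cong (frob m ∘ monomial) (sym (exponent-toℕ i))) (trans (frob-monomial m (toℕ i)) (cong monomial
    (trans (toℕ-injective (trans (toℕ-exponent _) (trans (cong (λ k → k * toℕ i % M) (sym 2^m)) (trans (cong (λ z → (toℕ i + z) % M) (*-comm M (toℕ i)))
      (trans ([m+kn]%n≡m%n (toℕ i) (toℕ i) M) (sym (toℕ-exponent (toℕ i)))))))) (exponent-toℕ i))))

  fermat₀ : ∀ x → frob m x ≡ x
  fermat₀ x = trans (cong (frob m) (as-combination x)) (trans (go (lookup x) monomial fermat-monomial) (sym (as-combination x)))
    where
    go : ∀ {n} (c : Fin n → Bool) v → (∀ i → frob m (v i) ≡ v i) → frob m (combination c v) ≡ combination c v
    go {zero} c v h = frob-0 m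
    go {suc n} c v h = trans (frob-⊕ m (pick (c zero) (v zero)) (combination (c ∘ suc) (v ∘ suc))) (cong₂ _⊕_ (one (c zero)) (go (c ∘ suc) (v ∘ suc) (h ∘ suc)))
      where
      one : ∀ b → frob m (pick b (v zero)) ≡ pick b (v zero)
      one true = h zero
      one false = frob-0 m

  -- Degrees of the partial products Π_{0<i≤d} (X^(2^i) + X).
  top : ℕ → ℕ
  top zero = 0
  top (suc d) = 2 ^ suc d + top d

  top≡ : ∀ d → top d + 2 ≡ 2 ^ suc d
  top≡ zero = refl
  top≡ (suc d) = trans (+-assoc (2 ^ suc d) (top d) 2) (trans (cong (2 ^ suc d +_) (top≡ d)) (cong (2 ^ suc d +_) (sym (+-identityʳ _))))

  open MinimalIdempotent m′ M ⦃ M≢0 ⦄ 2^m algebra (enum-bits M) fermat₀ X using (product; u; field-of-order)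

  Supported : Elt → ℕ → Set
  Supported g t = ∀ k → t < toℕ k → lookup g k ≡ false

  shift-toℕ : ∀ s t j → s + t < M → toℕ j ≤ t → toℕ (exponent s ∙ j) ≡ s + toℕ j
  shift-toℕ s t j h j≤t = trans (toℕ-∙ (exponent s) j) (trans (cong (λ z → (z + toℕ j) % M) (trans (toℕ-exponent s) (m<n⇒m%n≡m (≤-<-trans (m≤m+n s t) h))))
    (m<n⇒m%n≡m (≤-<-trans (+-monoʳ-≤ s j≤t) h)))

  shift-supported : ∀ s t g → s + t < M → Supported g t → Supported (monomial (exponent s) ⊗ g) (s + t)
  shift-supported s t g h sup k k> = trans (lookup-monomial-⊗ (exponent s) g k) (trans (⨁-cong none) (⨁-false M))
    where
    none : ∀ j → lookup g j ∧ χ (exponent s ∙ j) k ≡ false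
    none j with toℕ j ≤? t
    ... | no j> rewrite sup j (≰⇒> j>) = refl
    ... | yes j≤ with exponent s ∙ j Fin.≟ k
    ...   | no _ = Boolₚ.∧-zeroʳ _
    ...   | yes refl = ⊥-elim (<⇒≱ k> (≤-trans (≤-reflexive (shift-toℕ s t j h j≤)) (+-monoʳ-≤ s j≤)))

  shift-top : ∀ s t g → s + t < M → Supported g t → lookup (monomial (exponent s) ⊗ g) (exponent (s + t)) ≡ lookup g (exponent t)
  shift-top s t g h sup = trans (lookup-monomial-⊗ (exponent s) g _) (trans (⨁-cong same) (trans (⟨⟩-comm (lookup g) (λ j → χ (exponent t) j)) (χ-pick (exponent t) (lookup g))))
    where
    toℕ-e : ∀ a → a < M → toℕ (exponent a) ≡ a
    toℕ-e a lt = trans (toℕ-exponent a) (m<n⇒m%n≡m lt)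
    t<M : t < M
    t<M = ≤-<-trans (m≤n+m t s) h
    same : ∀ j → lookup g j ∧ χ (exponent s ∙ j) (exponent (s + t)) ≡ lookup g j ∧ χ (exponent t) j
    same j with toℕ j ≤? t
    ... | no j> rewrite sup j (≰⇒> j>) = refl
    ... | yes j≤ with exponent s ∙ j Fin.≟ exponent (s + t) | exponent t Fin.≟ j
    ...   | yes _ | yes _ = refl
    ...   | no _ | no _ = refl
    ...   | yes p | no q = ⊥-elim (q (toℕ-injective (trans (toℕ-e t t<M) (sym (+-cancelˡ-≡ s _ _ (trans (sym (shift-toℕ s t j h j≤)) (trans (cong toℕ p) (toℕ-e (s + t) h))))))))
    ...   | no p | yes refl = ⊥-elim (p (toℕ-injective (trans (shift-toℕ s t j h j≤) (trans (cong (s +_) (toℕ-e t t<M)) (sym (toℕ-e (s + t) h))))))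

  -- The full product has degree 2^m - 2 = M - 1, the largest exponent there is. So nothing wraps
  -- around modulo M, the leading coefficient survives, and the product is nonzero.
  top<M : ∀ d → d < m → top d < M
  top<M d h = ≤-pred (≤-trans (≤-trans (≤-reflexive (+-comm 2 (top d))) (≤-trans (≤-reflexive (top≡ d)) (^-monoʳ-≤ 2 h))) (≤-reflexive (sym 2^m)))

  product-top : ∀ d → d < m → lookup (product d) (exponent (top d)) ≡ true × Supported (product d) (top d)
  product-top zero h = trans (lookup∘tabulate _ (exponent 0)) χ-refl , λ k k> → trans (lookup∘tabulate _ k) (off k k>)
    where
    χ-refl : χ (exponent 0) (exponent 0) ≡ true
    χ-refl with exponent 0 Fin.≟ exponent 0
    ... | yes _ = refl
    ... | no ne = ⊥-elim (ne refl)
    off : ∀ k → 0 < toℕ k → χ (exponent 0) k ≡ false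
    off k k> with exponent 0 Fin.≟ k
    ... | no _ = refl
    ... | yes refl = ⊥-elim (<-irrefl (sym (trans (toℕ-exponent 0) (m<n⇒m%n≡m (top<M 0 h)))) k>)
  product-top (suc d) h with product-top d (<⇒≤ h)
  ... | lead , sup = trans (at (exponent (top (suc d)))) (cong₂ _xor_ (trans (shift-top a t g a+t<M sup) lead) (sup₁ (exponent (top (suc d))) (≤-trans 1+t< (≤-reflexive (sym (trans (toℕ-exponent (a + t)) (m<n⇒m%n≡m a+t<M)))))))
      , λ k k> → trans (at k) (cong₂ _xor_ (shift-supported a t g a+t<M sup k k>) (sup₁ k (<-trans 1+t< k>)))
    where
    a = 2 ^ suc d
    t = top d
    g = product d
    a+t<M : a + t < M
    a+t<M = top<M (suc d) h
    1+t< : 1 + t < a + t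
    1+t< = +-monoˡ-< t (≤-trans (s≤s (s≤s z≤n)) (^-monoʳ-≤ 2 (s≤s (z≤n {d}))))
    sup₁ : Supported (X ⊗ g) (1 + t)
    sup₁ = shift-supported 1 t g (<-trans 1+t< a+t<M) sup
    at : ∀ k → lookup (product (suc d)) k ≡ lookup (monomial (exponent a) ⊗ g) k xor lookup (X ⊗ g) k
    at k = trans (cong (λ z → lookup z k) (trans (⊗-distribʳ g (frob (suc d) X) X) (cong (λ z → z ⊗ g ⊕ X ⊗ g) (trans (frob-monomial (suc d) 1) (cong (monomial ∘ exponent) (*-identityʳ a))))))
      (lookup-⊕ (monomial (exponent a) ⊗ g) (X ⊗ g) k)

  u≢0 : ¬ u ≡ 0#
  u≢0 e = true≢false (trans (sym (proj₁ (product-top (suc m′) ≤-refl))) (trans (cong (λ z → lookup z (exponent (top (suc m′)))) e) (lookup∘tabulate (λ _ → false) (exponent (top (suc m′))))))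
    where
    true≢false : ¬ true ≡ false
    true≢false ()

  binary-field′ : BinaryField m
  binary-field′ = field-of-order u≢0

binary-field : ∀ m → 2 ≤ m → BinaryField m
binary-field (suc (suc m′)) _ = Build.binary-field′ m′ (2 ^ suc (suc m′) ∸ 1) ⦃ nonzero ⦄ 2^m
  where
  2^m : suc (2 ^ suc (suc m′) ∸ 1) ≡ 2 ^ suc (suc m′)
  2^m = m+[n∸m]≡n (m^n>0 2 (suc (suc m′)))
  nonzero : NonZero (2 ^ suc (suc m′) ∸ 1)
  nonzero = >-nonZero (+-cancelˡ-≤ 1 1 _ (≤-trans (^-monoʳ-≤ 2 (s≤s (z≤n {suc m′}))) (≤-reflexive (sym 2^m))))
binary-field (suc zero) (s≤s ())

module FixedField (e : ℕ) (1≤e : 1 ≤ e) (𝔽 : BinaryField (e + (e + e))) where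
  open BinaryField 𝔽
  open Roots ring 1≢0 integral

  θ : Carrier → Carrier
  θ = frob e

  θ³ : ∀ x → θ (θ (θ x)) ≡ x
  θ³ x = trans (cong θ (sym (frob-+ e e x))) (trans (sym (frob-+ (e + e) e x)) (trans (cong (λ k → frob k x) (+-comm (e + e) e)) (fermat x)))

  Fix : Set
  Fix = Σ Carrier λ x → θ x ≡ x

  Fix-≡ : ∀ {x y : Fix} → proj₁ x ≡ proj₁ y → x ≡ y
  Fix-≡ {x , p} {.x , q} refl = cong (x ,_) (uip p q)

  fixed-enum : ∃ λ f → Enum Fix f
  fixed-enum = enum-Σ elements (λ x → θ x ≡ x) (λ x → Enum.decide elements (θ x) x) (λ x → uip)

  1<q : 1 < 2 ^ e
  1<q = ^-monoʳ-≤ 2 1≤e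

  few-fixed : proj₁ fixed-enum ≤ 2 ^ e
  few-fixed = root-bound (plus (power (2 ^ e)) 1 1<q 1#) (λ i → proj₁ (Enum.from (proj₂ fixed-enum) i)) (λ h → Enum.from-injective (proj₂ fixed-enum) (Fix-≡ h))
    λ i → root (Enum.from (proj₂ fixed-enum) i)
    where
    root : ∀ (x : Fix) → eval (plus (power (2 ^ e)) 1 1<q 1#) (proj₁ x) ≡ 0#
    root (x , p) = trans (eval-plus (power (2 ^ e)) 1 1<q 1# x) (trans (cong₂ _⊕_ (trans (eval-power (2 ^ e) x) (trans (sym (frob-pow e x)) p)) (trans (⊗-identityˡ _) (⊗-identityʳ x))) (⊕-self x))

  trace : Carrier → Carrier
  trace x = θ (θ x) ⊕ θ x ⊕ x

  trace-fixed : ∀ x → θ (trace x) ≡ trace x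
  trace-fixed x = trans (frob-⊕ e _ x) (trans (cong (_⊕ θ x) (trans (frob-⊕ e _ _) (cong (_⊕ θ (θ x)) (θ³ x))))
    (trans (⊕-assoc x _ _) (⊕-comm x _)))

  -- The trace maps all q³ elements into the fixed field, and each fibre consists of roots of a
  -- polynomial of degree q².
  many-fixed : 2 ^ e ≤ proj₁ fixed-enum
  many-fixed = *-cancelʳ-≤ _ _ (2 ^ (e + e)) ⦃ m^n≢0 2 (e + e) ⦄ (≤-trans (≤-reflexive (sym (^-distribˡ-+-* 2 e (e + e))))
      (fibre-bound (2 ^ (e + e)) elements (proj₂ fixed-enum) (λ x → trace x , trace-fixed x)
        λ y n r inj h → root-bound (fibre (proj₁ y)) r inj λ i → root (proj₁ y) (r i) (cong proj₁ (h i))))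
    where
    Q : ℕ
    Q = 2 ^ (e + e)
    q<Q : 2 ^ e < Q
    q<Q = ^-monoʳ-< 2 (s≤s (s≤s z≤n)) (m<m+n e 1≤e)
    p₁ : Monic Q
    p₁ = plus (power Q) (2 ^ e) q<Q 1#
    p₂ : Monic Q
    p₂ = plus p₁ 1 (<-trans 1<q q<Q) 1#
    fibre : Carrier → Monic Q
    fibre y = plus p₂ 0 (≤-<-trans z≤n q<Q) y
    eval-fibre : ∀ y x → eval (fibre y) x ≡ trace x ⊕ y
    eval-fibre y x = trans (eval-plus p₂ 0 (≤-<-trans z≤n q<Q) y x) (cong₂ _⊕_
      (trans (eval-plus p₁ 1 (<-trans 1<q q<Q) 1# x) (cong₂ _⊕_
        (trans (eval-plus (power Q) (2 ^ e) q<Q 1# x) (cong₂ _⊕_ (trans (eval-power Q x) (trans (sym (frob-pow (e + e) x)) (frob-+ e e x))) (trans (⊗-identityˡ _) (sym (frob-pow e x)))))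
        (trans (⊗-identityˡ _) (⊗-identityʳ x)))) (⊗-identityʳ y))
    root : ∀ y x → trace x ≡ y → eval (fibre y) x ≡ 0#
    root y x refl = trans (eval-fibre y x) (⊕-self y)

  fixed-elements : Enum Fix (2 ^ e)
  fixed-elements = subst (Enum Fix) (≤-antisym few-fixed many-fixed) (proj₂ fixed-enum)

-- Geometries over finite fields

-- Codes number the lines inside a single parallel class, so they need to separate lines of equal
-- slope only.
module Encoded {Point Slope Line Code : Set} (ρ : ℕ) {n m : ℕ} (points : Enum Point n) (slopes : Enum Slope (16 * ρ)) (codes : Enum Code m)
  (lineOf : Slope → Point → Line) (code : Slope → Point → Code) (code-faithful : ∀ κ p q → code κ p ≡ code κ q → lineOf κ p ≡ lineOf κ q) where
  open Walk (decide points) (decide slopes) lineOf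

  line-of : Fin (16 * ρ) → Fin n → Fin m
  line-of κ v = to codes (code (from slopes κ) (from points v))

  same-line : ∀ κ v u → line-of κ v ≡ line-of κ u → lineOf (from slopes κ) (from points v) ≡ lineOf (from slopes κ) (from points u)
  same-line κ v u e = code-faithful _ _ _ (to-injective codes e)

  -- Two distinct common points of lines with different slopes would give a closed walk of length
  -- two.
  two-points : ∀ {ℓ} → 2 ≤ ℓ → Girth ℓ → ∀ κ κ′ v u → line-of κ v ≡ line-of κ u → line-of κ′ v ≡ line-of κ′ u → ¬ v ≡ u → κ ≡ κ′
  two-points 2≤ℓ girth κ κ′ v u e e′ ne with κ ≟ κ′
  ... | yes same = same
  ... | no κ≢κ′ = ⊥-elim (girth (from slopes κ) (same-line κ v u e) (step (from slopes κ′) (from points v) (sym (same-line κ′ v u e′)) []) (s≤s z≤n) 2≤ℓ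
      ((λ h → ne (from-injective points h)) , (λ h → κ≢κ′ (from-injective slopes h)) , (λ h → ne (sym (from-injective points h))) , tt , tt)
      (λ h → κ≢κ′ (from-injective slopes h)))

  module _ (side : Fin (16 * ρ) → Fin n → Bool) where
    open Parity (λ κ p → side (to slopes κ) (to points p))

    Path : ℕ → Bool → Fin n → Fin n → Set
    Path k b v u = Σ[ ω ∈ Walk (from points v) (from points u) ] (length ω ≡ k × parity ω ≡ b)

    stay : ∀ {v} → Path 0 false v v
    stay = [] , refl , refl

    extend : ∀ {k b v u w} → Lines.edge line-of side v u ≡ true → Path k b u w → Path (suc k) (not b) v w
    extend {v = v} {u} h (ω , len , par) with someᵇ-elim (Lines.across line-of side v u) h
    ... | κ , a with line-of κ v ≟ line-of κ u
    ...   | yes e = step (from slopes κ) (from points u) (same-line κ v u e) ω , cong suc len , cong₂ _xor_ (trans (cong₂ _xor_ (at v) (at u)) a) par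
      where
      at : ∀ v → side (to slopes (from slopes κ)) (to points (from points v)) ≡ side κ v
      at v = cong₂ side (to-from slopes κ) (to-from points v)

    no-odd-closed : ∀ {ℓ} → Girth ℓ → ∀ {v} → ¬ Path ℓ true v v
    no-odd-closed girth (ω , len , par) with () ← trans (sym par) (even girth _ ≤-refl ω (≤-reflexive len))

  geometry₅ : Girth 5 → Geometry C₅ n ρ m
  geometry₅ girth = record { line-of = line-of ; two-points = two-points (s≤s (s≤s z≤n)) girth ; no-walk = λ side w h →
    no-odd-closed side girth (extend side (h v₀ v₁ refl) (extend side (h v₁ v₂ refl) (extend side (h v₂ v₃ refl) (extend side (h v₃ v₄ refl) (extend side (h v₄ v₀ refl) (stay side)))))) }
    where
    v₀ v₁ v₂ v₃ v₄ : Fin 5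
    v₀ = zero
    v₁ = suc zero
    v₂ = suc (suc zero)
    v₃ = suc (suc (suc zero))
    v₄ = suc (suc (suc (suc zero)))

  geometry₇ : Girth 7 → Geometry C₇ n ρ m
  geometry₇ girth = record { line-of = line-of ; two-points = two-points (s≤s (s≤s z≤n)) girth ; no-walk = λ side w h →
    no-odd-closed side girth (extend side (h v₀ v₁ refl) (extend side (h v₁ v₂ refl) (extend side (h v₂ v₃ refl) (extend side (h v₃ v₄ refl)
      (extend side (h v₄ v₅ refl) (extend side (h v₅ v₆ refl) (extend side (h v₆ v₀ refl) (stay side)))))))) }
    where
    v₀ v₁ v₂ v₃ v₄ v₅ v₆ : Fin 7
    v₀ = zero
    v₁ = suc zero
    v₂ = suc (suc zero)
    v₃ = suc (suc (suc zero))
    v₄ = suc (suc (suc (suc zero)))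
    v₅ = suc (suc (suc (suc (suc zero))))
    v₆ = suc (suc (suc (suc (suc (suc zero)))))

module OctagonGeometry (j ρ : ℕ) (slopes : 2 ^ (j + suc j) ≡ 16 * ρ) (𝔽 : BinaryField (j + suc j)) where
  open BinaryField 𝔽

  -- Applying `frob (suc j)` twice raises to the power 2^(2j+2), one squaring more than the degree
  -- 2j + 1; hence σ ∘ σ is squaring.
  tits : TitsRing
  tits = record { ring = ring ; σ = frob (suc j) ; σ-⊕ = frob-⊕ (suc j) ; σ-⊗ = frob-⊗ (suc j) ; σ-1 = frob-1 (suc j)
    ; σ-σ = λ x → trans (sym (frob-+ (suc j) (suc j) x)) (fermat (x ⊗ x)) }

  directions : Enum Carrier (16 * ρ)
  directions = subst (Enum Carrier) slopes elements

  open OctagonGirth tits (Enum.decide directions) integral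
  open Formulas (TitsRing.operations tits)

  q = 2 ^ (j + suc j)

  points : Enum Point (q ^ 11)
  points = enum-via (enum-Vec elements 11)
    (λ { (a ∷ b ∷ c ∷ d ∷ e ∷ f ∷ g ∷ h ∷ i ∷ k ∷ l ∷ []) → point a b c d e f (v4 g h i k) l })
    (λ { (point a b c d e f (v4 g h i k) l) → a ∷ b ∷ c ∷ d ∷ e ∷ f ∷ g ∷ h ∷ i ∷ k ∷ l ∷ [] })
    (λ { (point a b c d e f (v4 g h i k) l) → refl }) (λ { (a ∷ b ∷ c ∷ d ∷ e ∷ f ∷ g ∷ h ∷ i ∷ k ∷ l ∷ []) → refl })

  -- All coordinates except the first, which is the slope; nine remain, so a parallel class has q^9
  -- lines.
  tail : Line → Vec Carrier 9
  tail x = c₁ (vec x) ∷ c₂ (vec x) ∷ c₃ (vec x) ∷ mid x ∷ c₀ (mom x) ∷ c₁ (mom x) ∷ c₂ (mom x) ∷ c₃ (mom x) ∷ cub x ∷ []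

  from-tail : ∀ x y → c₀ (vec x) ≡ c₀ (vec y) → tail x ≡ tail y → x ≡ y
  from-tail (line (v4 a b c d) m (v4 e f g h) r) (line (v4 _ _ _ _) _ (v4 _ _ _ _) _) refl refl = refl

  geometry : Geometry C₇ (q ^ 11) ρ (q ^ 9)
  geometry = geometry₇ (girth (Enum.decide points))
    where
    open Encoded ρ points directions (enum-Vec elements 9) lineOf (λ κ p → tail (lineOf κ p))
      (λ κ p q → from-tail _ _ refl)

module HexagonGeometry (e ρ : ℕ) (1≤e : 1 ≤ e) (slopes : 2 ^ e ≡ 16 * ρ) (𝔽 : BinaryField (e + (e + e))) (j : ℕ) (odd : e + (e + e) ≡ j + suc j) where
  open BinaryField 𝔽
  open FixedField e 1≤e 𝔽 using (θ; θ³; Fix; fixed-elements)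

  tits : TitsRing
  tits = record { ring = ring ; σ = frob (suc j) ; σ-⊕ = frob-⊕ (suc j) ; σ-⊗ = frob-⊗ (suc j) ; σ-1 = frob-1 (suc j)
    ; σ-σ = λ x → trans (sym (frob-+ (suc j) (suc j) x)) (trans (cong (λ k → frob k (x ⊗ x)) (sym odd)) (fermat (x ⊗ x))) }

  open HexagonGirth tits integral θ (frob-⊕ e) θ³
  open HexFormulas (TitsRing.operations tits)
  open Point

  q = 2 ^ e
  Q = 2 ^ (e + (e + e))

  fixeds : Enum Fixed q
  fixeds = enum-via fixed-elements (λ { (x , p) → fix x p }) (λ { (fix x p) → x , p }) (λ { (fix x p) → refl }) (λ { (x , p) → refl })

  points : Enum Point (Q ^ 3 * q ^ 2)
  points = enum-via (enum-Vec elements 3 ×ᴱ enum-Vec fixeds 2)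
    (λ { ((a ∷ b ∷ c ∷ []) , (d ∷ e ∷ [])) → point a b c d e }) (λ { (point a b c d e) → (a ∷ b ∷ c ∷ []) , (d ∷ e ∷ []) })
    (λ { (point a b c d e) → refl }) (λ { ((a ∷ b ∷ c ∷ []) , (d ∷ e ∷ [])) → refl })

  ⊗-fixed : ∀ {x y} → θ x ≡ x → θ y ≡ y → θ (x ⊗ y) ≡ x ⊗ y
  ⊗-fixed p r = trans (frob-⊗ e _ _) (cong₂ _⊗_ p r)

  ⊕-fixed : ∀ {x y} → θ x ≡ x → θ y ≡ y → θ (x ⊕ y) ≡ x ⊕ y
  ⊕-fixed p r = trans (frob-⊕ e _ _) (cong₂ _⊕_ p r)

  rotate : ∀ x → θ (x ⊕ θ x ⊕ θ (θ x)) ≡ x ⊕ θ x ⊕ θ (θ x)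
  rotate x = trans (frob-⊕ e _ _) (trans (cong₂ _⊕_ (frob-⊕ e _ _) (θ³ x)) (trans (⊕-comm _ x) (sym (⊕-assoc x _ _))))

  norm-fixed : ∀ b → θ (b ⊗ (θ b ⊗ θ (θ b))) ≡ b ⊗ (θ b ⊗ θ (θ b))
  norm-fixed b = trans (frob-⊗ e b _) (trans (cong (θ b ⊗_) (trans (frob-⊗ e _ _) (cong (θ (θ b) ⊗_) (θ³ b))))
    (trans (sym (⊗-assoc (θ b) _ b)) (⊗-comm _ b)))

  θ-scaled : ∀ {κ} → θ κ ≡ κ → ∀ x y → θ (x ⊕ κ ⊗ y) ≡ θ x ⊕ κ ⊗ θ y
  θ-scaled p x y = trans (frob-⊕ e x _) (cong (θ x ⊕_) (trans (frob-⊗ e _ y) (cong (_⊗ θ y) p)))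

  -- Norms are fixed by θ, and θ permutes the three products of `lin` and `sharp` in `pairing`
  -- cyclically, so the height changes by a fixed element plus a trace.
  cubeᶠ heightᶠ : Fixed → Point → Fixed
  cubeᶠ κ p = fix (cube (lineOf κ p)) (⊕-fixed (Fixed.fixed (cube₀ p)) (⊗-fixed (Fixed.fixed κ) (norm-fixed (at p))))
  heightᶠ κ p = fix (height (lineOf κ p)) (⊕-fixed (⊕-fixed (Fixed.fixed (height₀ p)) (frob-0 e)) (⊕-fixed (⊗-fixed (Fixed.fixed (cube₀ p)) (Fixed.fixed κ))
      (subst (λ z → θ z ≡ z) (cong₂ _⊕_ (cong (a ⊗ (k ⊗ (θ b ⊗ θ (θ b))) ⊕_) first) second) (rotate (a ⊗ (k ⊗ (θ b ⊗ θ (θ b))))))))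
    where
    a = lin₀ p
    b = at p
    k = elt κ
    first : θ (a ⊗ (k ⊗ (θ b ⊗ θ (θ b)))) ≡ θ a ⊗ (k ⊗ (θ (θ b) ⊗ b))
    first = trans (frob-⊗ e a _) (cong (θ a ⊗_) (trans (frob-⊗ e k _) (cong₂ _⊗_ (Fixed.fixed κ) (trans (frob-⊗ e _ _) (cong (θ (θ b) ⊗_) (θ³ b))))))
    second : θ (θ (a ⊗ (k ⊗ (θ b ⊗ θ (θ b))))) ≡ θ (θ a) ⊗ (k ⊗ (b ⊗ θ b))
    second = trans (cong θ first) (trans (frob-⊗ e (θ a) _) (cong (θ (θ a) ⊗_) (trans (frob-⊗ e k _) (cong₂ _⊗_ (Fixed.fixed κ) (trans (frob-⊗ e _ _) (cong (_⊗ θ b) (θ³ b)))))))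

  Code : Set
  Code = Vec Carrier 2 × Vec Fixed 2

  code : Fixed → Point → Code
  code κ p = (lin (lineOf κ p) ∷ sharp (lineOf κ p) ∷ []) , (cubeᶠ κ p ∷ heightᶠ κ p ∷ [])

  lineOf-conjugate : ∀ κ p → lineOf κ p ≡ hex (0# ⊕ elt κ) (lin (lineOf κ p)) (θ (lin (lineOf κ p))) (θ (θ (lin (lineOf κ p))))
    (sharp (lineOf κ p)) (θ (sharp (lineOf κ p))) (θ (θ (sharp (lineOf κ p)))) (cube (lineOf κ p)) (height (lineOf κ p))
  lineOf-conjugate κ p = rebuild (sym (θ-scaled fx a b)) (sym (trans (cong θ (θ-scaled fx a b)) (θ-scaled fx (θ a) (θ b))))
      (sym θs) (sym (trans (cong θ θs) (trans (θ-scaled fx (θ s) _) (cong (λ z → θ (θ s) ⊕ k ⊗ z) (trans (frob-⊗ e _ _) (cong (_⊗ θ b) (θ³ b)))))))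
    where
    a = lin₀ p
    s = sharp₀ p
    b = at p
    k = elt κ
    fx = Fixed.fixed κ
    θs : θ (s ⊕ k ⊗ (θ b ⊗ θ (θ b))) ≡ θ s ⊕ k ⊗ (θ (θ b) ⊗ b)
    θs = trans (θ-scaled fx s _) (cong (λ z → θ s ⊕ k ⊗ z) (trans (frob-⊗ e _ _) (cong (θ (θ b) ⊗_) (θ³ b))))
    rebuild : ∀ {o l l′ l″ m′ m″ r r′ r″ n′ n″ c h} → l′ ≡ m′ → l″ ≡ m″ → r′ ≡ n′ → r″ ≡ n″ → hex o l l′ l″ r r′ r″ c h ≡ hex o l m′ m″ r n′ n″ c h
    rebuild refl refl refl refl = refl

  assemble : Carrier → Code → Hex
  assemble o ((l ∷ s ∷ []) , (c ∷ h ∷ [])) = hex o l (θ l) (θ (θ l)) s (θ s) (θ (θ s)) (elt c) (elt h)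

  geometry : Geometry C₅ (Q ^ 3 * q ^ 2) ρ (Q ^ 2 * q ^ 2)
  geometry = geometry₅ (girth (Enum.decide points) (Enum.decide slopes′))
    where
    slopes′ : Enum Fixed (16 * ρ)
    slopes′ = subst (Enum Fixed) slopes fixeds
    open Encoded ρ points slopes′ (enum-Vec elements 2 ×ᴱ enum-Vec fixeds 2) lineOf code
      (λ κ p r h → trans (lineOf-conjugate κ p) (trans (cong (assemble (0# ⊕ elt κ)) h) (sym (lineOf-conjugate κ r))))

-- The order of the field

last-before : ∀ {P : ℕ → Set} → (∀ i → Dec (P i)) → P 0 → ∀ b → ¬ P b → ∃ λ i → P i × ¬ P (suc i)
last-before P? p₀ zero ¬p = ⊥-elim (¬p p₀)
last-before P? p₀ (suc b) ¬p with P? b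
... | yes p = b , p , ¬p
... | no ¬p′ = last-before P? p₀ b ¬p′

^-reflects-≤ : ∀ {a b} → 2 ^ a < 2 ^ suc b → a ≤ b
^-reflects-≤ h = ≮⇒≥ λ lt → <⇒≱ h (^-monoʳ-≤ 2 lt)

dyadic : ∀ t → 1 ≤ t → ∃ λ k → 2 ^ k ≤ t × t < 2 ^ suc k
dyadic t 1≤t = drop (last-before (λ i → 2 ^ i ≤? t) 1≤t t (<⇒≱ (n<2^n t)))
  where
  n<2^n : ∀ n → n < 2 ^ n
  n<2^n zero = s≤s z≤n
  n<2^n (suc n) = ≤-trans (+-mono-≤ (m^n>0 2 n) (n<2^n n)) (≤-reflexive (cong (2 ^ n +_) (sym (+-identityʳ _))))
  drop : (∃ λ i → 2 ^ i ≤ t × ¬ 2 ^ suc i ≤ t) → ∃ λ k → 2 ^ k ≤ t × t < 2 ^ suc k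
  drop (i , p , ¬p) = i , p , ≰⇒> ¬p

double-square : ∀ y → 3 ≤ y → suc y * suc y ≤ 2 * (y * y)
double-square y 3≤y = begin
  suc y * suc y ≡⟨ expand y ⟩
  y * y + (y + y + 1) ≤⟨ +-monoʳ-≤ (y * y) (≤-trans (+-monoʳ-≤ (y + y) (≤-trans (s≤s z≤n) 3≤y)) (≤-trans (≤-reflexive (three y)) (*-monoˡ-≤ y 3≤y))) ⟩
  y * y + y * y ≡⟨ cong (y * y +_) (sym (+-identityʳ _)) ⟩
  2 * (y * y) ∎
  where
  open ≤-Reasoning
  expand : ∀ y → suc y * suc y ≡ y * y + (y + y + 1)
  expand = solve-∀
  three : ∀ y → y + y + y ≡ 3 * y
  three = solve-∀

square≤2^ : ∀ c e → 3 ≤ c → c * c ≤ 2 ^ e → ∀ x → (c + x) * (c + x) ≤ 2 ^ (e + x)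
square≤2^ c e 3≤c base zero = subst₂ (λ a b → a * a ≤ 2 ^ b) (sym (+-identityʳ c)) (sym (+-identityʳ e)) base
square≤2^ c e 3≤c base (suc x) = subst₂ (λ a b → a * a ≤ 2 ^ b) (sym (+-suc c x)) (sym (+-suc e x))
  (≤-trans (double-square (c + x) (≤-trans 3≤c (m≤m+n c x))) (*-monoʳ-≤ 2 (square≤2^ c e 3≤c base x)))

scaled-square≤2^ : ∀ c e f → 3 ≤ c → c * c ≤ 2 ^ e → f + e ≤ c → ∀ k → c ≤ k → 2 ^ f * (k * k) ≤ 2 ^ k
scaled-square≤2^ c e f 3≤c base f+e≤c k c≤k = begin
  2 ^ f * (k * k) ≤⟨ *-monoʳ-≤ (2 ^ f) (subst (λ y → y * y ≤ 2 ^ (e + (k ∸ c))) (m+[n∸m]≡n c≤k) (square≤2^ c e 3≤c base (k ∸ c))) ⟩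
  2 ^ f * 2 ^ (e + (k ∸ c)) ≡⟨ sym (^-distribˡ-+-* 2 f (e + (k ∸ c))) ⟩
  2 ^ (f + (e + (k ∸ c))) ≤⟨ ^-monoʳ-≤ 2 (≤-trans (≤-reflexive (sym (+-assoc f e (k ∸ c)))) (≤-trans (+-monoˡ-≤ (k ∸ c) f+e≤c) (≤-reflexive (m+[n∸m]≡n c≤k)))) ⟩
  2 ^ k ∎
  where open ≤-Reasoning

-- 2 ^ (4 + w i) is the order of the fields used; the exponents 4 + w i are odd and increase in steps of 2.
w : ℕ → ℕ
w i = i + suc (4 + i)

w-suc : ∀ i → w (suc i) ≡ 2 + w i
w-suc i = cong suc (+-suc i (suc (4 + i)))

5≤w : ∀ i → 5 ≤ w i
5≤w i = ≤-trans (s≤s (m≤m+n 4 i)) (m≤n+m (suc (4 + i)) i)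

linear<exponential : ∀ c s v e → s ≤ v * 2 ^ e → c < v * 2 ^ e → ∀ x → c + x * s < v * 2 ^ (e + x)
linear<exponential c s v e s≤ c< zero = subst₂ (λ a b → a < v * 2 ^ b) (sym (+-identityʳ c)) (sym (+-identityʳ e)) c<
linear<exponential c s v e s≤ c< (suc x) = begin-strict
  c + (s + x * s) ≡⟨ swap c s (x * s) ⟩
  s + (c + x * s) <⟨ +-mono-≤-< (≤-trans s≤ (*-monoʳ-≤ v (^-monoʳ-≤ 2 (m≤m+n e x)))) (linear<exponential c s v e s≤ c< x) ⟩
  v * 2 ^ (e + x) + v * 2 ^ (e + x) ≡⟨ double v (2 ^ (e + x)) ⟩
  v * 2 ^ suc (e + x) ≡⟨ cong (λ k → v * 2 ^ k) (sym (+-suc e x)) ⟩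
  v * 2 ^ (e + suc x) ∎
  where
  open ≤-Reasoning
  swap : ∀ c s z → c + (s + z) ≡ s + (c + z)
  swap = solve-∀
  double : ∀ v z → v * z + v * z ≡ v * (2 * z)
  double = solve-∀

power-bound : ∀ x m n → suc (x * m) < n → 2 * (2 ^ x) ^ m < 2 ^ n
power-bound x m n h = subst (λ z → 2 * z < 2 ^ n) (sym (^-*-assoc 2 x m)) (^-monoʳ-< 2 (s≤s (s≤s z≤n)) {suc (x * m)} {n} h)

-- In exponents this is 11 (4 + b) + 1 < 5 · 2^b. At b = 5 it reads 100 < 160, and from there the
-- right side doubles while the left grows by 11.
few-points : ∀ b → 5 ≤ b → 2 * (2 ^ (4 + b)) ^ 11 < 2 ^ (5 * 2 ^ b)
few-points b 5≤b = power-bound (4 + b) 11 (5 * 2 ^ b) (exponents b 5≤b)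
  where
  exponents : ∀ b → 5 ≤ b → suc ((4 + b) * 11) < 5 * 2 ^ b
  exponents b 5≤b = subst₂ _<_ (cong suc (trans (sym (*-distribʳ-+ 11 9 (b ∸ 5))) (cong (λ b → (4 + b) * 11) (m+[n∸m]≡n 5≤b))))
    (cong (λ b → 5 * 2 ^ b) (m+[n∸m]≡n 5≤b)) (linear<exponential 100 11 5 5 (≤ᵇ⇒≤ 11 160 _) (≤ᵇ⇒≤ 101 160 _) (b ∸ 5))

-- A parallel class has q^(d+1) lines, and f is the exponent left over from the q^11 points: (d, f)
-- is (7, 3) for the hexagon and (8, 2) for the octagon. Large sets have at least `X` points, 64 for
-- each line of a class, and `M` is the inverse density of neighbourhoods.
module Choice {ℓ} {H : Graph ℓ} (d f : ℕ) (f+d : f + suc d ≡ 11) (f≤d : f ≤ d) (7≤d : 7 ≤ d) (ν : ℕ) (ν≥ : 4 * (4 * 16) * 16 ≤ ν)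
  (a q ρ : ℕ) (q≡2^a : q ≡ 2 ^ a) (q≡ : q ≡ 16 * ρ) (few-points : 2 * q ^ 11 < 2 ^ (5 * ρ)) (geometry : Geometry H (q ^ 11) ρ (q ^ suc d))
  (t k : ℕ) (1≤k : 1 ≤ k) (t< : t < 2 ^ suc k) (admissible : 4 * ν * (k * k) * q ^ d ≤ t) where
    y points X M E : ℕ
    y = q ^ d
    points = q ^ 11
    X = 4 * 16 * q ^ suc d
    M = ν * y
    E = a * f

    q^ : ∀ j → q ^ j ≡ 2 ^ (a * j)
    q^ j = trans (cong (_^ j) q≡2^a) (^-*-assoc 2 a j)

    1≤q^ : ∀ j → 1 ≤ q ^ j
    1≤q^ j = subst (1 ≤_) (sym (q^ j)) (m^n>0 2 (a * j))

    1≤ν : 1 ≤ ν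
    1≤ν = ≤-trans (s≤s z≤n) ν≥

    da≤k : a * d ≤ k
    da≤k = ^-reflects-≤ (≤-<-trans (≤-trans (≤-reflexive (sym (q^ d))) (≤-trans (m≤n*m y (4 * ν * (k * k)) ⦃ >-nonZero positive ⦄) admissible)) t<)
      where
      positive : 1 ≤ 4 * ν * (k * k)
      positive = *-mono-≤ (*-mono-≤ {1} {4} (s≤s z≤n) 1≤ν) (*-mono-≤ 1≤k 1≤k)

    fa≤k : a * f ≤ k
    fa≤k = ≤-trans (*-monoʳ-≤ a f≤d) da≤k

    11a≤2k : a * 11 ≤ 2 * k
    11a≤2k = ≤-trans (*-monoʳ-≤ a (≤-trans (≤ᵇ⇒≤ 11 14 _) (*-monoʳ-≤ 2 7≤d))) (≤-trans (≤-reflexive (trans (cong (a *_) (*-comm 2 d)) (trans (sym (*-assoc a d 2)) (*-comm (a * d) 2)))) (*-monoʳ-≤ 2 da≤k))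

    -- There are `M * E` rounds of peeling, each costing a factor of at most 2^(4k). Since also E ≤
    -- k, two factors k appear; this is the origin of k² in `admissible`.
    exponent≤ : (a * 11 + suc k) * (M * E) ≤ t
    exponent≤ = begin
      (a * 11 + suc k) * (M * E) ≤⟨ *-mono-≤ (+-mono-≤ 11a≤2k (+-monoˡ-≤ k 1≤k)) (*-monoʳ-≤ M fa≤k) ⟩
      (2 * k + (k + k)) * (ν * y * k) ≡⟨ cong (_* (ν * y * k)) (four k) ⟩
      (4 * k) * (ν * y * k) ≡⟨ regroup 4 ν k y ⟩
      4 * ν * (k * k) * y ≤⟨ admissible ⟩
      t ∎
      where
      open ≤-Reasoning
      four : ∀ k → 2 * k + (k + k) ≡ 4 * k
      four = solve-∀
      regroup : ∀ α β k y → (α * k) * (β * y * k) ≡ α * β * (k * k) * y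
      regroup = solve-∀

    base≤ : 1 + points * t ≤ 2 ^ (a * 11 + suc k)
    base≤ = begin
      1 + points * t ≤⟨ *-monoʳ-< points ⦃ >-nonZero (1≤q^ 11) ⦄ t< ⟩
      points * 2 ^ suc k ≡⟨ cong (_* 2 ^ suc k) (q^ 11) ⟩
      2 ^ (a * 11) * 2 ^ suc k ≡⟨ sym (^-distribˡ-+-* 2 (a * 11) (suc k)) ⟩
      2 ^ (a * 11 + suc k) ∎
      where open ≤-Reasoning

    words≤ : (1 + points * t) ^ (M * E) ≤ 2 ^ t
    words≤ = ≤-trans (^-monoˡ-≤ (M * E) base≤) (≤-trans (≤-reflexive (^-*-assoc 2 (a * 11 + suc k) (M * E))) (^-monoʳ-≤ 2 exponent≤))

    few-lines : 4 * (16 * ρ * q ^ suc d) ≤ ρ * X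
    few-lines = ≤-reflexive (regroup 4 16 ρ (q ^ suc d))
      where
      regroup : ∀ α β ρ y → α * (β * ρ * y) ≡ ρ * (α * β * y)
      regroup = solve-∀

    -- Since q = 16ρ, the left side is 4 · 64 · 16 · ρ q^d, which is the source of the lower bound
    -- 4096 for ν.
    wide : 4 * X ≤ M * ρ
    wide = ≤-trans (≤-reflexive (trans (cong (λ q → 4 * (4 * 16 * (q * y))) q≡) (regroup 4 (4 * 16) 16 ρ y))) (*-monoˡ-≤ ρ (*-monoˡ-≤ y ν≥))
      where
      regroup : ∀ α β γ ρ y → α * (β * (γ * ρ * y)) ≡ α * β * γ * y * ρ
      regroup = solve-∀

    q^f+d : q ^ f * q ^ suc d ≡ points
    q^f+d = trans (sym (^-distribˡ-+-* q f (suc d))) (cong (q ^_) f+d)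

    n≤ : points ≤ 2 ^ E * X
    n≤ = ≤-trans (≤-reflexive (sym q^f+d)) (*-mono-≤ (≤-reflexive (q^ f)) (m≤n*m (q ^ suc d) (4 * 16)))

    cliques : ∀ s → 1 ≤ s → s ≤ t → ∀ N → 16 * (4 * 16) * N < q ^ f * t → ∀ v (G : Graph v) → IsRamsey H (K t) G → N C s ≤ numKs s G
    cliques s 1≤s s≤t N small = FromGeometry.Ramsey-cliques geometry X M E (*-mono-≤ {1} {4 * 16} (s≤s z≤n) (1≤q^ (suc d))) (*-mono-≤ 1≤ν (1≤q^ d))
        few-lines few-points wide n≤ t s 1≤s s≤t words≤ N (begin-strict
          16 * N * X ≡⟨ regroup 16 (4 * 16) N (q ^ suc d) ⟩
          16 * (4 * 16) * N * q ^ suc d <⟨ *-monoˡ-< (q ^ suc d) ⦃ >-nonZero (1≤q^ (suc d)) ⦄ small ⟩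
          q ^ f * t * q ^ suc d ≡⟨ trans (*-assoc (q ^ f) t _) (trans (cong (q ^ f *_) (*-comm t _)) (sym (*-assoc (q ^ f) _ t))) ⟩
          q ^ f * q ^ suc d * t ≡⟨ cong (_* t) q^f+d ⟩
          points * t ∎)
      where
      open ≤-Reasoning
      regroup : ∀ α β N z → α * N * (β * z) ≡ α * β * N * z
      regroup = solve-∀

-- Compare t ^ m * t ^ r with its bound through t < A k² q ^ d, using d r = f m to turn the powers of q into (q ^ f t) ^ m.
size-bound : ∀ {t A B Γ k q N L} d f m r u → 1 ≤ r → d * r ≡ f * m → r + r ≤ u → 1 ≤ t → 1 ≤ k → k ≤ L → t < A * (k * k) * q ^ d → A ^ r * B ^ m ≤ Γ ^ m
  → Γ ^ m * N ^ m * L ^ u ≤ t ^ (m + r) → B * N < q ^ f * t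
size-bound {t} {A} {B} {Γ} {k} {q} {N} {L} d f m (suc r′) u _ dr≡fm 2r≤u 1≤t 1≤k k≤L t< constants h = ≰⇒> λ large → <-irrefl refl (begin-strict
  t ^ (m + r) ≡⟨ ^-distribˡ-+-* t m r ⟩
  t ^ m * t ^ r <⟨ *-monoʳ-< (t ^ m) ⦃ >-nonZero (m^n>0 t ⦃ >-nonZero 1≤t ⦄ m) ⦄ (^-monoˡ-< r t<) ⟩
  t ^ m * (A * (k * k) * q ^ d) ^ r ≡⟨ cong (t ^ m *_) (trans (^-distribʳ-* r (A * (k * k)) (q ^ d)) (cong₂ _*_ (^-distribʳ-* r A (k * k)) (^-*-assoc q d r))) ⟩
  t ^ m * (A ^ r * (k * k) ^ r * q ^ (d * r)) ≡⟨ cong (λ z → t ^ m * (A ^ r * (k * k) ^ r * z)) (trans (cong (q ^_) dr≡fm) (sym (^-*-assoc q f m))) ⟩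
  t ^ m * (A ^ r * (k * k) ^ r * (q ^ f) ^ m) ≡⟨ collect (t ^ m) (A ^ r) ((k * k) ^ r) ((q ^ f) ^ m) ⟩
  A ^ r * (k * k) ^ r * ((q ^ f) ^ m * t ^ m) ≡⟨ cong (A ^ r * (k * k) ^ r *_) (sym (^-distribʳ-* m (q ^ f) t)) ⟩
  A ^ r * (k * k) ^ r * (q ^ f * t) ^ m ≤⟨ *-monoʳ-≤ (A ^ r * (k * k) ^ r) (^-monoˡ-≤ m large) ⟩
  A ^ r * (k * k) ^ r * (B * N) ^ m ≡⟨ cong (A ^ r * (k * k) ^ r *_) (^-distribʳ-* m B N) ⟩
  A ^ r * (k * k) ^ r * (B ^ m * N ^ m) ≡⟨ regroup (A ^ r) ((k * k) ^ r) (B ^ m) (N ^ m) ⟩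
  A ^ r * B ^ m * N ^ m * (k * k) ^ r ≤⟨ *-mono-≤ (*-monoˡ-≤ (N ^ m) constants) squares ⟩
  Γ ^ m * N ^ m * L ^ u ≤⟨ h ⟩
  t ^ (m + r) ∎)
  where
  open ≤-Reasoning
  r = suc r′
  collect : ∀ a b c e → a * (b * c * e) ≡ b * c * (e * a)
  collect = solve-∀
  regroup : ∀ a b c e → a * b * (c * e) ≡ a * c * e * b
  regroup = solve-∀
  squares : (k * k) ^ r ≤ L ^ u
  squares = ≤-trans (≤-reflexive (trans (^-distribʳ-* r k k) (sym (^-distribˡ-+-* k r r)))) (≤-trans (^-monoʳ-≤ k ⦃ >-nonZero 1≤k ⦄ 2r≤u) (^-monoˡ-≤ u k≤L))

module Family {ℓ} {H : Graph ℓ} (d f : ℕ) (f+d : f + suc d ≡ 11) (f≤d : f ≤ d) (7≤d : 7 ≤ d) (ν : ℕ) (ν≥ : 4 * (4 * 16) * 16 ≤ ν)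
  (geometry : ∀ i → Geometry H ((2 ^ (4 + w i)) ^ 11) (2 ^ w i) ((2 ^ (4 + w i)) ^ suc d)) where

  order : ℕ → ℕ
  order i = 2 ^ (4 + w i)

  order-suc : ∀ i → order (suc i) ^ d ≡ (2 ^ 2) ^ d * order i ^ d
  order-suc i = trans (cong (λ z → (2 ^ (4 + z)) ^ d) (w-suc i)) (trans (cong (_^ d) (trans (cong (2 ^_) (+-comm 4 (2 + w i)) ) (trans (cong (2 ^_) (trans (+-assoc 2 (w i) 4) (cong (2 +_) (+-comm (w i) 4)))) (^-distribˡ-+-* 2 2 (4 + w i)))))
    (^-distribʳ-* d (2 ^ 2) (order i)))

  module _ (t k : ℕ) (1≤k : 1 ≤ k) (t< : t < 2 ^ suc k) (start : 4 * ν * (k * k) * order 0 ^ d ≤ t) where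
    Admissible : ℕ → Set
    Admissible i = 4 * ν * (k * k) * order i ^ d ≤ t

    positive : 1 ≤ 4 * ν * (k * k)
    positive = *-mono-≤ (*-mono-≤ {1} {4} (s≤s z≤n) (≤-trans (s≤s z≤n) ν≥)) (*-mono-≤ 1≤k 1≤k)

    inadmissible : ¬ Admissible k
    inadmissible h = <⇒≱ t< (≤-trans (^-monoʳ-≤ 2 (≤-trans (s≤s (m≤m+n k (suc (4 + k)))) (m≤n+m (suc (w k)) 3)))
      (≤-trans (≤-trans (≤-reflexive (sym (^-identityʳ (order k)))) (^-monoʳ-≤ (order k) ⦃ m^n≢0 2 (4 + w k) ⦄ (≤-trans (s≤s z≤n) 7≤d)))
        (≤-trans (m≤n*m (order k ^ d) (4 * ν * (k * k)) ⦃ >-nonZero positive ⦄) h)))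

    -- The largest admissible order is used. One index further q grows by the factor 4 and
    -- admissibility fails, so t is below 4^d · 4ν k² q^d; this is the upper bound on t that turns
    -- q^f t into a power of t. The condition 2r ≤ u compares the resulting k^(2r) with the power of
    -- the logarithm.
    cliques : ∀ {L Γ} m r u → 1 ≤ r → d * r ≡ f * m → r + r ≤ u → 1 ≤ t → k ≤ L → (4 * ν * (2 ^ 2) ^ d) ^ r * (16 * (4 * 16)) ^ m ≤ Γ ^ m →
      ∀ s → 1 ≤ s → s ≤ t → ∀ N → Γ ^ m * N ^ m * L ^ u ≤ t ^ (m + r) → ∀ v (G : Graph v) → IsRamsey H (K t) G → N C s ≤ numKs s G
    cliques m r u 1≤r dr≡fm 2r≤u 1≤t k≤L constants s 1≤s s≤t N h = use (last-before (λ i → 4 * ν * (k * k) * order i ^ d ≤? t) start k inadmissible)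
      where
      rearrange : ∀ a b c e → a * b * (c * e) ≡ a * c * b * e
      rearrange = solve-∀
      use : (∃ λ i → Admissible i × ¬ Admissible (suc i)) → ∀ v (G : Graph v) → IsRamsey H (K t) G → N C s ≤ numKs s G
      use (i , admissible , maximal) = Choice.cliques d f f+d f≤d 7≤d ν ν≥ (4 + w i) (order i) (2 ^ w i) refl (^-distribˡ-+-* 2 4 (w i)) (few-points (w i) (5≤w i)) (geometry i)
        t k 1≤k t< admissible s 1≤s s≤t N
        (size-bound {A = 4 * ν * (2 ^ 2) ^ d} {B = 16 * (4 * 16)} d f m r u 1≤r dr≡fm 2r≤u 1≤t 1≤k k≤L
          (≤-trans (≰⇒> maximal) (≤-reflexive (trans (cong (4 * ν * (k * k) *_) (order-suc i)) (rearrange (4 * ν) (k * k) ((2 ^ 2) ^ d) (order i ^ d))))) constants h)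

log-lower : ∀ {k t} → 2 ^ k ≤ t → k ≤ ⌊log₂ t ⌋
log-lower {k} h = ≤-trans (≤-reflexive (sym (⌊log₂[2^n]⌋≡n k))) (⌊log₂⌋-mono-≤ h)

octagons : ∀ i → Geometry C₇ ((2 ^ (4 + w i)) ^ 11) (2 ^ w i) ((2 ^ (4 + w i)) ^ 9)
octagons i = OctagonGeometry.geometry (4 + i) (2 ^ w i) (^-distribˡ-+-* 2 4 (w i)) (binary-field (4 + w i) (s≤s (s≤s z≤n)))

hexagons : ∀ i → Geometry C₅ ((2 ^ (4 + w i)) ^ 11) (2 ^ w i) ((2 ^ (4 + w i)) ^ 8)
hexagons i = resize (4 + w i) (HexagonGeometry.geometry (4 + w i) (2 ^ w i) (s≤s z≤n) (^-distribˡ-+-* 2 4 (w i))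
    (binary-field (4 + w i + (4 + w i + (4 + w i))) (s≤s (s≤s z≤n))) (3 * (4 + i) + 1) (odd (4 + i)))
  where
  odd : ∀ x → (x + suc x) + ((x + suc x) + (x + suc x)) ≡ (3 * x + 1) + suc (3 * x + 1)
  odd = solve-∀
  cube : ∀ e → 2 ^ (e + (e + e)) ≡ (2 ^ e) ^ 3
  cube e = trans (cong (2 ^_) (triple e)) (sym (^-*-assoc 2 e 3))
    where
    triple : ∀ e → e + (e + e) ≡ e * 3
    triple = solve-∀
  powers : ∀ q j → (q ^ 3) ^ j * q ^ 2 ≡ q ^ (3 * j + 2)
  powers q j = trans (cong (_* q ^ 2) (^-*-assoc q 3 j)) (sym (^-distribˡ-+-* q (3 * j) 2))
  resize : ∀ e {ρ} → Geometry C₅ ((2 ^ (e + (e + e))) ^ 3 * (2 ^ e) ^ 2) ρ ((2 ^ (e + (e + e))) ^ 2 * (2 ^ e) ^ 2) → Geometry C₅ ((2 ^ e) ^ 11) ρ ((2 ^ e) ^ 8)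
  resize e {ρ} = subst₂ (λ n m → Geometry C₅ n ρ m) (trans (cong (λ Q → Q ^ 3 * (2 ^ e) ^ 2) (cube e)) (powers (2 ^ e) 3))
    (trans (cong (λ Q → Q ^ 2 * (2 ^ e) ^ 2) (cube e)) (powers (2 ^ e) 2))

-- The smallest order of the family is admissible as soon as 2^k outgrows a fixed multiple of k².
start : ∀ a F {k t} → a ≤ 2 ^ F → 2 ^ F * (k * k) ≤ 2 ^ k → 2 ^ k ≤ t → ∀ α z → α * z ≡ a → α * (k * k) * z ≤ t
start a F {k} a≤ sq k≤ α z refl = ≤-trans (≤-reflexive (regroup α (k * k) z)) (≤-trans (*-monoˡ-≤ (k * k) a≤) (≤-trans sq k≤))
  where
  regroup : ∀ α x z → α * x * z ≡ α * z * x
  regroup = solve-∀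

200²≤2^114 : 200 * 200 ≤ 2 ^ 114
200²≤2^114 = ≤-trans (≤ᵇ⇒≤ 40000 65536 _) (^-monoʳ-≤ 2 (≤ᵇ⇒≤ 16 114 _))

-- With c = p/q, the bounds on N are raised to the seventh and fourth power to avoid real exponents.
-- Quantifying over all such N includes the floor of the bound.
theorem3p5 : ∃ λ (p : ℕ) → ∃ λ (q : ℕ) → ∃ λ (t₀ : ℕ) →
      1 ≤ p × 1 ≤ q ×
      (∀ (t s : ℕ) → t₀ ≤ t → 1 ≤ s → s ≤ t →
        (∀ (n : ℕ) (G : Graph n) → IsRamsey C₅ (K t) G →
          ∀ (N : ℕ) → q ^ 7 * N ^ 7 * ⌊log₂ t ⌋ ^ 13 ≤ p ^ 7 * t ^ 10 →
          N C s ≤ numKs s G)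
        ×
        (∀ (n : ℕ) (G : Graph n) → IsRamsey C₇ (K t) G →
          ∀ (N : ℕ) → q ^ 4 * N ^ 4 * ⌊log₂ t ⌋ ^ 6 ≤ p ^ 4 * t ^ 5 →
          N C s ≤ numKs s G))
-- For the hexagon the constants give (2^28)^3 (2^10)^7 = (2^22)^7, hence c = 2^(-22); the octagon
-- needs less. For t₀, the smallest order 2^9 in the octagon requires 2^14 · 2^72 · k² = 2^86 k² ≤
-- t, which holds from k = 200 on because 200² ≤ 2^114 and 86 + 114 = 200.
theorem3p5 = 1 , Γ , 2 ^ 200 , s≤s z≤n , m^n>0 2 22 , λ t s t₀≤t 1≤s s≤t → bounds t s t₀≤t 1≤s s≤t (dyadic t (≤-trans 1≤s s≤t))
  where
  Γ : ℕ
  Γ = 2 ^ 22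
  module _ (t s : ℕ) (t₀≤t : 2 ^ 200 ≤ t) (1≤s : 1 ≤ s) (s≤t : s ≤ t) where
    bounds : (∃ λ k → 2 ^ k ≤ t × t < 2 ^ suc k) →
        (∀ (n : ℕ) (G : Graph n) → IsRamsey C₅ (K t) G → ∀ (N : ℕ) → Γ ^ 7 * N ^ 7 * ⌊log₂ t ⌋ ^ 13 ≤ 1 ^ 7 * t ^ 10 → N C s ≤ numKs s G)
      × (∀ (n : ℕ) (G : Graph n) → IsRamsey C₇ (K t) G → ∀ (N : ℕ) → Γ ^ 4 * N ^ 4 * ⌊log₂ t ⌋ ^ 6 ≤ 1 ^ 4 * t ^ 5 → N C s ≤ numKs s G)
    bounds (k , k≤ , t<) =
        (λ n G ramsey N h → Family.cliques 7 3 refl (≤ᵇ⇒≤ 3 7 _) (≤ᵇ⇒≤ 7 7 _) 4096 (≤ᵇ⇒≤ 4096 4096 _) hexagons t k 1≤k t<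
          (start _ 86 {k} {t} (≤ᵇ⇒≤ (4 * 4096 * (2 ^ 9) ^ 7) (2 ^ 86) _) squares k≤ (4 * 4096) ((2 ^ 9) ^ 7) refl)
          {⌊log₂ t ⌋} {Γ} 7 3 13 (s≤s z≤n) refl (≤ᵇ⇒≤ 6 13 _) 1≤t k≤log (≤ᵇ⇒≤ ((4 * 4096 * (2 ^ 2) ^ 7) ^ 3 * (16 * (4 * 16)) ^ 7) (Γ ^ 7) _) s 1≤s s≤t N
          (≤-trans h (≤-reflexive (*-identityˡ (t ^ 10)))) n G ramsey)
      , (λ n G ramsey N h → Family.cliques 8 2 refl (≤ᵇ⇒≤ 2 8 _) (≤ᵇ⇒≤ 7 8 _) 4096 (≤ᵇ⇒≤ 4096 4096 _) octagons t k 1≤k t<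
          (start _ 86 {k} {t} (≤ᵇ⇒≤ (4 * 4096 * (2 ^ 9) ^ 8) (2 ^ 86) _) squares k≤ (4 * 4096) ((2 ^ 9) ^ 8) refl)
          {⌊log₂ t ⌋} {Γ} 4 1 6 (s≤s z≤n) refl (≤ᵇ⇒≤ 2 6 _) 1≤t k≤log (≤ᵇ⇒≤ ((4 * 4096 * (2 ^ 2) ^ 8) ^ 1 * (16 * (4 * 16)) ^ 4) (Γ ^ 4) _) s 1≤s s≤t N
          (≤-trans h (≤-reflexive (*-identityˡ (t ^ 5)))) n G ramsey)
      where
      200≤k : 200 ≤ k
      200≤k = ^-reflects-≤ (≤-<-trans t₀≤t t<)
      1≤k : 1 ≤ k
      1≤k = ≤-trans (s≤s z≤n) 200≤k
      1≤t : 1 ≤ t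
      1≤t = ≤-trans 1≤s s≤t
      k≤log : k ≤ ⌊log₂ t ⌋
      k≤log = log-lower k≤
      squares : 2 ^ 86 * (k * k) ≤ 2 ^ k
      squares = scaled-square≤2^ 200 114 86 (s≤s (s≤s (s≤s z≤n))) 200²≤2^114 (≤ᵇ⇒≤ 200 200 _) k 200≤k
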